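{- Let $\mathscr Z=\sum_{n\ge1}\widetilde W_{C_n}(b,w_-,w_+)/|\operatorname{Aut}C_n|$, regarded as a formal power series in $b,w_-,w_+$ (each $\widetilde W_{C_n}$ is homogeneous of degree $n$). Substitute $$b\gets\mathscr T_b,\qquad w_+\gets\mathscr T_w^++\mathscr T_w^-,\qquad w_-\gets t^{ -1}\mathscr T_w^++t\,\mathscr T_w^-.$$ The result is the series $\mathscr W_1(x)$.
   Context: Graphs may have loops and parallel edges. A coloring is $c\colon V\to\{0,1\}$ ($0$ white, $1$ black). For a vertex $v$, its black-neighbor count is the number of edges joining $v$ to black vertices, with multiplicity, loops not counted. Full $W$-polynomial: $\widetilde W_K=\sum_c b^{\#\text{black}}w_+^{\#\text{white with even count}}w_-^{\#\text{white with odd count}}$; black-white polynomial $W_K(t)=\sum_c t^{\#\text{white vertices with even count}}$. $C_n$ is the $n$-cycle, where $C_1$ is a vertex with a loop and $C_2$ is two vertices joined by two parallel edges; $|\operatorname{Aut}C_n|=2n$. $\operatorname{Aut}$ includes permutations of vertices and parallel edges and flips/permutations of loops. $\Gamma(g)$ is the set of isomorphism classes of connected graphs with first Betti number $g$ ($=1-|V|+|E|$), and $\mathscr W_g(x)=\sum_{G\in\Gamma(g)}W_G(t)x^{v(G)}/|\operatorname{Aut}G|$, $v(G)$ the number of vertices. Rooted tree series: with sums over isomorphism classes of rooted trees $T$ (root-preserving automorphisms) and colorings $c$, $\mathscr T_w^+$ (resp. $\mathscr T_w^-$, $\mathscr T_b$) is $\sum t^{\#\{\text{white vertices with even count}\}}x^{v(T)}/|\operatorname{Aut}T|$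 over pairs $(T,c)$ whose root is white with an even number of black children (resp. white with an odd number of black children; black). -}

module Defs where

open import Data.Bool using (Bool; true; false; not; _∧_; _∨_; if_then_else_)
open import Data.Nat as ℕ using (ℕ; zero; suc; _∸_)
open import Data.Nat.DivMod using (_mod_)
open import Data.Integer as ℤ using (ℤ; +_)
open import Data.Rational as ℚ using (ℚ; 0ℚ; 1ℚ)
open import Data.Fin as Fin using (Fin; toℕ)
open import Data.Fin.Properties using () renaming (_≟_ to _≟F_)
open import Data.Sum using (_⊎_)
open import Data.Product using (_×_; _,_; proj₁; proj₂; Σ; ∃)
open import Data.List as List using (List; []; _∷_; _++_; map; concat; concatMap; allFin; upTo; length; foldr; lookup)
open import Data.List.Relation.Unary.All using (All)
open import Data.Bool.ListAction using (all)
open import Data.Nat.ListAction using () renaming (sum to sumℕ)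
open import Data.Vec as Vec using (Vec)
open import Relation.Binary.PropositionalEquality using (_≡_)
open import Relation.Nullary.Decidable using (⌊_⌋)
open import Function.Bundles using (_↔_; Inverse)

-- Multigraphs (loops and parallel edges allowed).
-- Vertices Fin nv, edges Fin ne; each edge has an (arbitrarily ordered)
-- pair of end-vertices; a loop has equal ends.

record Graph : Set where
  constructor graph
  field
    nv   : ℕ
    ne   : ℕ
    ends : Fin ne → Fin nv × Fin nv
open Graph public

orient : ∀ {A : Set} → Bool → A × A → A × A
orient false p       = p
orient true  (a , b) = (b , a)

mapPair : ∀ {A B : Set} → (A → B) → A × A → B × B
mapPair f (a , b) = (f a , f b)

record Iso (G H : Graph) : Set where
  field
    σ      : Fin (nv G) ↔ Fin (nv H)
    τ      : Fin (ne G) ↔ Fin (ne H)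
    ε      : Fin (ne G) → Bool
    compat : ∀ e → ends H (Inverse.to τ e)
                   ≡ orient (ε e) (mapPair (Inverse.to σ) (ends G e))

data Walk (G : Graph) : Fin (nv G) → Fin (nv G) → Set where
  here : ∀ {u} → Walk G u u
  step : ∀ {u w v} (e : Fin (ne G)) →
         (ends G e ≡ (u , w) ⊎ ends G e ≡ (w , u)) →
         Walk G w v → Walk G u v

Connected : Graph → Set
Connected G = Fin (nv G) × (∀ u v → Walk G u v)

betti : Graph → ℤ
betti G = (+ 1 ℤ.- + nv G) ℤ.+ + ne G

record RootedTree : Set where
  constructor rtree
  field
    tree : Graph
    root : Fin (nv tree)
open RootedTree public

IsRootedTree : RootedTree → Set
IsRootedTree T = Connected (tree T) × betti (tree T) ≡ + 0

record RIso (T U : RootedTree) : Set where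
  field
    iso      : Iso (tree T) (tree U)
    rootPres : Inverse.to (Iso.σ iso) (root T) ≡ root U

record IsRepSystem {X : Set} (_≅_ : X → X → Set) (P : X → Set) (L : List X) : Set where
  field
    allP     : All P L
    complete : ∀ x → P x → ∃ λ (i : Fin (length L)) → x ≅ lookup L i
    distinct : ∀ (i j : Fin (length L)) → lookup L i ≅ lookup L j → i ≡ j

allVecs : ∀ {A : Set} (n : ℕ) → List A → List (Vec A n)
allVecs zero    xs = Vec.[] ∷ []
allVecs (suc n) xs = concatMap (λ x → map (x Vec.∷_) (allVecs n xs)) xs

bools : List Bool
bools = false ∷ true ∷ []

allFuns : ∀ {A : Set} (n : ℕ) → List A → List (Fin n → A)
allFuns n xs = map Vec.lookup (allVecs n xs)

eqF : ∀ {n} → Fin n → Fin n → Bool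
eqF i j = ⌊ i ≟F j ⌋

eqP : ∀ {n} → Fin n × Fin n → Fin n × Fin n → Bool
eqP (a , b) (c , d) = eqF a c ∧ eqF b d

injB : ∀ {n} → (Fin n → Fin n) → Bool
injB {n} f = all (λ i → all (λ j → not (eqF (f i) (f j)) ∨ eqF i j) (allFin n)) (allFin n)

countB : ∀ {A : Set} → (A → Bool) → List A → ℕ
countB p xs = sumℕ (map (λ x → if p x then 1 else 0) xs)

-- is (σ, τ, ε) an automorphism of G (σ, τ bijections on finite sets,
-- equivalently injections)
isAutB : (G : Graph) → (Fin (nv G) → Fin (nv G)) → (Fin (ne G) → Fin (ne G)) →
         (Fin (ne G) → Bool) → Bool
isAutB G σ τ ε = injB σ ∧ injB τ ∧
  all (λ e → eqP (ends G (τ e)) (orient (ε e) (mapPair σ (ends G e)))) (allFin (ne G))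

autCountWith : (G : Graph) → ((Fin (nv G) → Fin (nv G)) → Bool) → ℕ
autCountWith G p =
  sumℕ (map (λ σ → sumℕ (map (λ τ →
      countB (λ ε → p σ ∧ isAutB G σ τ ε) (allFuns (ne G) bools))
    (allFuns (ne G) (allFin (ne G)))))
   (allFuns (nv G) (allFin (nv G))))

autCount : Graph → ℕ
autCount G = autCountWith G (λ _ → true)

autCountR : RootedTree → ℕ
autCountR T = autCountWith (tree T) (λ σ → eqF (σ (root T)) (root T))

-- Colorings: true = black (1), false = white (0).

blackCount : (G : Graph) → (Fin (nv G) → Bool) → Fin (nv G) → ℕ
blackCount G c v = countB edgeOK (allFin (ne G))
  where
  edgeOK : Fin (ne G) → Bool
  edgeOK e with ends G e
  ... | (a , b) = not (eqF a b) ∧ ((eqF a v ∧ c b) ∨ (eqF b v ∧ c a))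

isEven : ℕ → Bool
isEven zero          = true
isEven (suc zero)    = false
isEven (suc (suc n)) = isEven n

whiteEven : (G : Graph) → (Fin (nv G) → Bool) → ℕ
whiteEven G c = countB (λ v → not (c v) ∧ isEven (blackCount G c v)) (allFin (nv G))

whiteOdd : (G : Graph) → (Fin (nv G) → Bool) → ℕ
whiteOdd G c = countB (λ v → not (c v) ∧ not (isEven (blackCount G c v))) (allFin (nv G))

blacks : (G : Graph) → (Fin (nv G) → Bool) → ℕ
blacks G c = countB c (allFin (nv G))

colorings : (G : Graph) → List (Fin (nv G) → Bool)
colorings G = allFuns (nv G) bools

-- Laurent polynomials in t over ℚ as formal finite sums of monomials
-- q t^k (list of (k , q)), compared via their coefficients.

LP : Set
LP = List (ℤ × ℚ)

coeff : LP → ℤ → ℚ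
coeff []            k = 0ℚ
coeff ((e , q) ∷ p) k = (if ⌊ e ℤ.≟ k ⌋ then q else 0ℚ) ℚ.+ coeff p k

_⊗_ : LP → LP → LP
p ⊗ r = concatMap (λ { (a , x) → map (λ { (b , y) → (a ℤ.+ b , x ℚ.* y) }) r }) p

scaleLP : ℚ → LP → LP
scaleLP q = map (λ { (e , x) → (e , q ℚ.* x) })

shiftLP : ℤ → LP → LP
shiftLP k = map (λ { (e , x) → (e ℤ.+ k , x) })

Series : Set
Series = ℕ → LP

_+S_ : Series → Series → Series
(f +S g) N = f N ++ g N

_*S_ : Series → Series → Series
(f *S g) N = concatMap (λ i → f i ⊗ g (N ∸ i)) (upTo (suc N))

oneS : Series
oneS zero    = (+ 0 , 1ℚ) ∷ []
oneS (suc _) = []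

shiftS : ℤ → Series → Series
shiftS k f N = shiftLP k (f N)

prodS : List Series → Series
prodS = foldr _*S_ oneS

-- 1/k (k = |Aut| is always ≥ 1; the value at 0 is irrelevant)
inv : ℕ → ℚ
inv zero    = 0ℚ
inv (suc k) = + 1 ℚ./ suc k

WLP : Graph → LP
WLP G = map (λ c → (+ whiteEven G c , 1ℚ)) (colorings G)

-- 𝒲_1(x): given, for each N, a system of representatives RG N of the
-- isomorphism classes of connected graphs with Betti number 1 and N vertices.
W1 : (ℕ → List Graph) → Series
W1 RG N = concatMap (λ G → scaleLP (inv (autCount G)) (WLP G)) (RG N)

-- Rooted tree series, given for each m a system of representatives RT m
-- of the isomorphism classes of rooted trees with m vertices.
treeSeries : (T : RootedTree) → ((Fin (nv (tree T)) → Bool) → Bool) → LP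
treeSeries T cond =
  concatMap (λ c → if cond c then (+ whiteEven (tree T) c , 1ℚ) ∷ [] else [])
            (colorings (tree T))

TSeriesWith : (ℕ → List RootedTree) →
              ((T : RootedTree) → (Fin (nv (tree T)) → Bool) → Bool) → Series
TSeriesWith RT cond m =
  concatMap (λ T → scaleLP (inv (autCountR T)) (treeSeries T (cond T))) (RT m)

Tw⁺ : (ℕ → List RootedTree) → Series
Tw⁺ RT = TSeriesWith RT (λ T c → not (c (root T)) ∧ isEven (blackCount (tree T) c (root T)))

Tw⁻ : (ℕ → List RootedTree) → Series
Tw⁻ RT = TSeriesWith RT (λ T c → not (c (root T)) ∧ not (isEven (blackCount (tree T) c (root T))))

Tb : (ℕ → List RootedTree) → Series
Tb RT = TSeriesWith RT (λ T c → c (root T))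

-- The cycle C_n (n ≥ 1): vertices Fin n, edge i joins i and i+1 mod n.
-- C_1 is a vertex with a loop, C_2 two vertices with two parallel edges.

nextF : ∀ {n} → Fin n → Fin n
nextF {suc k} i = suc (toℕ i) mod (suc k)

cycle : ℕ → Graph
cycle n = graph n n (λ i → (i , nextF i))

-- W̃_{C_n}(b, w₋, w₊) with the substitution
--   b ← Tb,  w₊ ← Tw⁺ + Tw⁻,  w₋ ← t⁻¹ Tw⁺ + t Tw⁻
-- applied monomial by monomial (each coloring c gives the monomial
-- b^#black w₊^#white-even w₋^#white-odd = product over the vertices).
substW : (ℕ → List RootedTree) → (n : ℕ) → Series
substW RT n x = concatMap (λ c → prodS (map (vsub c) (allFin n)) x) (colorings (cycle n))
  where
  B Wp Wm : Series
  B  = Tb RT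
  Wp = Tw⁺ RT +S Tw⁻ RT
  Wm = shiftS (ℤ.- + 1) (Tw⁺ RT) +S shiftS (+ 1) (Tw⁻ RT)
  vsub : (Fin n → Bool) → Fin n → Series
  vsub c v = if c v then B
             else (if isEven (blackCount (cycle n) c v) then Wp else Wm)

-- 𝒵 after substitution: Σ_{n ≥ 1} W̃_{C_n}(subst) / |Aut C_n|.
-- Coefficient of x^N: only n ≤ N contribute (every substituted series
-- has zero constant term).
substZ : (ℕ → List RootedTree) → Series
substZ RT N = concatMap (λ n → scaleLP (inv (autCount (cycle n))) (substW RT n N))
                        (List.map suc (upTo N))

{-# OPTIONS --safe #-}
module Submission where

-- Both sides are masses of groupoids. Gluing the roots of trees T₁, …, Tₙ onto the
-- vertices of Cₙ gives a connected graph of Betti number 1, and every such graph G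
-- arises so: delete an edge e₀ = ab whose removal leaves G connected, let every vertex
-- v ≠ a own the first edge of a shortest path to a in G − e₀ and let a own e₀; following
-- owned edges is a self-map whose periodic orbit is the cycle and whose transient
-- parts are the trees. Bridges are exactly the tree edges, so an isomorphism of glued
-- graphs is an automorphism ψ of Cₙ together with rooted isomorphisms Tᵢ → S_{ψ i}.
-- Hence ∑_T |Iso(glue T, G)| / ∏ |Aut Tᵢ| = |Aut Cₙ|, that is, the gluings
-- isomorphic to G have total mass 1 / |Aut G|. A cycle vertex sees its neighbours on the
-- cycle besides its tree children, which is what the three substitutions record.

open import Defs
open import Algebra.Bundles using (CommutativeSemiring)
import Algebra.Properties.CommutativeMonoid.Sum as MonoidSum
import Algebra.Properties.Semiring.Sum as SemiringSum
open import Data.Bool as Bool using (Bool; true; false; not; _∧_; _∨_; if_then_else_; _xor_)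
open import Data.Bool.ListAction using (all)
import Data.Bool.Properties as Bool
open import Data.Empty using (⊥; ⊥-elim)
open import Data.Fin as Fin using (Fin; zero; suc; toℕ; _↑ˡ_; _↑ʳ_; splitAt; fromℕ<; combine; remQuot)
open import Data.Fin.Permutation using (↔⇒≡)
import Data.Fin.Properties as Fin
open import Data.Integer as ℤ using (ℤ; +_)
import Data.Integer.Properties as ℤ
import Data.Integer.Solver as ℤ
open import Data.List as List using (List; []; _∷_; _++_; map; concatMap; allFin; upTo; applyUpTo; tabulate; length; lookup; cartesianProductWith)
open import Data.List.Membership.Propositional using (_∈_)
open import Data.List.Membership.Propositional.Properties using (∈-map⁺; ∈-cartesianProductWith⁺; ∈-allFin; ∈-lookup)
import Data.List.Membership.Setoid as MemS
import Data.List.Membership.Setoid.Properties as MemS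
import Data.List.Properties as List
open import Data.List.Relation.Unary.All as All using (All; []; _∷_)
open import Data.List.Relation.Unary.AllPairs using ([]; _∷_)
open import Data.List.Relation.Unary.Any as Any using (here; there; Any)
import Data.List.Relation.Unary.Any.Properties as Any
import Data.List.Relation.Unary.Unique.Propositional as UniqueP
import Data.List.Relation.Unary.Unique.Propositional.Properties as UniqueP
import Data.List.Relation.Unary.Unique.Setoid as UniqueS
import Data.List.Relation.Unary.Unique.Setoid.Properties as UniqueSP
open import Data.Nat as ℕ using (ℕ; zero; suc; _<_; s≤s; _%_; _/_; NonZero; _∸_)
import Data.Nat.DivMod as ℕ
open import Data.Nat.GeneralisedArithmetic using (fold; fold-+)
open import Data.Nat.ListAction using () renaming (sum to sumℕ)
import Data.Nat.Properties as ℕ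
import Data.Nat.Solver as ℕ
open import Data.Product using (_×_; _,_; proj₁; proj₂; Σ; ∃; uncurry; ∃₂)
open import Data.Product.Properties using (≡-dec)
open import Data.Rational as ℚ using (ℚ; 0ℚ; 1ℚ)
import Data.Rational.Properties as ℚ
import Data.Rational.Solver as ℚ
import Data.Rational.Unnormalised as ℚᵘ
import Data.Rational.Unnormalised.Properties as ℚᵘ
open import Data.Sum as Sum using (_⊎_; inj₁; inj₂; [_,_]′)
open import Data.Sum.Function.Propositional using (_⊎-↔_)
open import Data.Sum.Properties using (inj₁-injective; inj₂-injective)
open import Data.Unit using (⊤; tt)
open import Data.Vec as Vec using (Vec)
import Data.Vec.Properties as Vec
open import Function using (_∘_; id; _↔_; Inverse; mk↔ₛ′; Injective)
open import Function.Construct.Composition using (_↔-∘_)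
open import Function.Construct.Identity using (↔-id)
open import Function.Construct.Symmetry using (↔-sym)
open import Level using (0ℓ)
open import Relation.Binary using (Setoid; tri<; tri≈; tri>; DecidableEquality)
open import Relation.Binary.PropositionalEquality as ≡ using (_≡_; _≢_; refl; cong; cong₂; subst; sym; trans; _≗_; _→-setoid_)
import Relation.Binary.Reasoning.Setoid as SetoidReasoning
open import Relation.Nullary using (yes; no; contradiction; Dec; ¬_)
open import Relation.Nullary.Decidable using (⌊_⌋; _×-dec_; _⊎-dec_; ¬?; decidable-stable)

-- Finite sums

-- Three obstacles shape the proof. Isomorphisms contain functions, which are compared pointwise
-- only, so every count is the cardinality of a setoid, and two counts agree because they enumerate
-- the same setoid. The flag `ε` is forced by the vertex and edge maps except at a loop, where both
-- values occur. Thus a loop contributes its flip, $C_1$ and $C_2$ need no separate treatment, and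
-- an automorphism of the cycle has to carry vertex map, edge map and flags together. The double
-- count weighs each tuple of trees by its number of isomorphisms to a representative graph. In this
-- way no starting vertex or direction on the cycle is ever normalised. Laurent polynomials are
-- compared through arbitrary linear functionals `φ` on the powers of $t$. Multiplication by a power
-- of $t$ becomes a translation of `φ`, so an induction over the factors of a product goes through
-- once its claim holds for all `φ`.

encΣ : ∀ {n} (g : Fin n → ℕ) (i : Fin n) → Fin (g i) → Fin (SemiringSum.sum ℕ.+-*-semiring g)
encΣ g zero    x = x ↑ˡ _
encΣ g (suc i) x = g zero ↑ʳ encΣ (g ∘ suc) i x

decΣ : ∀ {n} (g : Fin n → ℕ) → Fin (SemiringSum.sum ℕ.+-*-semiring g) → Σ (Fin n) (Fin ∘ g)
decΣ {suc n} g k with splitAt (g zero) k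
... | inj₁ x = zero , x
... | inj₂ y with decΣ (g ∘ suc) y
...   | i , x = suc i , x

dec-encΣ : ∀ {n} (g : Fin n → ℕ) i x → decΣ g (encΣ g i x) ≡ (i , x)
dec-encΣ {suc n} g zero x
  rewrite Fin.splitAt-↑ˡ (g zero) x (SemiringSum.sum ℕ.+-*-semiring (g ∘ suc)) = refl
dec-encΣ {suc n} g (suc i) x
  rewrite Fin.splitAt-↑ʳ (g zero) (SemiringSum.sum ℕ.+-*-semiring (g ∘ suc)) (encΣ (g ∘ suc) i x)
        | dec-encΣ (g ∘ suc) i x = refl

enc-decΣ : ∀ {n} (g : Fin n → ℕ) k → encΣ g (proj₁ (decΣ g k)) (proj₂ (decΣ g k)) ≡ k
enc-decΣ {suc n} g k with splitAt (g zero) k in eq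
... | inj₁ x = Fin.splitAt⁻¹-↑ˡ eq
... | inj₂ y with decΣ (g ∘ suc) y in eq′
...   | i , x = ≡.trans (cong (g zero ↑ʳ_)
                  (≡.trans (cong (λ p → encΣ (g ∘ suc) (proj₁ p) (proj₂ p)) (≡.sym eq′)) (enc-decΣ (g ∘ suc) y)))
                  (Fin.splitAt⁻¹-↑ʳ eq)

Fin-Σ : ∀ {n} (g : Fin n → ℕ) → Fin (SemiringSum.sum ℕ.+-*-semiring g) ↔ Σ (Fin n) (Fin ∘ g)
Fin-Σ g = mk↔ₛ′ (decΣ g) (λ p → encΣ g (proj₁ p) (proj₂ p)) (λ p → dec-encΣ g _ _) (enc-decΣ g)

-- Stated over any commutative semiring because three are used: `ℕ` for counts, `ℚ` for masses, `ℤ`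
-- for exponents.
module Sums (R : CommutativeSemiring 0ℓ 0ℓ) where
  open CommutativeSemiring R hiding (zero) renaming (Carrier to C; refl to ≈-refl; sym to ≈-sym; trans to ≈-trans)
  open SemiringSum semiring public using
    (sum; sum-cong-≋; sum-permute; ∑-distrib-+; ∑-comm; *-distribˡ-sum; *-distribʳ-sum; sum-replicate-zero)
  open MonoidSum *-commutativeMonoid public using () renaming
    (sum to prod; sum-cong-≋ to prod-cong; ∑-distrib-+ to prod-distrib-*)
  open SetoidReasoning setoid

  sum-zero : ∀ {n} {f : Fin n → C} → (∀ i → f i ≈ 0#) → sum f ≈ 0#
  sum-zero {n} f≈0 = ≈-trans (sum-cong-≋ f≈0) (sum-replicate-zero n)

  sum-single : ∀ {n} {f : Fin n → C} j → (∀ i → i ≢ j → f i ≈ 0#) → sum f ≈ f j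
  sum-single {suc n} zero    z = ≈-trans (+-congˡ (sum-zero λ i → z (suc i) λ ())) (+-identityʳ _)
  sum-single {suc n} (suc j) z = ≈-trans (+-cong (z zero λ ())
    (sum-single j λ i i≢j → z (suc i) (i≢j ∘ Fin.suc-injective))) (+-identityˡ _)

  prod-one : ∀ {n} {f : Fin n → C} → (∀ i → f i ≈ 1#) → prod f ≈ 1#
  prod-one {zero}  f≈1 = ≈-refl
  prod-one {suc n} f≈1 = ≈-trans (*-cong (f≈1 zero) (prod-one (f≈1 ∘ suc))) (*-identityˡ 1#)

  sum-+ : ∀ m n (f : Fin (m ℕ.+ n) → C) → sum f ≈ sum (f ∘ (_↑ˡ n)) + sum (f ∘ (m ↑ʳ_))
  sum-+ zero    n f = ≈-sym (+-identityˡ _)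
  sum-+ (suc m) n f = ≈-trans (+-congˡ (sum-+ m n (f ∘ suc))) (≈-sym (+-assoc _ _ _))

  sum-Σ : ∀ {n} (g : Fin n → ℕ) (f : Fin _ → C) → sum f ≈ sum (λ i → sum (f ∘ encΣ g i))
  sum-Σ {zero}  g f = ≈-refl
  sum-Σ {suc n} g f = ≈-trans (sum-+ (g zero) _ f) (+-congˡ (sum-Σ (g ∘ suc) (f ∘ (g zero ↑ʳ_))))

  ∑ : ∀ {A : Set} → List A → (A → C) → C
  ∑ L f = sum (f ∘ lookup L)

  ∑-cong : ∀ {A : Set} (L : List A) {f g : A → C} → (∀ x → f x ≈ g x) → ∑ L f ≈ ∑ L g
  ∑-cong L h = sum-cong-≋ (λ i → h (lookup L i))

  ∑-++ : ∀ {A : Set} (L M : List A) (f : A → C) → ∑ (L ++ M) f ≈ ∑ L f + ∑ M f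
  ∑-++ []      M f = ≈-sym (+-identityˡ _)
  ∑-++ (x ∷ L) M f = ≈-trans (+-congˡ (∑-++ L M f)) (≈-sym (+-assoc _ _ _))

  ∑-map : ∀ {A B : Set} (h : A → B) (L : List A) (f : B → C) → ∑ (map h L) f ≈ ∑ L (f ∘ h)
  ∑-map h []      f = ≈-refl
  ∑-map h (x ∷ L) f = +-congˡ (∑-map h L f)

  ∑-concatMap : ∀ {A B : Set} (h : A → List B) (L : List A) (f : B → C) →
                ∑ (concatMap h L) f ≈ ∑ L (λ x → ∑ (h x) f)
  ∑-concatMap h []      f = ≈-refl
  ∑-concatMap h (x ∷ L) f = ≈-trans (∑-++ (h x) (concatMap h L) f) (+-congˡ (∑-concatMap h L f))

  ∑-tabulate : ∀ {A : Set} {n} (g : Fin n → A) (f : A → C) → ∑ (tabulate g) f ≈ sum (f ∘ g)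
  ∑-tabulate {n = zero}  g f = ≈-refl
  ∑-tabulate {n = suc n} g f = +-congˡ (∑-tabulate (g ∘ suc) f)

  ∑-applyUpTo : ∀ {A : Set} (g : ℕ → A) n (f : A → C) → ∑ (applyUpTo g n) f ≈ sum {n} (f ∘ g ∘ toℕ)
  ∑-applyUpTo g zero    f = ≈-refl
  ∑-applyUpTo g (suc n) f = +-congˡ (∑-applyUpTo (g ∘ suc) n f)

  ∑-+ : ∀ {A : Set} (L : List A) (f g : A → C) → ∑ L (λ x → f x + g x) ≈ ∑ L f + ∑ L g
  ∑-+ L f g = ∑-distrib-+ (f ∘ lookup L) (g ∘ lookup L)

  ∑-*ˡ : ∀ {A : Set} (L : List A) x (f : A → C) → x * ∑ L f ≈ ∑ L (λ y → x * f y)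
  ∑-*ˡ L x f = *-distribˡ-sum x (f ∘ lookup L)

  ∑-*ʳ : ∀ {A : Set} (L : List A) x (f : A → C) → ∑ L f * x ≈ ∑ L (λ y → f y * x)
  ∑-*ʳ L x f = *-distribʳ-sum x (f ∘ lookup L)

  ∑-swap : ∀ {A B : Set} (L : List A) (M : List B) (f : A → B → C) →
           ∑ L (λ x → ∑ M (f x)) ≈ ∑ M (λ y → ∑ L (λ x → f x y))
  ∑-swap L M f = ∑-comm (λ i j → f (lookup L i) (lookup M j))

  ∑-allVecs-suc : ∀ {A : Set} n (L : List A) (f : Vec A (suc n) → C) →
                  ∑ (allVecs (suc n) L) f ≈ ∑ L (λ x → ∑ (allVecs n L) (λ v → f (x Vec.∷ v)))
  ∑-allVecs-suc n L f = ≈-trans (∑-concatMap (λ x → map (x Vec.∷_) (allVecs n L)) L f) (∑-cong L λ x → ∑-map (x Vec.∷_) (allVecs n L) f)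

  -- Expanding the product picks one entry of `L` per factor. This is what lets the trees at
  -- different cycle positions be summed independently.
  ∑-prod : ∀ {A : Set} n (L : List A) (g : Fin n → A → C) →
           ∑ (allVecs n L) (λ v → prod (λ i → g i (Vec.lookup v i))) ≈ prod (λ i → ∑ L (g i))
  ∑-prod zero    L g = +-identityʳ _
  ∑-prod (suc n) L g = begin
    ∑ (allVecs (suc n) L) (λ v → prod (λ i → g i (Vec.lookup v i)))
      ≈⟨ ∑-allVecs-suc n L (λ v → prod (λ i → g i (Vec.lookup v i))) ⟩
    ∑ L (λ x → ∑ (allVecs n L) (λ v → g zero x * prod (λ i → g (suc i) (Vec.lookup v i))))
      ≈⟨ ∑-cong L (λ x → ≈-sym (∑-*ˡ (allVecs n L) (g zero x) (λ v → prod (λ i → g (suc i) (Vec.lookup v i))))) ⟩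
    ∑ L (λ x → g zero x * ∑ (allVecs n L) (λ v → prod (λ i → g (suc i) (Vec.lookup v i))))
      ≈⟨ ≈-sym (∑-*ʳ L _ (g zero)) ⟩
    ∑ L (g zero) * ∑ (allVecs n L) (λ v → prod (λ i → g (suc i) (Vec.lookup v i)))
      ≈⟨ *-congˡ (∑-prod n L (g ∘ suc)) ⟩
    prod (λ i → ∑ L (g i)) ∎

module ΣN = Sums ℕ.+-*-commutativeSemiring
module ΣQ = Sums (Algebra.Bundles.CommutativeRing.commutativeSemiring ℚ.+-*-commutativeRing)

-- Cardinalities of setoids and automorphism counts

private
  module S = Setoid

-- Pigeonhole: a missed value `y`, put in front of the values of `f`, would give an injection from
-- `Fin (suc n)` to `Fin n`.
inj⇒surj : ∀ {n} {f : Fin n → Fin n} → Injective _≡_ _≡_ f → ∀ y → ∃ λ x → f x ≡ y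
inj⇒surj {n} {f} f-inj y with Fin.any? (λ x → f x Fin.≟ y)
... | yes p = p
... | no ¬p = contradiction (Fin.injective⇒≤ g-inj) ℕ.1+n≰n
  where
  g : Fin (suc n) → Fin n
  g zero    = y
  g (suc x) = f x
  g-inj : Injective _≡_ _≡_ g
  g-inj {zero}  {zero}  _ = refl
  g-inj {zero}  {suc b} e = contradiction (b , sym e) ¬p
  g-inj {suc a} {zero}  e = contradiction (a , e) ¬p
  g-inj {suc a} {suc b} e = cong suc (f-inj e)

inj-surj⇒↔ : ∀ {A B : Set} (f : A → B) → Injective _≡_ _≡_ f → (∀ y → ∃ λ x → f x ≡ y) → A ↔ B
inj-surj⇒↔ f f-inj f-surj =
  mk↔ₛ′ f (proj₁ ∘ f-surj) (proj₂ ∘ f-surj) (λ x → f-inj (proj₂ (f-surj (f x))))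

inj⇒↔ : ∀ {m n} → m ≡ n → (f : Fin m → Fin n) → Injective _≡_ _≡_ f → Fin m ↔ Fin n
inj⇒↔ refl f f-inj = inj-surj⇒↔ f f-inj (inj⇒surj f-inj)

↔-injective : ∀ {A B : Set} (f : A ↔ B) → Injective _≡_ _≡_ (Inverse.to f)
↔-injective f {x} {y} e = trans (sym (Inverse.strictlyInverseʳ f x))
  (trans (cong (Inverse.from f) e) (Inverse.strictlyInverseʳ f y))

-- Enumeration up to the equality of the setoid, since colourings and isomorphisms are identified
-- only pointwise.
record IsEnum (S : Setoid 0ℓ 0ℓ) {n : ℕ} (at : Fin n → S.Carrier S) : Set where
  constructor enum
  open Setoid S
  field
    at-inj  : ∀ i j → at i ≈ at j → i ≡ j
    at-surj : ∀ x → ∃ λ i → at i ≈ x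
open IsEnum public

record Card (S : Setoid 0ℓ 0ℓ) (n : ℕ) : Set where
  constructor card
  field
    {at}   : Fin n → S.Carrier S
    isEnum : IsEnum S at
open Card public using (isEnum)

module _ (S : Setoid 0ℓ 0ℓ) where
  open Setoid S using (_≈_) renaming (Carrier to X; sym to ≈-sym; trans to ≈-trans)

  Card-≤ : ∀ {m n} → Card S m → Card S n → m ℕ.≤ n
  Card-≤ {m} {n} (card {a} A) (card {b} B) = Fin.injective⇒≤ {f = f} λ {i} {j} e →
    at-inj A i j (≈-trans (≈-sym (proj₂ (at-surj B (a i))))
      (subst (λ k → b k ≈ a j) (sym e) (proj₂ (at-surj B (a j)))))
    where
    f : Fin m → Fin n
    f i = proj₁ (at-surj B (a i))

  -- The source of the numerical identities: isomorphisms onto a fixed graph are enumerated in two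
  -- ways and the counts compared.
  Card-unique : ∀ {m n} → Card S m → Card S n → m ≡ n
  Card-unique A B = ℕ.≤-antisym (Card-≤ A B) (Card-≤ B A)

Card-map : (S S′ : Setoid 0ℓ 0ℓ) (f : S.Carrier S → S.Carrier S′) →
           (∀ {x y} → S._≈_ S x y → S._≈_ S′ (f x) (f y)) →
           (∀ {x y} → S._≈_ S′ (f x) (f y) → S._≈_ S x y) →
           (∀ y → ∃ λ x → S._≈_ S′ (f x) y) →
           ∀ {n} → Card S n → Card S′ n
Card-map S S′ f f-cong f-inj f-surj (card {a} A) = card {at = f ∘ a} (enum
  (λ i j e → at-inj A i j (f-inj e))
  (λ y → let (x , e) = f-surj y ; (i , e′) = at-surj A x in i , S.trans S′ (f-cong e′) e))

Card-empty : (S : Setoid 0ℓ 0ℓ) → (S.Carrier S → ⊥) → Card S 0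
Card-empty S ¬s = card {at = λ ()} (enum (λ ()) (λ x → ⊥-elim (¬s x)))

Unique⇒IsEnum : (S : Setoid 0ℓ 0ℓ) {L : List (S.Carrier S)} → UniqueS.Unique S L →
                (∀ x → ∃ λ i → S._≈_ S (lookup L i) x) → IsEnum S (lookup L)
Unique⇒IsEnum S {L} u c = enum (inj u) c
  where
  open Setoid S using (_≈_)
  inj : ∀ {L} → UniqueS.Unique S L → ∀ i j → lookup L i ≈ lookup L j → i ≡ j
  inj (_ ∷ _)  zero    zero    e = refl
  inj {_ ∷ L} (x∉ ∷ _) zero    (suc j) e = contradiction e (All.lookup x∉ (∈-lookup {xs = L} j))
  inj {_ ∷ L} (x∉ ∷ _) (suc i) zero    e = contradiction (S.sym S e) (All.lookup x∉ (∈-lookup {xs = L} i))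
  inj (_ ∷ u)  (suc i) (suc j) e = cong suc (inj u i j e)

allVecs-suc : ∀ {A : Set} n (xs : List A) →
              allVecs (suc n) xs ≡ cartesianProductWith Vec._∷_ xs (allVecs n xs)
allVecs-suc n xs = go xs
  where
  go : ∀ ys → List.concatMap (λ x → map (x Vec.∷_) (allVecs n xs)) ys
            ≡ cartesianProductWith Vec._∷_ ys (allVecs n xs)
  go []       = refl
  go (y ∷ ys) = cong (map (y Vec.∷_) (allVecs n xs) ++_) (go ys)

allVecs-Unique : ∀ {A : Set} n {xs : List A} → UniqueP.Unique xs → UniqueP.Unique (allVecs n xs)
allVecs-Unique zero    u = [] ∷ []
allVecs-Unique (suc n) {xs} u = subst UniqueP.Unique (sym (allVecs-suc n xs))
  (UniqueP.cartesianProductWith⁺ Vec._∷_ Vec.∷-injective u (allVecs-Unique n u))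

∈-allVecs : ∀ {A : Set} n {xs : List A} → (∀ x → x ∈ xs) → ∀ v → v ∈ allVecs n xs
∈-allVecs zero    c Vec.[] = here refl
∈-allVecs (suc n) {xs} c (x Vec.∷ v) = subst (x Vec.∷ v ∈_) (sym (allVecs-suc n xs))
  (∈-cartesianProductWith⁺ Vec._∷_ (c x) (∈-allVecs n c v))

lookup-≗⇒≡ : ∀ {A : Set} {n} {v w : Vec A n} → Vec.lookup v ≗ Vec.lookup w → v ≡ w
lookup-≗⇒≡ {v = v} {w} e =
  trans (sym (Vec.tabulate∘lookup v)) (trans (Vec.tabulate-cong e) (Vec.tabulate∘lookup w))

allFuns-isEnum : ∀ {A : Set} n {xs : List A} → UniqueP.Unique xs → (∀ x → x ∈ xs) →
                 IsEnum (Fin n →-setoid A) (lookup (allFuns n xs))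
allFuns-isEnum {A} n {xs} u c = Unique⇒IsEnum (Fin n →-setoid A)
  (UniqueSP.map⁺ (≡.setoid _) (Fin n →-setoid A) lookup-≗⇒≡ (allVecs-Unique n u))
  λ f → let m = ∈-map⁺ Vec.lookup (∈-allVecs n c (Vec.tabulate f)) in
    Any.index m , λ x → trans (cong (λ g → g x) (sym (Any.lookup-index m))) (Vec.lookup∘tabulate f x)

bools-Unique : UniqueP.Unique bools
bools-Unique = ((λ ()) ∷ []) ∷ [] ∷ []

∈-bools : ∀ b → b ∈ bools
∈-bools false = here refl
∈-bools true  = there (here refl)

∧-true : ∀ {a b} → a ∧ b ≡ true → a ≡ true × b ≡ true
∧-true {true} {true} e = refl , refl

true-∧ : ∀ {a b} → a ≡ true → b ≡ true → a ∧ b ≡ true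
true-∧ refl refl = refl

dec⇒true : ∀ {P : Set} (p? : Dec P) → P → ⌊ p? ⌋ ≡ true
dec⇒true (yes _) p = refl
dec⇒true (no ¬p) p = contradiction p ¬p

true⇒dec : ∀ {P : Set} (p? : Dec P) → ⌊ p? ⌋ ≡ true → P
true⇒dec (yes p) _ = p

dec⇒false : ∀ {P : Set} (p? : Dec P) → (P → ⊥) → ⌊ p? ⌋ ≡ false
dec⇒false (yes p) ¬p = contradiction p ¬p
dec⇒false (no _)  ¬p = refl

all-allFin⁻ : ∀ {n} (p : Fin n → Bool) → all p (allFin n) ≡ true → ∀ i → p i ≡ true
all-allFin⁻ p = go p id
  where
  go : ∀ {n} {A : Set} (p : A → Bool) (f : Fin n → A) → all p (tabulate f) ≡ true → ∀ i → p (f i) ≡ true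
  go p f e zero    = proj₁ (∧-true {p (f zero)} e)
  go p f e (suc i) = go p (f ∘ suc) (proj₂ (∧-true {p (f zero)} e)) i

all-allFin⁺ : ∀ {n} (p : Fin n → Bool) → (∀ i → p i ≡ true) → all p (allFin n) ≡ true
all-allFin⁺ p = go p id
  where
  go : ∀ {n} {A : Set} (p : A → Bool) (f : Fin n → A) → (∀ i → p (f i) ≡ true) → all p (tabulate f) ≡ true
  go {zero}  p f h = refl
  go {suc n} p f h = true-∧ (h zero) (go p (f ∘ suc) (h ∘ suc))

injB⁻ : ∀ {n} {f : Fin n → Fin n} → injB f ≡ true → Injective _≡_ _≡_ f
injB⁻ {f = f} e {x} {y} fx≡fy with all-allFin⁻ _ (all-allFin⁻ _ e x) y
... | h rewrite dec⇒true (f x Fin.≟ f y) fx≡fy = true⇒dec (x Fin.≟ y) h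

injB⁺ : ∀ {n} {f : Fin n → Fin n} → Injective _≡_ _≡_ f → injB f ≡ true
injB⁺ {f = f} f-inj = all-allFin⁺ _ λ x → all-allFin⁺ _ λ y → h x y
  where
  h : ∀ x y → not (eqF (f x) (f y)) ∨ eqF x y ≡ true
  h x y with f x Fin.≟ f y
  ... | no _  = refl
  ... | yes e = dec⇒true (x Fin.≟ y) (f-inj e)

eqP⁻ : ∀ {n} {p q : Fin n × Fin n} → eqP p q ≡ true → p ≡ q
eqP⁻ {p = a , b} {c , d} e = let (e₁ , e₂) = ∧-true {eqF a c} e in
  cong₂ _,_ (true⇒dec (a Fin.≟ c) e₁) (true⇒dec (b Fin.≟ d) e₂)

eqP⁺ : ∀ {n} {p q : Fin n × Fin n} → p ≡ q → eqP p q ≡ true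
eqP⁺ {p = a , b} refl = true-∧ (dec⇒true (a Fin.≟ a) refl) (dec⇒true (b Fin.≟ b) refl)

sumℕ-map : ∀ {A : Set} (f : A → ℕ) L → sumℕ (map f L) ≡ ΣN.∑ L f
sumℕ-map f []      = refl
sumℕ-map f (x ∷ L) = cong (f x ℕ.+_) (sumℕ-map f L)

countB-allFin : ∀ {n} (p : Fin n → Bool) → countB p (allFin n) ≡ ΣN.sum (λ i → if p i then 1 else 0)
countB-allFin {n} p = trans (sumℕ-map _ (allFin n)) (ΣN.∑-tabulate {n = n} id _)

isAutB⁻ : ∀ G {σ τ ε} → isAutB G σ τ ε ≡ true → Injective _≡_ _≡_ σ × Injective _≡_ _≡_ τ ×
          (∀ e → ends G (τ e) ≡ orient (ε e) (mapPair σ (ends G e)))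
isAutB⁻ G {σ} {τ} e = let (a , b) = ∧-true {injB σ} e ; (b , c) = ∧-true {injB τ} b in
  injB⁻ a , injB⁻ b , λ i → eqP⁻ (all-allFin⁻ _ c i)

isAutB⁺ : ∀ G {σ τ ε} → Injective _≡_ _≡_ σ → Injective _≡_ _≡_ τ →
          (∀ e → ends G (τ e) ≡ orient (ε e) (mapPair σ (ends G e))) → isAutB G σ τ ε ≡ true
isAutB⁺ G a b c = true-∧ (injB⁺ a) (true-∧ (injB⁺ b) (all-allFin⁺ _ λ i → eqP⁺ (c i)))

IsoSetoid : Graph → Graph → Setoid 0ℓ 0ℓ
IsoSetoid G H = record
  { Carrier = Iso G H
  ; _≈_ = λ f g → (Inverse.to (Iso.σ f) ≗ Inverse.to (Iso.σ g)) × (Inverse.to (Iso.τ f) ≗ Inverse.to (Iso.τ g))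
                  × (Iso.ε f ≗ Iso.ε g)
  ; isEquivalence = record
    { refl  = (λ _ → refl) , (λ _ → refl) , (λ _ → refl)
    ; sym   = λ (a , b , c) → sym ∘ a , sym ∘ b , sym ∘ c
    ; trans = λ (a , b , c) (a′ , b′ , c′) →
        (λ x → trans (a x) (a′ x)) , (λ x → trans (b x) (b′ x)) , (λ x → trans (c x) (c′ x)) } }

Restrict : (S : Setoid 0ℓ 0ℓ) → (S.Carrier S → Set) → Setoid 0ℓ 0ℓ
Restrict S P = record
  { Carrier = Σ (S.Carrier S) P
  ; _≈_ = λ x y → S._≈_ S (proj₁ x) (proj₁ y)
  ; isEquivalence = record { refl = S.refl S ; sym = S.sym S ; trans = S.trans S } }

Σ-injective₂ : ∀ {A : Set} {B : A → Set} {i : A} {x y : B i} → _≡_ {A = Σ A B} (i , x) (i , y) → x ≡ y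
Σ-injective₂ refl = refl

Card-Fin : ∀ n → Card (≡.setoid (Fin n)) n
Card-Fin n = card {at = id} (enum (λ _ _ → id) (λ i → i , refl))

Card-Σ : ∀ {n} {B : Fin n → Set} (g : Fin n → ℕ) → (∀ i → Card (≡.setoid (B i)) (g i)) →
         Card (≡.setoid (Σ (Fin n) B)) (ΣN.sum g)
Card-Σ {n} {B} g c = card {at = f ∘ decΣ g} (enum
  (λ i j e → trans (sym (enc-decΣ g i)) (trans (cong (uncurry (encΣ g)) (f-inj _ _ e)) (enc-decΣ g j)))
  (λ (i , b) → let (k , e) = at-surj (isEnum (c i)) b in
    encΣ g i k , trans (cong f (dec-encΣ g i k)) (cong (i ,_) e)))
  where
  f : Σ (Fin n) (Fin ∘ g) → Σ (Fin n) B
  f (i , k) = i , Card.at (c i) k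
  f-inj : ∀ p q → f p ≡ f q → p ≡ q
  f-inj (i , k) (j , l) e with cong proj₁ e
  ... | refl = cong (i ,_) (at-inj (isEnum (c i)) k l (Σ-injective₂ e))

module _ (G : Graph) (p : (Fin (nv G) → Fin (nv G)) → Bool) (p-cong : ∀ {f g} → f ≗ g → p f ≡ p g) where
  private
    V = Fin (nv G)
    E = Fin (ne G)
    Ls = allFuns (nv G) (allFin (nv G))
    Lt = allFuns (ne G) (allFin (ne G))
    Le = allFuns (ne G) bools
    enumS : IsEnum (V →-setoid V) (lookup Ls)
    enumS = allFuns-isEnum (nv G) (UniqueP.allFin⁺ _) ∈-allFin
    enumT : IsEnum (E →-setoid E) (lookup Lt)
    enumT = allFuns-isEnum (ne G) (UniqueP.allFin⁺ _) ∈-allFin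
    enumE : IsEnum (E →-setoid Bool) (lookup Le)
    enumE = allFuns-isEnum (ne G) bools-Unique ∈-bools
    q : (V → V) → (E → E) → (E → Bool) → Bool
    q σ τ ε = p σ ∧ isAutB G σ τ ε
    b : Bool → ℕ
    b x = if x then 1 else 0
    gE : Fin (length Ls) → Fin (length Lt) → Fin (length Le) → ℕ
    gE i j k = b (q (lookup Ls i) (lookup Lt j) (lookup Le k))
    gT : Fin (length Ls) → Fin (length Lt) → ℕ
    gT i j = ΣN.sum (gE i j)
    gS : Fin (length Ls) → ℕ
    gS i = ΣN.sum (gT i)

    count≡ : autCountWith G p ≡ ΣN.sum gS
    count≡ = trans (sumℕ-map (λ σ → sumℕ (map (λ τ → countB (q σ τ) Le) Lt)) Ls) (ΣN.∑-cong Ls λ σ →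
      trans (sumℕ-map (λ τ → countB (q σ τ) Le) Lt) (ΣN.∑-cong Lt λ τ → sumℕ-map (b ∘ q σ τ) Le))

    S : Setoid 0ℓ 0ℓ
    S = Restrict (IsoSetoid G G) (λ f → p (Inverse.to (Iso.σ f)) ≡ true)

    -- The sum of 0/1 tests is read as the size of a dependent sum whose last component is
    -- inhabited, and then by one element, exactly when the test succeeds.
    Ix : Setoid 0ℓ 0ℓ
    Ix = ≡.setoid (Σ (Fin (length Ls)) λ i → Σ (Fin (length Lt)) λ j → Σ (Fin (length Le)) λ k → Fin (gE i j k))

    cardIx : Card Ix (ΣN.sum gS)
    cardIx = Card-Σ gS λ i → Card-Σ (gT i) λ j → Card-Σ (gE i j) λ k → Card-Fin (gE i j k)

    true-of : ∀ x → Fin (b x) → x ≡ true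
    true-of true w = refl

    of-true : ∀ x → x ≡ true → Fin (b x)
    of-true true e = zero

    Fin-b-irr : ∀ x (v w : Fin (b x)) → v ≡ w
    Fin-b-irr true zero zero = refl

    f : Setoid.Carrier Ix → S.Carrier S
    f (i , j , k , w) =
      let (h₁ , h₂) = ∧-true {p (lookup Ls i)} (true-of _ w)
          (a , b , c) = isAutB⁻ G h₂ in
      record { σ = inj⇒↔ refl (lookup Ls i) a ; τ = inj⇒↔ refl (lookup Lt j) b ; ε = lookup Le k ; compat = c } , h₁

  -- The test `p` has to respect pointwise equality because the vertex map of an isomorphism is
  -- matched with a listed function only pointwise.
  autCountWith-Card : Card S (autCountWith G p)
  autCountWith-Card = subst (Card S) (sym count≡) (Card-map Ix S f f-cong f-inj f-surj cardIx)
    where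
    f-cong : ∀ {x y} → x ≡ y → Setoid._≈_ S (f x) (f y)
    f-cong {x} refl = S.refl S {f x}
    f-inj : ∀ {x y} → Setoid._≈_ S (f x) (f y) → x ≡ y
    f-inj {i , j , k , w} {i′ , j′ , k′ , w′} (a , b , c)
      with at-inj enumS i i′ a | at-inj enumT j j′ b | at-inj enumE k k′ c
    ... | refl | refl | refl = cong (λ w → i , j , k , w) (Fin-b-irr _ w w′)
    f-surj : ∀ y → ∃ λ x → Setoid._≈_ S (f x) y
    f-surj (φ , pφ) =
      let open Iso φ
          (i , ei) = at-surj enumS (Inverse.to σ)
          (j , ej) = at-surj enumT (Inverse.to τ)
          (k , ek) = at-surj enumE ε
          aut = isAutB⁺ G {lookup Ls i} {lookup Lt j} {lookup Le k}
                  (λ {x} {y} e → ↔-injective σ (trans (sym (ei x)) (trans e (ei y))))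
                  (λ {x} {y} e → ↔-injective τ (trans (sym (ej x)) (trans e (ej y))))
                  (λ e → trans (cong (ends G) (ej e)) (trans (compat e) (cong₂ orient (sym (ek e))
                          (cong₂ _,_ (sym (ei _)) (sym (ei _))))))
      in (i , j , k , of-true _ (true-∧ (trans (p-cong ei) pφ) aut)) , ei , ej , ek

-- Isomorphisms, walks and spanning trees

-- Arbitrary carriers allow the glued graph to have pairs and disjoint unions as vertices and edges;
-- a numbering by `Fin` is chosen only in `glue`.
record AGraph : Set₁ where
  field
    Vtx : Set
    Edg : Set
    inc : Edg → Vtx × Vtx
open AGraph public

⌜_⌝ : Graph → AGraph
⌜ G ⌝ = record { Vtx = Fin (nv G) ; Edg = Fin (ne G) ; inc = ends G }

record AIso (A B : AGraph) : Set where
  field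
    σ      : Vtx A ↔ Vtx B
    τ      : Edg A ↔ Edg B
    ε      : Edg A → Bool
    compat : ∀ e → inc B (Inverse.to τ e) ≡ orient (ε e) (mapPair (Inverse.to σ) (inc A e))
  σ→ = Inverse.to σ
  σ← = Inverse.from σ
  τ→ = Inverse.to τ
  τ← = Inverse.from τ

open AIso public using (σ→; σ←; τ→; τ←)

fromIso : ∀ {G H} → Iso G H → AIso ⌜ G ⌝ ⌜ H ⌝
fromIso f = record { Iso f }

toIso : ∀ {G H} → AIso ⌜ G ⌝ ⌜ H ⌝ → Iso G H
toIso f = record { σ = AIso.σ f ; τ = AIso.τ f ; ε = AIso.ε f ; compat = AIso.compat f }

orient-mapPair : ∀ {A B : Set} (f : A → B) b p → orient b (mapPair f p) ≡ mapPair f (orient b p)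
orient-mapPair f false p = refl
orient-mapPair f true  p = refl

orient-orient : ∀ {A : Set} b c (p : A × A) → orient b (orient c p) ≡ orient (c xor b) p
orient-orient false false p = refl
orient-orient false true  p = refl
orient-orient true  false p = refl
orient-orient true  true  p = refl

AIso-sym : ∀ {A B} → AIso A B → AIso B A
AIso-sym {A} {B} f = record
  { σ = ↔-sym (AIso.σ f)
  ; τ = ↔-sym (AIso.τ f)
  ; ε = AIso.ε f ∘ τ← f
  ; compat = λ e → let b = AIso.ε f (τ← f e) ; p = inc A (τ← f e) in sym (begin
      orient b (mapPair (σ← f) (inc B e))
        ≡⟨ cong (λ e → orient b (mapPair (σ← f) (inc B e))) (sym (Inverse.strictlyInverseˡ (AIso.τ f) e)) ⟩
      orient b (mapPair (σ← f) (inc B (τ→ f (τ← f e))))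
        ≡⟨ cong (orient b ∘ mapPair (σ← f)) (AIso.compat f (τ← f e)) ⟩
      orient b (mapPair (σ← f) (orient b (mapPair (σ→ f) p)))
        ≡⟨ cong (orient b) (sym (orient-mapPair (σ← f) b _)) ⟩
      orient b (orient b (mapPair (σ← f) (mapPair (σ→ f) p)))
        ≡⟨ orient-orient b b _ ⟩
      orient (b xor b) (mapPair (σ← f) (mapPair (σ→ f) p))
        ≡⟨ cong (λ b → orient b (mapPair (σ← f) (mapPair (σ→ f) p))) (Bool.xor-same b) ⟩
      mapPair (σ← f) (mapPair (σ→ f) p)
        ≡⟨ cong₂ _,_ (Inverse.strictlyInverseʳ (AIso.σ f) _) (Inverse.strictlyInverseʳ (AIso.σ f) _) ⟩
      p ∎) }
  where open ≡.≡-Reasoning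

AIso-trans : ∀ {A B C} → AIso A B → AIso B C → AIso A C
AIso-trans {A} {B} {C} f g = record
  { σ = AIso.σ g ↔-∘ AIso.σ f
  ; τ = AIso.τ g ↔-∘ AIso.τ f
  ; ε = λ e → AIso.ε f e xor AIso.ε g (τ→ f e)
  ; compat = λ e → begin
      inc C (τ→ g (τ→ f e))
        ≡⟨ AIso.compat g (τ→ f e) ⟩
      orient (AIso.ε g (τ→ f e)) (mapPair (σ→ g) (inc B (τ→ f e)))
        ≡⟨ cong (orient (AIso.ε g (τ→ f e)) ∘ mapPair (σ→ g)) (AIso.compat f e) ⟩
      orient (AIso.ε g (τ→ f e)) (mapPair (σ→ g) (orient (AIso.ε f e) (mapPair (σ→ f) (inc A e))))
        ≡⟨ cong (orient (AIso.ε g (τ→ f e))) (sym (orient-mapPair (σ→ g) (AIso.ε f e) _)) ⟩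
      orient (AIso.ε g (τ→ f e)) (orient (AIso.ε f e) (mapPair (σ→ g) (mapPair (σ→ f) (inc A e))))
        ≡⟨ orient-orient (AIso.ε g (τ→ f e)) (AIso.ε f e) _ ⟩
      orient (AIso.ε f e xor AIso.ε g (τ→ f e)) (mapPair (σ→ g ∘ σ→ f) (inc A e)) ∎ }
  where open ≡.≡-Reasoning

AIsoSetoid : AGraph → AGraph → Setoid 0ℓ 0ℓ
AIsoSetoid A B = record
  { Carrier = AIso A B
  ; _≈_ = λ f g → (σ→ f ≗ σ→ g) × (τ→ f ≗ τ→ g) × (AIso.ε f ≗ AIso.ε g)
  ; isEquivalence = record
    { refl  = (λ _ → refl) , (λ _ → refl) , (λ _ → refl)
    ; sym   = λ (a , b , c) → sym ∘ a , sym ∘ b , sym ∘ c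
    ; trans = λ (a , b , c) (a′ , b′ , c′) →
        (λ x → trans (a x) (a′ x)) , (λ x → trans (b x) (b′ x)) , (λ x → trans (c x) (c′ x)) } }

infix 4 _≈ᵢ_
_≈ᵢ_ : ∀ {A B} → AIso A B → AIso A B → Set
_≈ᵢ_ {A} {B} = Setoid._≈_ (AIsoSetoid A B)

xor-cancelˡ : ∀ a {b c} → a xor b ≡ a xor c → b ≡ c
xor-cancelˡ false e = e
xor-cancelˡ true {false} {false} e = refl
xor-cancelˡ true {true}  {true}  e = refl

xor-inv : ∀ a b → a xor (a xor b) ≡ b
xor-inv false b = refl
xor-inv true false = refl
xor-inv true true = refl

Card-precompose : ∀ {A B C} → AIso B A → ∀ {n} → Card (AIsoSetoid A C) n → Card (AIsoSetoid B C) n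
Card-precompose {A} {B} {C} h = Card-map (AIsoSetoid A C) (AIsoSetoid B C) (AIso-trans h)
  (λ (a , b , c) → a ∘ σ→ h , b ∘ τ→ h , λ e → cong (AIso.ε h e xor_) (c (τ→ h e)))
  (λ {f} {g} (a , b , c) →
      (λ x → subst (λ x → σ→ f x ≡ σ→ g x) (Inverse.strictlyInverseˡ (AIso.σ h) x) (a (σ← h x)))
    , (λ x → subst (λ x → τ→ f x ≡ τ→ g x) (Inverse.strictlyInverseˡ (AIso.τ h) x) (b (τ← h x)))
    , (λ x → subst (λ x → AIso.ε f x ≡ AIso.ε g x) (Inverse.strictlyInverseˡ (AIso.τ h) x)
               (xor-cancelˡ (AIso.ε h (τ← h x)) (c (τ← h x)))))
  (λ g → AIso-trans (AIso-sym h) g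
    , (λ x → cong (σ→ g) (Inverse.strictlyInverseʳ (AIso.σ h) x))
    , (λ x → cong (τ→ g) (Inverse.strictlyInverseʳ (AIso.τ h) x))
    , (λ x → trans (cong (λ y → AIso.ε h x xor (AIso.ε h y xor AIso.ε g y)) (Inverse.strictlyInverseʳ (AIso.τ h) x))
                   (xor-inv (AIso.ε h x) _)))

xor-invʳ : ∀ a b → (a xor b) xor b ≡ a
xor-invʳ a b = trans (Bool.xor-comm (a xor b) b) (trans (cong (b xor_) (Bool.xor-comm a b)) (xor-inv b a))

xor-cancelʳ : ∀ a {b c} → b xor a ≡ c xor a → b ≡ c
xor-cancelʳ a {b} {c} e = xor-cancelˡ a (trans (Bool.xor-comm a b) (trans e (Bool.xor-comm c a)))

module _ {A B C : AGraph} (h : AIso A B) where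
  postcompose-inj : {f g : AIso C A} → AIso-trans f h ≈ᵢ AIso-trans g h → f ≈ᵢ g
  postcompose-inj {f} {g} (a , b , c) = ↔-injective (AIso.σ h) ∘ a , ↔-injective (AIso.τ h) ∘ b , λ e →
    xor-cancelʳ (AIso.ε h (τ→ f e)) (trans (c e) (cong (λ d → AIso.ε g e xor AIso.ε h d) (sym (↔-injective (AIso.τ h) (b e)))))

  postcompose-cong : {f g : AIso C A} → f ≈ᵢ g → AIso-trans f h ≈ᵢ AIso-trans g h
  postcompose-cong (a , b , c) = cong (σ→ h) ∘ a , cong (τ→ h) ∘ b , λ e →
    cong₂ (λ x d → x xor AIso.ε h d) (c e) (b e)

  postcompose-sym : (g : AIso C B) → AIso-trans (AIso-trans g (AIso-sym h)) h ≈ᵢ g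
  postcompose-sym g = (λ x → Inverse.strictlyInverseˡ (AIso.σ h) (σ→ g x))
    , (λ e → Inverse.strictlyInverseˡ (AIso.τ h) (τ→ g e))
    , λ e → xor-invʳ (AIso.ε g e) (AIso.ε h (τ← h (τ→ g e)))

  Card-postcompose : ∀ {n} → Card (AIsoSetoid C A) n → Card (AIsoSetoid C B) n
  Card-postcompose = Card-map (AIsoSetoid C A) (AIsoSetoid C B) (λ f → AIso-trans f h)
    (λ {f} {g} → postcompose-cong {f} {g}) (λ {f} {g} → postcompose-inj {f} {g})
    (λ g → AIso-trans g (AIso-sym h) , postcompose-sym g)

Joins : (A : AGraph) → Edg A → Vtx A → Vtx A → Set
Joins A e u w = inc A e ≡ (u , w) ⊎ inc A e ≡ (w , u)

Joins-sym : ∀ {A e u w} → Joins A e u w → Joins A e w u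
Joins-sym = Sum.swap

Joins-unique : ∀ {A e u w u′ w′} → Joins A e u w → Joins A e u′ w′ → (u ≡ u′ × w ≡ w′) ⊎ (u ≡ w′ × w ≡ u′)
Joins-unique (inj₁ p) (inj₁ q) with refl ← trans (sym p) q = inj₁ (refl , refl)
Joins-unique (inj₁ p) (inj₂ q) with refl ← trans (sym p) q = inj₂ (refl , refl)
Joins-unique (inj₂ p) (inj₁ q) with refl ← trans (sym p) q = inj₂ (refl , refl)
Joins-unique (inj₂ p) (inj₂ q) with refl ← trans (sym p) q = inj₁ (refl , refl)

-- With `Q` equal to `_≢ e` this is connectivity after deleting `e`, expressed without building the
-- smaller graph.
data Conn (A : AGraph) (Q : Edg A → Set) : Vtx A → Vtx A → Set where
  here : ∀ {u} → Conn A Q u u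
  step : ∀ {u w v} (e : Edg A) → Q e → Joins A e u w → Conn A Q w v → Conn A Q u v

Conn-trans : ∀ {A Q u v w} → Conn A Q u v → Conn A Q v w → Conn A Q u w
Conn-trans here           d = d
Conn-trans (step e q j c) d = step e q j (Conn-trans c d)

Conn-sym : ∀ {A Q u v} → Conn A Q u v → Conn A Q v u
Conn-sym here           = here
Conn-sym {A} (step e q j c) = Conn-trans (Conn-sym c) (step e q (Joins-sym {A} j) here)

-- An edge may be sent to any walk. Hence the same lemma serves for detours around a deleted edge
-- and for projections that collapse edges.
Conn-map : ∀ {A Q B Q′} (f : Vtx A → Vtx B) →
           (∀ e → Q e → uncurry (λ u w → Conn B Q′ (f u) (f w)) (inc A e)) →
           ∀ {u v} → Conn A Q u v → Conn B Q′ (f u) (f v)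
Conn-map f h here = here
Conn-map {A} {B = B} {Q′} f h (step e q (inj₁ p) c) =
  Conn-trans (subst (uncurry (λ u w → Conn B Q′ (f u) (f w))) p (h e q)) (Conn-map f h c)
Conn-map {A} {B = B} {Q′} f h (step e q (inj₂ p) c) =
  Conn-trans (Conn-sym (subst (uncurry (λ u w → Conn B Q′ (f u) (f w))) p (h e q))) (Conn-map f h c)

fromWalk : ∀ {G u v} → Walk G u v → Conn ⌜ G ⌝ (λ _ → ⊤) u v
fromWalk here         = here
fromWalk (step e j w) = step e tt j (fromWalk w)

toWalk : ∀ {G Q u v} → Conn ⌜ G ⌝ Q u v → Walk G u v
toWalk here           = here
toWalk (step e q j w) = step e j (toWalk w)

-- Shortest paths, spanning trees and bridges

least : ∀ {P : ℕ → Set} → (∀ k → Dec (P k)) → ∀ k → P k → ∃ λ j → P j × (∀ i → i < j → ¬ P i)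
least P? k pk with P? 0
... | yes p = 0 , p , λ _ ()
least P? zero    pk | no ¬p = contradiction pk ¬p
least P? (suc k) pk | no ¬p =
  let (j , pj , min) = least (P? ∘ suc) k pk in
  suc j , pj , λ { zero _ → ¬p ; (suc i) (s≤s i<j) → min i i<j }

-- A spanning tree rooted at `r`, given by one parent edge per vertex; the decreasing `rank`
-- excludes cycles.
record Parents (G : Graph) (Q : Fin (ne G) → Set) (r : Fin (nv G)) : Set where
  field
    rank   : Fin (nv G) → ℕ
    parent : ∀ u → u ≡ r ⊎ ∃ λ e → ∃ λ w → Q e × Joins ⌜ G ⌝ e u w × rank w < rank u

module _ (G : Graph) {Q : Fin (ne G) → Set} (Q? : ∀ e → Dec (Q e)) (r : Fin (nv G)) where
  private
    Reach : ℕ → Fin (nv G) → Set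
    Reach zero    u = u ≡ r
    Reach (suc k) u = ∃ λ e → ∃ λ w → Q e × Joins ⌜ G ⌝ e u w × Reach k w

    reach? : ∀ k u → Dec (Reach k u)
    reach? zero    u = u Fin.≟ r
    reach? (suc k) u = Fin.any? λ e → Fin.any? λ w →
      Q? e ×-dec ((≡-dec Fin._≟_ Fin._≟_ _ _) ⊎-dec (≡-dec Fin._≟_ Fin._≟_ _ _)) ×-dec reach? k w

    Conn⇒Reach : ∀ {u} → Conn ⌜ G ⌝ Q u r → ∃ λ k → Reach k u
    Conn⇒Reach here = 0 , refl
    Conn⇒Reach (step e q j c) = let (k , p) = Conn⇒Reach c in suc k , e , _ , q , j , p

  abstract
    -- The rank is the distance to `r` along edges in `Q`: the second vertex of a shortest walk is
    -- strictly closer. Being abstract, the search never unfolds in later types.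
    parents : (∀ u → Conn ⌜ G ⌝ Q u r) → Parents G Q r
    parents conn = record { rank = proj₁ ∘ short ; parent = λ u → par u (proj₁ (short u)) (proj₁ (proj₂ (short u))) refl }
      where
      short : ∀ u → ∃ λ j → Reach j u × (∀ i → i < j → ¬ Reach i u)
      short u = let (k , p) = Conn⇒Reach (conn u) in least (λ k → reach? k u) k p
      short-≤ : ∀ u k → Reach k u → proj₁ (short u) ℕ.≤ k
      short-≤ u k p with proj₁ (short u) ℕ.≤? k
      ... | yes q = q
      ... | no ¬q = contradiction p (proj₂ (proj₂ (short u)) k (ℕ.≰⇒> ¬q))
      par : ∀ u k → Reach k u → k ≡ proj₁ (short u) →
            u ≡ r ⊎ ∃ λ e → ∃ λ w → Q e × Joins ⌜ G ⌝ e u w × proj₁ (short w) < proj₁ (short u)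
      par u zero    p eq = inj₁ p
      par u (suc k) (e , w , q , j , p) eq =
        inj₂ (e , w , q , j , subst (proj₁ (short w) <_) eq (s≤s (short-≤ w k p)))

module Out {G : Graph} {Q : Fin (ne G) → Set} {r : Fin (nv G)} (P : Parents G Q r)
           (e₀ : Fin (ne G)) (¬Qe₀ : ¬ Q e₀) where
  open Parents P

  out : Fin (nv G) → Fin (ne G)
  out u = [ (λ _ → e₀) , proj₁ ]′ (parent u)

  -- Two distinct vertices sharing a parent edge would be each other's parent, each of smaller rank
  -- than the other. The root cannot clash either, since its edge `e₀` lies outside `Q`.
  out-injective : Injective _≡_ _≡_ out
  out-injective {u} {v} eq with parent u | parent v
  ... | inj₁ refl | inj₁ refl = refl
  ... | inj₁ _ | inj₂ (e , _ , q , _) = contradiction (subst Q (sym eq) q) ¬Qe₀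
  ... | inj₂ (e , _ , q , _) | inj₁ _ = contradiction (subst Q eq q) ¬Qe₀
  ... | inj₂ (e , w , _ , j , w<u) | inj₂ (_ , w′ , _ , j′ , w′<v) with refl ← eq
    with Joins-unique {⌜ G ⌝} {e} j j′
  ... | inj₁ (u≡v , _) = u≡v
  ... | inj₂ (refl , refl) = contradiction w<u (ℕ.<-asym w′<v)

  nv≤ne : nv G ℕ.≤ ne G
  nv≤ne = Fin.injective⇒≤ out-injective

-- A detour around `e` could replace `e` in every walk, so deleting `e` would leave the graph
-- connected. Its spanning tree together with the spare edge `e` would then give every vertex its
-- own edge, one more than there are.
tree-bridge : (G : Graph) → Connected G → nv G ≡ suc (ne G) → ∀ e {a b} → Joins ⌜ G ⌝ e a b →
              ¬ Conn ⌜ G ⌝ (_≢ e) a b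
tree-bridge G (r , walk) nv≡ e {a} {b} j c = ℕ.1+n≰n (subst (ℕ._≤ ne G) nv≡ (Out.nv≤ne P e (λ ¬e → ¬e refl)))
  where
  c′ : Conn ⌜ G ⌝ (_≢ e) (proj₁ (ends G e)) (proj₂ (ends G e))
  c′ = [ (λ p → subst (uncurry (Conn ⌜ G ⌝ (_≢ e))) (sym p) c)
       , (λ p → subst (uncurry (Conn ⌜ G ⌝ (_≢ e))) (sym p) (Conn-sym c)) ]′ j
  detour : ∀ e′ → Conn ⌜ G ⌝ (_≢ e) (proj₁ (ends G e′)) (proj₂ (ends G e′))
  detour e′ with e′ Fin.≟ e
  ... | yes refl = c′
  ... | no  e′≢e = step e′ e′≢e (inj₁ refl) here
  P : Parents G (_≢ e) r
  P = parents G (λ e′ → ¬? (e′ Fin.≟ e)) r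
        (λ u → Conn-map id (λ e′ _ → detour e′) (fromWalk (walk u r)))

-- Gluing rooted trees along a cycle, and the decomposition of unicyclic graphs

fold-suc : ∀ {A : Set} (f : A → A) k x → fold (f x) f k ≡ f (fold x f k)
fold-suc f zero    x = refl
fold-suc f (suc k) x = cong f (fold-suc f k x)

fold-cycle : ∀ {A : Set} (f : A → A) n {x} → fold x f n ≡ x → ∀ q → fold x f (q ℕ.* n) ≡ x
fold-cycle f n p zero    = refl
fold-cycle f n {x} p (suc q) = trans (fold-+ x f n) (trans (cong (λ y → fold y f n) (fold-cycle f n p q)) p)

fold-% : ∀ {A : Set} (f : A → A) n .{{_ : NonZero n}} {x} → fold x f n ≡ x →
         ∀ k → fold x f (k % n) ≡ fold x f k
fold-% f n {x} p k = sym (trans (cong (fold x f) (ℕ.m≡m%n+[m/n]*n k n))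
  (trans (fold-+ x f (k % n)) (cong (λ y → fold y f (k % n)) (fold-cycle f n p (k / n)))))

suc-%-% : ∀ m n .{{_ : NonZero n}} → suc (m % n) % n ≡ suc m % n
suc-%-% m n = trans (ℕ.%-distribˡ-+ 1 (m % n) n)
  (trans (cong (λ x → (1 % n ℕ.+ x) % n) (ℕ.m%n%n≡m%n m n)) (sym (ℕ.%-distribˡ-+ 1 m n)))

toℕ-nextF : ∀ {n} (i : Fin (suc n)) → toℕ (nextF i) ≡ suc (toℕ i) % suc n
toℕ-nextF i = Fin.toℕ-fromℕ< _

toℕ-fold-nextF : ∀ {n} (i : Fin (suc n)) t → toℕ (fold i nextF t) ≡ (t ℕ.+ toℕ i) % suc n
toℕ-fold-nextF i zero    = sym (ℕ.m<n⇒m%n≡m (Fin.toℕ<n i))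
toℕ-fold-nextF {n} i (suc t) = trans (toℕ-nextF (fold i nextF t))
  (trans (cong (λ x → suc x % suc n) (toℕ-fold-nextF i t)) (suc-%-% (t ℕ.+ toℕ i) (suc n)))

nextF-transitive : ∀ {n} (i j : Fin n) → ∃ λ t → fold i nextF t ≡ j
nextF-transitive {suc n} i j = t , Fin.toℕ-injective (begin
    toℕ (fold i nextF t)           ≡⟨ toℕ-fold-nextF i t ⟩
    (t ℕ.+ toℕ i) % suc n          ≡⟨ cong (_% suc n) (ℕ.+-assoc (toℕ j) (suc n ℕ.∸ toℕ i) (toℕ i)) ⟩
    (toℕ j ℕ.+ (suc n ℕ.∸ toℕ i ℕ.+ toℕ i)) % suc n
      ≡⟨ cong (λ x → (toℕ j ℕ.+ x) % suc n) (ℕ.m∸n+n≡m (ℕ.<⇒≤ (Fin.toℕ<n i))) ⟩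
    (toℕ j ℕ.+ suc n) % suc n      ≡⟨ ℕ.[m+n]%n≡m%n (toℕ j) (suc n) ⟩
    toℕ j % suc n                  ≡⟨ ℕ.m<n⇒m%n≡m (Fin.toℕ<n j) ⟩
    toℕ j ∎)
  where
  open ≡.≡-Reasoning
  -- Complete the turn from `i` back to 0, then go `j` steps further; the truncated subtraction is
  -- exact because `toℕ i` is below `suc n`.
  t = toℕ j ℕ.+ (suc n ℕ.∸ toℕ i)

-- Clears the subtraction: `k = 0` gives one more vertex than edges, `k = 1` gives equally many.
betti⇒ : ∀ {G k} → betti G ≡ + k → suc (ne G) ≡ k ℕ.+ nv G
betti⇒ {G} {k} e = ℤ.+-injective (trans (lem (+ nv G) (+ ne G)) (cong (ℤ._+ + nv G) e))
  where
  open ℤ.+-*-Solver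
  lem : ∀ a b → + 1 ℤ.+ b ≡ + 1 ℤ.- a ℤ.+ b ℤ.+ a
  lem = solve 2 (λ a b → con (+ 1) :+ b := con (+ 1) :- a :+ b :+ a) refl

betti⇐ : ∀ {G k} → suc (ne G) ≡ k ℕ.+ nv G → betti G ≡ + k
betti⇐ {G} {k} e = trans (lem (+ nv G) (+ ne G))
  (trans (cong (λ x → + x ℤ.- + nv G) e) (lem′ (+ nv G) (+ k)))
  where
  open ℤ.+-*-Solver
  lem : ∀ a b → + 1 ℤ.- a ℤ.+ b ≡ + 1 ℤ.+ b ℤ.- a
  lem = solve 2 (λ a b → con (+ 1) :- a :+ b := con (+ 1) :+ b :- a) refl
  lem′ : ∀ a b → b ℤ.+ a ℤ.- a ≡ b
  lem′ = solve 2 (λ a b → b :+ a :- a := b) refl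

-- The edges `inj₁ i` copy the edges of `cycle n`. For one tree this is a loop at the root and for
-- two trees a pair of parallel edges, so short cycles follow the general rule.
Glued : ∀ {n} → (Fin n → RootedTree) → AGraph
Glued {n} T = record
  { Vtx = Σ (Fin n) λ i → Fin (nv (tree (T i)))
  ; Edg = Fin n ⊎ Σ (Fin n) λ i → Fin (ne (tree (T i)))
  ; inc = λ { (inj₁ i)       → (i , root (T i)) , (nextF i , root (T (nextF i)))
            ; (inj₂ (i , e)) → mapPair (i ,_) (ends (tree (T i)) e) } }

module _ {n} (T : Fin n → RootedTree) where
  glue-V : Fin (ΣN.sum (λ i → nv (tree (T i)))) ↔ Vtx (Glued T)
  glue-V = Fin-Σ (λ i → nv (tree (T i)))

  glue-E : Fin (n ℕ.+ ΣN.sum (λ i → ne (tree (T i)))) ↔ Edg (Glued T)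
  glue-E = (↔-id _ ⊎-↔ Fin-Σ (λ i → ne (tree (T i)))) ↔-∘ Fin.+↔⊎

  glue : Graph
  glue = graph _ _ (mapPair (Inverse.from glue-V) ∘ inc (Glued T) ∘ Inverse.to glue-E)

  glue-AIso : AIso ⌜ glue ⌝ (Glued T)
  glue-AIso = record
    { σ = glue-V ; τ = glue-E ; ε = λ _ → false
    ; compat = λ e → cong₂ _,_ (sym (Inverse.strictlyInverseˡ glue-V _)) (sym (Inverse.strictlyInverseˡ glue-V _)) }

  -- The edge `inj₁ i` leaves position `i`, so walking forward and stopping at the first visit to
  -- `i` avoids it. This is why cycle edges are not bridges.
  cycle-Conn : ∀ i t x → fold x nextF t ≡ i →
               Conn (Glued T) (_≢ inj₁ i) (x , root (T x)) (i , root (T i))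
  cycle-Conn i zero    x refl = here
  cycle-Conn i (suc t) x p with x Fin.≟ i
  ... | yes refl = here
  ... | no  x≢i  = step (inj₁ x) (λ { refl → x≢i refl }) (inj₁ refl)
                     (cycle-Conn i t (nextF x) (trans (fold-suc nextF t x) p))

  root-Conn : ∀ i x → Conn (Glued T) (_≢ inj₁ i) (x , root (T x)) (i , root (T i))
  root-Conn i x = let (t , p) = nextF-transitive x i in cycle-Conn i t x p

  module _ (isTree : ∀ i → IsRootedTree (T i)) where
    tree-Conn : ∀ i v → Conn (Glued T) (λ _ → ⊤) (i , v) (i , root (T i))
    tree-Conn i v = Conn-map (i ,_) (λ e _ → step (inj₂ (i , e)) tt (inj₁ refl) here)
      (fromWalk (proj₂ (proj₁ (isTree i)) v (root (T i))))

    Glued-Conn : ∀ u v → Conn (Glued T) (λ _ → ⊤) u v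
    Glued-Conn (i , u) (j , v) = Conn-trans (tree-Conn i u) (Conn-trans
      (Conn-map id (λ e _ → step e tt (inj₁ refl) here) (root-Conn j i)) (Conn-sym (tree-Conn j v)))

    glue-Walk : ∀ u v → Walk glue u v
    glue-Walk u v = toWalk (subst₂-Conn (Inverse.strictlyInverseʳ glue-V u) (Inverse.strictlyInverseʳ glue-V v)
      (Conn-map {Q′ = λ _ → ⊤} (Inverse.from glue-V)
        (λ e _ → step (Inverse.from glue-E e) tt
          (inj₁ (cong (mapPair (Inverse.from glue-V) ∘ inc (Glued T)) (Inverse.strictlyInverseˡ glue-E e))) here)
        (Glued-Conn (Inverse.to glue-V u) (Inverse.to glue-V v))))
      where
      subst₂-Conn : ∀ {u u′ v v′} → u ≡ u′ → v ≡ v′ → Conn ⌜ glue ⌝ (λ _ → ⊤) u v → Conn ⌜ glue ⌝ (λ _ → ⊤) u′ v′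
      subst₂-Conn refl refl c = c

    glue-Connected : Fin n → Connected glue
    glue-Connected i = Inverse.from glue-V (i , root (T i)) , glue-Walk

    glue-nv : nv glue ≡ ne glue
    glue-nv = trans (ΣN.sum-cong-≋ (λ i → sym (betti⇒ {tree (T i)} (proj₂ (isTree i))))) (lem (λ i → ne (tree (T i))))
      where
      lem : ∀ {n} (f : Fin n → ℕ) → ΣN.sum (suc ∘ f) ≡ n ℕ.+ ΣN.sum f
      lem {zero}  f = refl
      lem {suc n} f = cong suc (trans (cong (f zero ℕ.+_) (lem (f ∘ suc)))
        (trans (sym (ℕ.+-assoc (f zero) n _)) (trans (cong (ℕ._+ ΣN.sum (f ∘ suc)) (ℕ.+-comm (f zero) n)) (ℕ.+-assoc n (f zero) _))))

    glue-betti : betti glue ≡ + 1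
    glue-betti = betti⇐ {glue} (cong suc (sym glue-nv))

-- The cycle and the branches of a self-map

Card-dec : ∀ {N} {P : Fin N → Set} → (∀ u → Dec (P u)) → ∃ λ k → Card (Restrict (≡.setoid (Fin N)) P) k
Card-dec {zero} P? = 0 , Card-empty _ (λ ())
Card-dec {suc N} {P} P? with Card-dec (P? ∘ suc) | P? zero
... | k , card {a} A | no ¬p = k , card {at = λ i → let (u , p) = a i in suc u , p} (enum
  (λ i j e → at-inj A i j (Fin.suc-injective e))
  λ { (zero , p) → contradiction p ¬p ; (suc u , p) → let (i , e) = at-surj A (u , p) in i , cong suc e })
... | k , card {a} A | yes p₀ = suc k , card {at = b} (enum
  (λ { zero zero e → refl ; (suc i) (suc j) e → cong suc (at-inj A i j (Fin.suc-injective e)) })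
  λ { (zero , p) → zero , refl ; (suc u , p) → let (i , e) = at-surj A (u , p) in suc i , cong suc e })
  where
  b : Fin (suc k) → Σ (Fin (suc N)) P
  b zero    = zero , p₀
  b (suc i) = let (u , p) = a i in suc u , p

-- Since `out` names the edge that `f` follows, loops and parallel edges are told apart without
-- looking at their ends. All orbits pass through `a`, so there is just one periodic orbit.
module Functional (G : Graph) (nv≡ne : nv G ≡ ne G) (out : Fin (nv G) → Fin (ne G)) (out-inj : Injective _≡_ _≡_ out)
  (f : Fin (nv G) → Fin (nv G)) (out-joins : ∀ u → Joins ⌜ G ⌝ (out u) u (f u))
  (a : Fin (nv G)) (reach : ∀ u → ∃ λ k → fold u f k ≡ a) where

  private
    V = Fin (nv G)

    -- Testing `suc j` keeps the period positive. A return exists because the orbit of `f a` also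
    -- reaches `a`.
    period : ∃ λ j → fold a f (suc j) ≡ a × (∀ i → i < j → ¬ fold a f (suc i) ≡ a)
    period = let (k , p) = reach (f a) in least (λ k → fold a f (suc k) Fin.≟ a) k (trans (sym (fold-suc f k a)) p)

  len : ℕ
  len = suc (proj₁ period)

  private
    f^len : fold a f len ≡ a
    f^len = proj₁ (proj₂ period)

    c : Fin len → V
    c i = fold a f (toℕ i)

    ≢a : ∀ k → 0 < k → k < len → fold a f k ≢ a
    ≢a (suc k) _ (s≤s k<) = proj₂ (proj₂ period) k k<

    -- Advance both points by `len ∸ j` steps: the later one is back at `a`, so the earlier one
    -- would reach `a` after a positive number of steps below the period.
    c≢ : ∀ {i j} → j < len → i < j → fold a f i ≢ fold a f j
    c≢ {i} {j} j<len i<j e = ≢a (len ℕ.∸ j ℕ.+ i) (ℕ.<-≤-trans (ℕ.m<n⇒0<n∸m j<len) (ℕ.m≤m+n _ i))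
      (ℕ.<-≤-trans (ℕ.+-monoʳ-< (len ℕ.∸ j) i<j) (ℕ.≤-reflexive (ℕ.m∸n+n≡m (ℕ.<⇒≤ j<len))))
      (trans (fold-+ a f (len ℕ.∸ j)) (trans (cong (λ y → fold y f (len ℕ.∸ j)) e)
        (trans (sym (fold-+ a f (len ℕ.∸ j))) (trans (cong (fold a f) (ℕ.m∸n+n≡m (ℕ.<⇒≤ j<len))) f^len))))

    c-inj : ∀ i j → c i ≡ c j → i ≡ j
    c-inj i j e with ℕ.<-cmp (toℕ i) (toℕ j)
    ... | tri< i<j _ _ = contradiction e (c≢ (Fin.toℕ<n j) i<j)
    ... | tri≈ _ i≡j _ = Fin.toℕ-injective i≡j
    ... | tri> _ _ j<i = contradiction (sym e) (c≢ (Fin.toℕ<n i) j<i)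

    c-next : ∀ i → c (nextF i) ≡ f (c i)
    c-next i = trans (cong (fold a f) (toℕ-nextF i)) (fold-% f len f^len (suc (toℕ i)))

    OnC : V → Set
    OnC u = ∃ λ i → c i ≡ u

    onC? : ∀ u → Dec (OnC u)
    onC? u = Fin.any? λ i → c i Fin.≟ u

    -- The point of first entry into the cycle. It does not mention a number of steps, which makes
    -- it unique, and its derivations are the induction that `toRoot` runs on.
    data Hit (u : V) (i : Fin len) : Set where
      base : c i ≡ u → Hit u i
      step : ¬ OnC u → Hit (f u) i → Hit u i

    hit : ∀ k u → fold u f k ≡ a → ∃ (Hit u)
    hit k u p with onC? u
    ... | yes (i , e) = i , base e
    hit zero    u p | no ¬on = contradiction (zero , sym p) ¬on
    hit (suc k) u p | no ¬on = let (i , h) = hit k (f u) (trans (fold-suc f k u) p) in i , step ¬on h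

    Hit-unique : ∀ {u i j} → Hit u i → Hit u j → i ≡ j
    Hit-unique {i = i} {j} (base p) (base q) = c-inj i j (trans p (sym q))
    Hit-unique {i = i} (base p) (step ¬on _) = contradiction (i , p) ¬on
    Hit-unique {j = j} (step ¬on _) (base q) = contradiction (j , q) ¬on
    Hit-unique (step _ h)  (step _ h′) = Hit-unique h h′

    π : V → Fin len
    π u = let (k , p) = reach u in proj₁ (hit k u p)

    π-Hit : ∀ u → Hit u (π u)
    π-Hit u = let (k , p) = reach u in proj₂ (hit k u p)

    π-c : ∀ i → π (c i) ≡ i
    π-c i = Hit-unique {c i} {π (c i)} {i} (π-Hit (c i)) (base refl)

    π-f : ∀ {u} → ¬ OnC u → π (f u) ≡ π u
    π-f {u} ¬on = Hit-unique (step ¬on (π-Hit (f u))) (π-Hit u)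

    Off : Fin len → V → Set
    Off i u = ¬ OnC u × π u ≡ i

    off : ∀ i → ∃ λ k → Card (Restrict (≡.setoid V) (Off i)) k
    off i = Card-dec λ u → ¬? (onC? u) ×-dec (π u Fin.≟ i)

    size : Fin len → ℕ
    size i = proj₁ (off i)

    offAt : ∀ i → Fin (size i) → Σ V (Off i)
    offAt i = Card.at (proj₂ (off i))

    vtx : ∀ i → Fin (suc (size i)) → V
    vtx i zero    = c i
    vtx i (suc x) = proj₁ (offAt i x)

    vtx-π : ∀ i x → π (vtx i x) ≡ i
    vtx-π i zero    = π-c i
    vtx-π i (suc x) = proj₂ (proj₂ (offAt i x))

    vtx-inj : ∀ i x y → vtx i x ≡ vtx i y → x ≡ y
    vtx-inj i zero    zero    e = refl
    vtx-inj i zero    (suc y) e = contradiction (i , e) (proj₁ (proj₂ (offAt i y)))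
    vtx-inj i (suc x) zero    e = contradiction (i , sym e) (proj₁ (proj₂ (offAt i x)))
    vtx-inj i (suc x) (suc y) e = cong suc (at-inj (isEnum (proj₂ (off i))) x y e)

    idx : ∀ {i} u → π u ≡ i → ∃ λ x → vtx i x ≡ u
    idx {i} u πu = go (onC? u)
      where
      go : Dec (OnC u) → ∃ λ x → vtx i x ≡ u
      go (yes (j , e)) = zero , trans (cong c (trans (sym πu) (Hit-unique {u} {π u} {j} (π-Hit u) (base e)))) e
      go (no ¬on) = let (x , e) = at-surj (isEnum (proj₂ (off i))) (u , ¬on , πu) in suc x , e

    above : ∀ i (e : Fin (size i)) → ∃ λ x → vtx i x ≡ f (vtx i (suc e))
    above i e = let (u , ¬on , πu) = offAt i e in idx (f u) (trans (π-f ¬on) πu)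

  -- Vertex 0 is the cycle vertex and edge `e` climbs from vertex `suc e` to its image under `f`.
  -- There is one edge per non-root vertex, so the Betti number is 0 by computation.
  branch : Fin len → RootedTree
  branch i = rtree (graph (suc (size i)) (size i) (λ e → suc e , proj₁ (above i e))) zero

  branch-isRootedTree : ∀ i → IsRootedTree (branch i)
  branch-isRootedTree i =
    (zero , λ u v → toWalk (Conn-trans (toRoot u (π-Hit _) refl) (Conn-sym (toRoot v (π-Hit _) refl)))) ,
    betti⇐ {tree (branch i)} {0} refl
    where
    toRoot : ∀ {u j} x → Hit u j → vtx i x ≡ u → Conn ⌜ tree (branch i) ⌝ (λ _ → ⊤) x zero
    toRoot zero    h        e = here
    toRoot {j = j} (suc x) (base p) e = contradiction (j , trans p (sym e)) (proj₁ (proj₂ (offAt i x)))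
    toRoot (suc x) (step _ h) refl =
      step x tt (inj₁ refl) (toRoot (proj₁ (above i x)) h (proj₂ (above i x)))

  private
    V↔ : Vtx (Glued branch) ↔ V
    V↔ = inj-surj⇒↔ (uncurry vtx) inj (λ u → let (x , e) = idx u refl in (π u , x) , e)
      where
      inj : Injective _≡_ _≡_ (uncurry vtx)
      inj {i , x} {j , y} e with trans (sym (vtx-π i x)) (trans (cong π e) (vtx-π j y))
      ... | refl = cong (i ,_) (vtx-inj i x y e)

    -- A cycle edge belongs to the root it leaves, a tree edge to its lower vertex. Followed by the
    -- vertex bijection and `out`, this becomes the edge bijection of `decomposition`.
    owner : Edg (Glued branch) ↔ Vtx (Glued branch)
    owner = mk↔ₛ′
      (λ { (inj₁ i) → i , zero ; (inj₂ (i , e)) → i , suc e })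
      (λ { (i , zero) → inj₁ i ; (i , suc e) → inj₂ (i , e) })
      (λ { (i , zero) → refl ; (i , suc e) → refl })
      (λ { (inj₁ i) → refl ; (inj₂ (i , e)) → refl })

    side : ∀ {e u w} → Joins ⌜ G ⌝ e u w → Bool
    side (inj₁ _) = false
    side (inj₂ _) = true

    side-orient : ∀ {e u w} (j : Joins ⌜ G ⌝ e u w) → ends G e ≡ orient (side j) (u , w)
    side-orient (inj₁ p) = p
    side-orient (inj₂ p) = p

    u[_] : Edg (Glued branch) → V
    u[ e ] = Inverse.to V↔ (Inverse.to owner e)

    far-end : ∀ e → (u[ e ] , f u[ e ]) ≡ mapPair (Inverse.to V↔) (inc (Glued branch) e)
    far-end (inj₁ i)       = cong (c i ,_) (sym (c-next i))
    far-end (inj₂ (i , e)) = cong (vtx i (suc e) ,_) (sym (proj₂ (above i e)))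

  decomposition : AIso (Glued branch) ⌜ G ⌝
  decomposition = record
    { σ = V↔
    -- Betti number 1 enters here: with as many edges as vertices, the injection `out` reaches every
    -- edge of `G`.
    ; τ = inj⇒↔ nv≡ne out out-inj ↔-∘ (V↔ ↔-∘ owner)
    ; ε = λ e → side (out-joins u[ e ])
    ; compat = λ e → trans (τ-out e) (trans (side-orient (out-joins u[ e ])) (cong (orient (side (out-joins u[ e ]))) (far-end e))) }
    where
    τ-out : ∀ e → ends G (Inverse.to (inj⇒↔ nv≡ne out out-inj) u[ e ]) ≡ ends G (out u[ e ])
    τ-out e = cong (ends G) (to-inj⇒↔ nv≡ne out out-inj u[ e ])
      where
      to-inj⇒↔ : ∀ {m n} (p : m ≡ n) (g : Fin m → Fin n) (g-inj : Injective _≡_ _≡_ g) x →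
                 Inverse.to (inj⇒↔ p g g-inj) x ≡ g x
      to-inj⇒↔ refl g g-inj x = refl

-- A spanning tree has too few edges to use all of them.
nonbridge : (G : Graph) → nv G ≡ ne G → (r : Fin (nv G)) → (∀ u → Conn ⌜ G ⌝ (λ _ → ⊤) u r) →
            ∃ λ e₀ → ∀ u → Conn ⌜ G ⌝ (_≢ e₀) u r
nonbridge G nv≡ne r conn = e₀ , λ u → toRoot (suc (rank u)) u ℕ.≤-refl
  where
  open Parents (parents G (λ _ → yes tt) r conn)
  Via : Fin (ne G) → Fin (nv G) → Set
  Via e u = u ≢ r × [ (λ _ → ⊥) , (λ p → proj₁ p ≡ e) ]′ (parent u)
  via? : ∀ e u → Dec (Via e u)
  via? e u = ¬? (u Fin.≟ r) ×-dec lem (parent u)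
    where
    lem : ∀ p → Dec ([ (λ _ → ⊥) , (λ q → proj₁ q ≡ e) ]′ p)
    lem (inj₁ _) = no λ ()
    lem (inj₂ q) = proj₁ q Fin.≟ e
  via-unique : ∀ {e e′} u → Via e u → Via e′ u → e ≡ e′
  via-unique {e} {e′} u (_ , p) (_ , p′) = lem (parent u) p p′
    where
    lem : ∀ q → [ (λ _ → ⊥) , (λ q → proj₁ q ≡ e) ]′ q → [ (λ _ → ⊥) , (λ q → proj₁ q ≡ e′) ]′ q → e ≡ e′
    lem (inj₂ q) p p′ = trans (sym p) p′
  missed : ∃ λ e → ¬ ∃ (Via e)
  missed with Fin.any? (λ e → ¬? (Fin.any? (via? e)))
  ... | yes p = p
  -- Otherwise choose, for each edge, a vertex other than `r` having it as parent edge. These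
  -- vertices are distinct, and together with `r` they number `suc (ne G)`.
  ... | no ¬p = ⊥-elim (ℕ.1+n≰n (subst (suc (ne G) ℕ.≤_) nv≡ne (Fin.injective⇒≤ {f = g} λ {x} {y} → g-inj x y)))
    where
    child : ∀ e → ∃ (Via e)
    child e = decidable-stable (Fin.any? (via? e)) λ ¬q → ¬p (e , ¬q)
    g : Fin (suc (ne G)) → Fin (nv G)
    g zero    = r
    g (suc e) = proj₁ (child e)
    g-inj : ∀ x y → g x ≡ g y → x ≡ y
    g-inj zero    zero    q = refl
    g-inj zero    (suc e) q = contradiction (sym q) (proj₁ (proj₂ (child e)))
    g-inj (suc e) zero    q = contradiction q (proj₁ (proj₂ (child e)))
    g-inj (suc e) (suc d) q =
      cong suc (via-unique _ (proj₂ (child e)) (subst (Via d) (sym q) (proj₂ (child d))))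
  e₀ : Fin (ne G)
  e₀ = proj₁ missed
  toRoot : ∀ k u → rank u < k → Conn ⌜ G ⌝ (_≢ e₀) u r
  toRoot (suc k) u (s≤s u≤k) with u Fin.≟ r | parent u in eq
  ... | yes refl | _ = here
  ... | no u≢r | inj₁ u≡r = contradiction u≡r u≢r
  ... | no u≢r | inj₂ (e , w , _ , j , w<u) =
    step e (λ e≡ → proj₂ missed (u , u≢r , subst [ (λ _ → ⊥) , (λ p → proj₁ p ≡ e₀) ]′ (sym eq) e≡)) j
      (toRoot k w (ℕ.<-≤-trans w<u u≤k))

decompose : (G : Graph) → Connected G → nv G ≡ ne G →
            ∃ λ n → ∃ λ (T : Fin (suc n) → RootedTree) → (∀ i → IsRootedTree (T i)) × AIso (Glued T) ⌜ G ⌝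
decompose G (r , walk) nv≡ne = _ , branch , branch-isRootedTree , decomposition
  where
  nb : ∃ λ e₀ → ∀ u → Conn ⌜ G ⌝ (_≢ e₀) u r
  nb = nonbridge G nv≡ne r (λ u → fromWalk (walk u r))
  e₀ : Fin (ne G)
  e₀ = proj₁ nb
  a b : Fin (nv G)
  a = proj₁ (ends G e₀)
  b = proj₂ (ends G e₀)
  P : Parents G (_≢ e₀) a
  P = parents G (λ e → ¬? (e Fin.≟ e₀)) a (λ u → Conn-trans (proj₂ nb u) (Conn-sym (proj₂ nb a)))
  open Parents P
  open Out P e₀ (λ ¬p → ¬p refl)
  f : Fin (nv G) → Fin (nv G)
  -- The root `a` crosses `e₀` to its other end `b`, which closes the cycle; if `e₀` is a loop, `a`
  -- is a fixed point and the cycle has length 1.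
  f u = [ (λ _ → b) , (λ (_ , w , _) → w) ]′ (parent u)
  out-joins : ∀ u → Joins ⌜ G ⌝ (out u) u (f u)
  out-joins u with parent u
  ... | inj₁ refl = inj₁ refl
  ... | inj₂ (_ , _ , _ , j , _) = j
  reach : ∀ k u → rank u < k → ∃ λ k → fold u f k ≡ a
  reach (suc k) u (s≤s u≤k) with parent u in eq
  ... | inj₁ u≡a = 0 , u≡a
  ... | inj₂ (_ , w , _ , _ , w<u) =
    let (j , p) = reach k w (ℕ.<-≤-trans w<u u≤k)
        f≡w : f u ≡ w
        f≡w = cong [ (λ _ → b) , (λ (_ , w , _) → w) ]′ eq
    in suc j , trans (sym (fold-suc f j u)) (trans (cong (λ x → fold x f j) f≡w) p)
  open Functional G nv≡ne out out-injective f out-joins a (λ u → reach (suc (rank u)) u ℕ.≤-refl)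

-- Isomorphisms of glued graphs

decΠ : ∀ {n} (g : Fin n → ℕ) → Fin (ΣN.prod g) → ∀ i → Fin (g i)
decΠ {suc n} g k zero    = proj₁ (remQuot {g zero} (ΣN.prod (g ∘ suc)) k)
decΠ {suc n} g k (suc i) = decΠ (g ∘ suc) (proj₂ (remQuot {g zero} (ΣN.prod (g ∘ suc)) k)) i

encΠ : ∀ {n} (g : Fin n → ℕ) → (∀ i → Fin (g i)) → Fin (ΣN.prod g)
encΠ {zero}  g t = zero
encΠ {suc n} g t = combine (t zero) (encΠ (g ∘ suc) (t ∘ suc))

dec-encΠ : ∀ {n} (g : Fin n → ℕ) t i → decΠ g (encΠ g t) i ≡ t i
dec-encΠ {suc n} g t zero = cong proj₁ (Fin.remQuot-combine (t zero) (encΠ (g ∘ suc) (t ∘ suc)))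
dec-encΠ {suc n} g t (suc i) =
  trans (cong (λ k → decΠ (g ∘ suc) (proj₂ k) i) (Fin.remQuot-combine (t zero) (encΠ (g ∘ suc) (t ∘ suc))))
        (dec-encΠ (g ∘ suc) (t ∘ suc) i)

decΠ-inj : ∀ {n} (g : Fin n → ℕ) k l → (∀ i → decΠ g k i ≡ decΠ g l i) → k ≡ l
decΠ-inj {zero}  g zero zero e = refl
decΠ-inj {suc n} g k l e =
  trans (sym (Fin.combine-remQuot {g zero} (ΣN.prod (g ∘ suc)) k))
  (trans (cong₂ combine (e zero) (decΠ-inj (g ∘ suc) _ _ (e ∘ suc)))
         (Fin.combine-remQuot {g zero} (ΣN.prod (g ∘ suc)) l))

AIso-Joins : ∀ {A B} (f : AIso A B) {e u w} → Joins A e u w → Joins B (τ→ f e) (σ→ f u) (σ→ f w)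
AIso-Joins f {e} j with AIso.ε f e | AIso.compat f e
AIso-Joins f (inj₁ p) | false | q = inj₁ (trans q (cong (mapPair (σ→ f)) p))
AIso-Joins f (inj₂ p) | false | q = inj₂ (trans q (cong (mapPair (σ→ f)) p))
AIso-Joins f (inj₁ p) | true  | q = inj₂ (trans q (cong (orient true ∘ mapPair (σ→ f)) p))
AIso-Joins f (inj₂ p) | true  | q = inj₁ (trans q (cong (orient true ∘ mapPair (σ→ f)) p))

AIso-Conn : ∀ {A B} (f : AIso A B) {e u v} → Conn A (_≢ e) u v → Conn B (_≢ τ→ f e) (σ→ f u) (σ→ f v)
AIso-Conn f here = here
AIso-Conn f (step e ≢e j c) =
  step (τ→ f e) (λ p → ≢e (↔-injective (AIso.τ f) p)) (AIso-Joins f {e} j) (AIso-Conn f c)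

Conn-const : ∀ {A Q} {X : Set} (g : Vtx A → X) → (∀ e {u w} → Joins A e u w → g u ≡ g w) →
             ∀ {u v} → Conn A Q u v → g u ≡ g v
Conn-const g h here           = refl
Conn-const g h (step e _ j c) = trans (h e j) (Conn-const g h c)

module _ {n} (T : Fin n → RootedTree) where
  -- The retraction onto tree `i` that sends all other trees to its root. Edges outside tree `i`
  -- collapse, so a walk in the glued graph projects to a walk in the tree.
  fold-to : ∀ i → Vtx (Glued T) → Fin (nv (tree (T i)))
  fold-to i (j , v) with j Fin.≟ i
  ... | yes refl = v
  ... | no  _    = root (T i)

  fold-to-same : ∀ i v → fold-to i (i , v) ≡ v
  fold-to-same i v with i Fin.≟ i
  ... | yes refl = refl
  ... | no  i≢i  = contradiction refl i≢i

  fold-to-root : ∀ i j → fold-to i (j , root (T j)) ≡ root (T i)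
  fold-to-root i j with j Fin.≟ i
  ... | yes refl = refl
  ... | no  _    = refl

  fold-to-Conn : ∀ i e {u v} → Conn (Glued T) (_≢ inj₂ (i , e)) u v →
                 Conn ⌜ tree (T i) ⌝ (_≢ e) (fold-to i u) (fold-to i v)
  fold-to-Conn i e = Conn-map (fold-to i) h
    where
    h : ∀ e′ → e′ ≢ inj₂ (i , e) →
        uncurry (λ u w → Conn ⌜ tree (T i) ⌝ (_≢ e) (fold-to i u) (fold-to i w)) (inc (Glued T) e′)
    h (inj₁ j) _ = subst (Conn ⌜ tree (T i) ⌝ (_≢ e) _)
      (trans (fold-to-root i j) (sym (fold-to-root i (nextF j)))) here
    h (inj₂ (j , e′)) ≢e with j Fin.≟ i
    ... | yes refl = step e′ (λ { refl → ≢e refl }) (inj₁ refl) here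
    ... | no  _    = here

  tree-edge-Joins : ∀ {i e d u v} → d ≡ inj₂ (i , e) → Joins (Glued T) d u v →
    ∃₂ λ x y → u ≡ (i , x) × v ≡ (i , y) × Joins ⌜ tree (T i) ⌝ e x y
  tree-edge-Joins refl (inj₁ refl) = _ , _ , refl , refl , inj₁ refl
  tree-edge-Joins refl (inj₂ refl) = _ , _ , refl , refl , inj₂ refl

  -- A detour around the edge would project under `fold-to` to a detour inside its tree,
  -- contradicting `tree-bridge`.
  tree-edge-bridge : (∀ i → IsRootedTree (T i)) → ∀ i e {u v} → Joins (Glued T) (inj₂ (i , e)) u v →
                     ¬ Conn (Glued T) (_≢ inj₂ (i , e)) u v
  tree-edge-bridge isTree i e j c with tree-edge-Joins {i} {e} refl j
  ... | x , y , refl , refl , j′ = tree-bridge (tree (T i)) (proj₁ (isTree i)) (sym (betti⇒ {tree (T i)} (proj₂ (isTree i)))) e j′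
    (≡.subst₂ (Conn ⌜ tree (T i) ⌝ (_≢ e)) (fold-to-same i x) (fold-to-same i y) (fold-to-Conn i e c))

module GluedIso {n m} {T : Fin n → RootedTree} {S : Fin m → RootedTree}
  (T-tree : ∀ i → IsRootedTree (T i)) (S-tree : ∀ i → IsRootedTree (S i)) where

  -- If the image were a cycle edge, the way round the rest of the cycle, pulled back along `f`,
  -- would be a detour around a bridge.
  tree-edge : (f : AIso (Glued T) (Glued S)) → ∀ i e → ∃₂ λ j e′ → τ→ f (inj₂ (i , e)) ≡ inj₂ (j , e′)
  tree-edge f i e with τ→ f (inj₂ (i , e)) in eq
  ... | inj₂ (j , e′) = j , e′ , refl
  ... | inj₁ j = ⊥-elim (tree-edge-bridge T T-tree i e joins conn)
    where
    g = AIso-sym f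
    back : τ→ g (inj₁ j) ≡ inj₂ (i , e)
    back = trans (cong (τ→ g) (sym eq)) (Inverse.strictlyInverseʳ (AIso.τ f) _)
    joins = subst (λ d → Joins (Glued T) d _ _) back (AIso-Joins g {inj₁ j} (inj₂ refl))
    conn = subst (λ d → Conn (Glued T) (_≢ d) _ _) back (AIso-Conn g (root-Conn S j (nextF j)))

module GluedIso₂ {n m} {T : Fin n → RootedTree} {S : Fin m → RootedTree}
  (T-tree : ∀ i → IsRootedTree (T i)) (S-tree : ∀ i → IsRootedTree (S i)) (f : AIso (Glued T) (Glued S)) where

  open GluedIso {T = T} {S} T-tree S-tree using (tree-edge)
  private
    module R = GluedIso {T = S} {T} S-tree T-tree

  -- By `tree-edge` for the inverse: a tree edge as image would be carried back to a tree edge.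
  -- Since `tree-edge` is used in both directions, it lives in a module of its own.
  cycle-edge : ∀ i → ∃ λ j → τ→ f (inj₁ i) ≡ inj₁ j
  cycle-edge i with τ→ f (inj₁ i) in eq
  ... | inj₁ j = j , refl
  ... | inj₂ (j , e) with R.tree-edge (AIso-sym f) j e
  ...   | _ , _ , q with trans (sym q) (trans (cong (τ← f) (sym eq)) (Inverse.strictlyInverseʳ (AIso.τ f) _))
  ...     | ()

  len-≤ : n ℕ.≤ m
  len-≤ = Fin.injective⇒≤ {f = proj₁ ∘ cycle-edge} λ {i} {j} e → inj₁-injective (↔-injective (AIso.τ f)
    (trans (proj₂ (cycle-edge i)) (trans (cong inj₁ e) (sym (proj₂ (cycle-edge j))))))

  -- A root is an end of a cycle edge, and both ends of the image of that edge are roots, whichever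
  -- way `f` turns it.
  root-to-root : ∀ i → ∃ λ j → σ→ f (i , root (T i)) ≡ (j , root (S j))
  root-to-root i = go (AIso-Joins f {inj₁ i} (inj₁ refl))
    where
    go : ∀ {v w} → Joins (Glued S) (τ→ f (inj₁ i)) v w → ∃ λ j → v ≡ (j , root (S j))
    go j with τ→ f (inj₁ i) | cycle-edge i
    go (inj₁ p) | _ | _ , refl = _ , sym (cong proj₁ p)
    go (inj₂ p) | _ | _ , refl = _ , sym (cong proj₂ p)

  pos : Fin n → Fin m
  pos i = proj₁ (root-to-root i)

  -- Tree edges go to tree edges and so stay at one position; connectedness of the tree spreads the
  -- position of the root to all its vertices.
  vertex-pos : ∀ i v → proj₁ (σ→ f (i , v)) ≡ pos i
  vertex-pos i v = trans
    (Conn-const {Q = λ _ → ⊤} (λ v → proj₁ (σ→ f (i , v))) same (fromWalk (proj₂ (proj₁ (T-tree i)) v (root (T i)))))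
    (cong proj₁ (proj₂ (root-to-root i)))
    where
    same : ∀ e {u w} → Joins ⌜ tree (T i) ⌝ e u w → proj₁ (σ→ f (i , u)) ≡ proj₁ (σ→ f (i , w))
    same e j = go (AIso-Joins f {inj₂ (i , e)} (Sum.map (cong (mapPair (i ,_))) (cong (mapPair (i ,_))) j))
      where
      go : ∀ {x y} → Joins (Glued S) (τ→ f (inj₂ (i , e))) x y → proj₁ x ≡ proj₁ y
      go j = let (_ , _ , q) = tree-edge f i e ; (_ , _ , p , p′ , _) = tree-edge-Joins S q j in
        trans (cong proj₁ p) (sym (cong proj₁ p′))

  edge-pos : ∀ i e → ∃ λ e′ → τ→ f (inj₂ (i , e)) ≡ inj₂ (pos i , e′)
  edge-pos i e with tree-edge f i e
  ... | k , e′ , q with tree-edge-Joins S q (AIso-Joins f {inj₂ (i , e)} (inj₁ refl))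
  ...   | _ , _ , p , _ with trans (sym (cong proj₁ p)) (vertex-pos i _)
  ...     | refl = e′ , q

  pos-inj : Injective _≡_ _≡_ pos
  pos-inj {i} {j} e = cong proj₁ (↔-injective (AIso.σ f) (trans (proj₂ (root-to-root i))
    (trans (cong (λ k → k , root (S k)) e) (sym (proj₂ (root-to-root j))))))

  cycle-edge-inj : Injective _≡_ _≡_ (proj₁ ∘ cycle-edge)
  cycle-edge-inj {i} {j} e = inj₁-injective (↔-injective (AIso.τ f)
    (trans (proj₂ (cycle-edge i)) (trans (cong inj₁ e) (sym (proj₂ (cycle-edge j))))))

  cycle-compat : ∀ i → (proj₁ (cycle-edge i) , nextF (proj₁ (cycle-edge i)))
                       ≡ orient (AIso.ε f (inj₁ i)) (pos i , pos (nextF i))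
  cycle-compat i = begin
    mapPair proj₁ (inc (Glued S) (inj₁ (proj₁ (cycle-edge i))))
      ≡⟨ cong (mapPair proj₁ ∘ inc (Glued S)) (sym (proj₂ (cycle-edge i))) ⟩
    mapPair proj₁ (inc (Glued S) (τ→ f (inj₁ i)))
      ≡⟨ cong (mapPair proj₁) (AIso.compat f (inj₁ i)) ⟩
    mapPair proj₁ (orient (AIso.ε f (inj₁ i)) (mapPair (σ→ f) (inc (Glued T) (inj₁ i))))
      ≡⟨ sym (orient-mapPair proj₁ (AIso.ε f (inj₁ i)) _) ⟩
    orient (AIso.ε f (inj₁ i)) (mapPair (proj₁ ∘ σ→ f) (inc (Glued T) (inj₁ i)))
      ≡⟨ cong (orient (AIso.ε f (inj₁ i))) (cong₂ _,_ (vertex-pos _ _) (vertex-pos _ _)) ⟩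
    orient (AIso.ε f (inj₁ i)) (pos i , pos (nextF i)) ∎
    where open ≡.≡-Reasoning

glued-length : ∀ {n m} {T : Fin n → RootedTree} {S : Fin m → RootedTree} →
  (∀ i → IsRootedTree (T i)) → (∀ i → IsRootedTree (S i)) → AIso (Glued T) (Glued S) → n ≡ m
glued-length {T = T} {S} T-tree S-tree f =
  ℕ.≤-antisym (GluedIso₂.len-≤ {T = T} {S} T-tree S-tree f) (GluedIso₂.len-≤ {T = S} {T} S-tree T-tree (AIso-sym f))

-- Cycle automorphisms with families of rooted isomorphisms

RootedSetoid : RootedTree → RootedTree → Setoid 0ℓ 0ℓ
RootedSetoid T U = Restrict (AIsoSetoid ⌜ tree T ⌝ ⌜ tree U ⌝) (λ f → σ→ f (root T) ≡ root U)

module _ {n} {T S : Fin n → RootedTree} (ψ : AIso ⌜ cycle n ⌝ ⌜ cycle n ⌝)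
  (ρ : ∀ i → Setoid.Carrier (RootedSetoid (T i) (S (σ→ ψ i)))) where
  private
    ψ-surj : ∀ j → ∃ λ i → σ→ ψ i ≡ j
    ψ-surj j = σ← ψ j , Inverse.strictlyInverseˡ (AIso.σ ψ) j

    V : Vtx (Glued T) → Vtx (Glued S)
    V (i , v) = σ→ ψ i , σ→ (proj₁ (ρ i)) v

    E : Edg (Glued T) → Edg (Glued S)
    E (inj₁ i)       = inj₁ (τ→ ψ i)
    E (inj₂ (i , e)) = inj₂ (σ→ ψ i , τ→ (proj₁ (ρ i)) e)

    V-inj : Injective _≡_ _≡_ V
    V-inj {i , v} {j , w} e with ↔-injective (AIso.σ ψ) (cong proj₁ e)
    ... | refl = cong (i ,_) (↔-injective (AIso.σ (proj₁ (ρ i))) (Σ-injective₂ e))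

    V-surj : ∀ y → ∃ λ x → V x ≡ y
    V-surj (j , w) with ψ-surj j
    ... | i , refl = (i , σ← (proj₁ (ρ i)) w) , cong (σ→ ψ i ,_) (Inverse.strictlyInverseˡ (AIso.σ (proj₁ (ρ i))) w)

    E-inj : Injective _≡_ _≡_ E
    E-inj {inj₁ i} {inj₁ j} e = cong inj₁ (↔-injective (AIso.τ ψ) (inj₁-injective e))
    E-inj {inj₂ (i , v)} {inj₂ (j , w)} e with ↔-injective (AIso.σ ψ) (cong proj₁ (inj₂-injective e))
    ... | refl = cong (λ w → inj₂ (i , w)) (↔-injective (AIso.τ (proj₁ (ρ i))) (Σ-injective₂ (inj₂-injective e)))

    E-surj : ∀ y → ∃ λ x → E x ≡ y
    E-surj (inj₁ j) = inj₁ (τ← ψ j) , cong inj₁ (Inverse.strictlyInverseˡ (AIso.τ ψ) j)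
    E-surj (inj₂ (j , w)) with ψ-surj j
    ... | i , refl = inj₂ (i , τ← (proj₁ (ρ i)) w) ,
                     cong (λ w → inj₂ (σ→ ψ i , w)) (Inverse.strictlyInverseˡ (AIso.τ (proj₁ (ρ i))) w)

    flip : Edg (Glued T) → Bool
    flip (inj₁ i)       = AIso.ε ψ i
    flip (inj₂ (i , e)) = AIso.ε (proj₁ (ρ i)) e

    cmp : ∀ e → inc (Glued S) (E e) ≡ orient (flip e) (mapPair V (inc (Glued T) e))
    cmp (inj₁ i) = begin
      mapPair r (ends (cycle n) (τ→ ψ i))
        ≡⟨ cong (mapPair r) (AIso.compat ψ i) ⟩
      mapPair r (orient (AIso.ε ψ i) (mapPair (σ→ ψ) (i , nextF i)))
        ≡⟨ sym (orient-mapPair r (AIso.ε ψ i) _) ⟩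
      orient (AIso.ε ψ i) (mapPair (r ∘ σ→ ψ) (i , nextF i))
        ≡⟨ cong (orient (AIso.ε ψ i)) (cong₂ _,_ (rV i) (rV (nextF i))) ⟩
      orient (AIso.ε ψ i) (mapPair V (inc (Glued T) (inj₁ i))) ∎
      where
      open ≡.≡-Reasoning
      r : Fin n → Vtx (Glued S)
      r j = j , root (S j)
      rV : ∀ i → r (σ→ ψ i) ≡ V (i , root (T i))
      rV i = cong (σ→ ψ i ,_) (sym (proj₂ (ρ i)))
    cmp (inj₂ (i , e)) = trans (cong (mapPair (σ→ ψ i ,_)) (AIso.compat (proj₁ (ρ i)) e))
      (sym (orient-mapPair (σ→ ψ i ,_) (AIso.ε (proj₁ (ρ i)) e) _))

  glueIso : AIso (Glued T) (Glued S)
  glueIso = record { σ = inj-surj⇒↔ V V-inj V-surj ; τ = inj-surj⇒↔ E E-inj E-surj ; ε = flip ; compat = cmp }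

module _ {n} {T S : Fin n → RootedTree} (T-tree : ∀ i → IsRootedTree (T i)) (S-tree : ∀ i → IsRootedTree (S i))
  (f : AIso (Glued T) (Glued S)) where
  open GluedIso₂ {T = T} {S} T-tree S-tree f

  -- May also be a reflection. Edge map and flags are recorded because for `n` at most 2 the vertex
  -- map does not determine them.
  rotation : AIso ⌜ cycle n ⌝ ⌜ cycle n ⌝
  rotation = record
    { σ = inj⇒↔ refl pos pos-inj
    ; τ = inj⇒↔ refl (proj₁ ∘ cycle-edge) cycle-edge-inj
    ; ε = AIso.ε f ∘ inj₁
    ; compat = cycle-compat }

  -- An enumerated automorphism agrees with `pos` only pointwise, yet the type of the rooted
  -- isomorphisms mentions the target `S (κ i)`. Taking `κ` as a parameter avoids transporting whole
  -- isomorphisms.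
  module _ (κ : Fin n → Fin n) (κ≗pos : κ ≗ pos) where
    private
      at-pos : ∀ {B : Fin n → Set} {j} (p : Σ (Fin n) B) → proj₁ p ≡ j → ∃ λ w → p ≡ (j , w)
      at-pos (j , w) refl = w , refl

      v-at : ∀ i v → ∃ λ w → σ→ f (i , v) ≡ (κ i , w)
      v-at i v = at-pos (σ→ f (i , v)) (trans (vertex-pos i v) (sym (κ≗pos i)))

      e-at : ∀ i e → ∃ λ d → τ→ f (inj₂ (i , e)) ≡ inj₂ (κ i , d)
      e-at i e = subst (λ k → ∃ λ d → τ→ f (inj₂ (i , e)) ≡ inj₂ (k , d)) (sym (κ≗pos i)) (edge-pos i e)

      κ-inj : ∀ {i j} → κ i ≡ κ j → i ≡ j
      κ-inj {i} {j} e = pos-inj (trans (sym (κ≗pos i)) (trans e (κ≗pos j)))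

    restrict : ∀ i → Setoid.Carrier (RootedSetoid (T i) (S (κ i)))
    restrict i = record
      { σ = inj-surj⇒↔ (proj₁ ∘ v-at i)
          (λ {v} {w} e → Σ-injective₂ (↔-injective (AIso.σ f)
            (trans (proj₂ (v-at i v)) (trans (cong (κ i ,_) e) (sym (proj₂ (v-at i w)))))))
          (λ w → v-onto w (σ← f (κ i , w)) (Inverse.strictlyInverseˡ (AIso.σ f) _))
      ; τ = inj-surj⇒↔ (proj₁ ∘ e-at i)
          (λ {v} {w} e → Σ-injective₂ (inj₂-injective (↔-injective (AIso.τ f)
            (trans (proj₂ (e-at i v)) (trans (cong (λ w → inj₂ (κ i , w)) e) (sym (proj₂ (e-at i w))))))))
          (λ w → e-onto w (τ← f (inj₂ (κ i , w))) (Inverse.strictlyInverseˡ (AIso.τ f) _))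
      ; ε = λ e → AIso.ε f (inj₂ (i , e))
      ; compat = λ e → mapPair-inj (begin
          inc (Glued S) (inj₂ (κ i , proj₁ (e-at i e)))
            ≡⟨ cong (inc (Glued S)) (sym (proj₂ (e-at i e))) ⟩
          inc (Glued S) (τ→ f (inj₂ (i , e)))
            ≡⟨ AIso.compat f (inj₂ (i , e)) ⟩
          orient (AIso.ε f (inj₂ (i , e))) (mapPair (σ→ f ∘ (i ,_)) (ends (tree (T i)) e))
            ≡⟨ cong (orient (AIso.ε f (inj₂ (i , e)))) (cong₂ _,_ (proj₂ (v-at i _)) (proj₂ (v-at i _))) ⟩
          orient (AIso.ε f (inj₂ (i , e))) (mapPair ((κ i ,_) ∘ proj₁ ∘ v-at i) (ends (tree (T i)) e))
            ≡⟨ orient-mapPair (κ i ,_) (AIso.ε f (inj₂ (i , e))) _ ⟩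
          mapPair (κ i ,_) (orient (AIso.ε f (inj₂ (i , e))) (mapPair (proj₁ ∘ v-at i) (ends (tree (T i)) e))) ∎) }
      , root-at
      where
      open ≡.≡-Reasoning
      mapPair-inj : ∀ {B : Fin n → Set} {k} {p q : B k × B k} →
                    _≡_ {A = Σ (Fin n) B × Σ (Fin n) B} (mapPair (k ,_) p) (mapPair (k ,_) q) → p ≡ q
      mapPair-inj refl = refl
      v-onto : ∀ w p → σ→ f p ≡ (κ i , w) → ∃ λ v → proj₁ (v-at i v) ≡ w
      v-onto w (j , v) e with κ-inj (cong proj₁ (trans (sym (proj₂ (v-at j v))) e))
      ... | refl = v , Σ-injective₂ (trans (sym (proj₂ (v-at j v))) e)
      e-onto : ∀ w d → τ→ f d ≡ inj₂ (κ i , w) → ∃ λ v → proj₁ (e-at i v) ≡ w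
      e-onto w (inj₁ j) e with trans (sym e) (proj₂ (cycle-edge j))
      ... | ()
      e-onto w (inj₂ (j , v)) e with κ-inj (cong proj₁ (inj₂-injective (trans (sym (proj₂ (e-at j v))) e)))
      ... | refl = v , Σ-injective₂ (inj₂-injective (trans (sym (proj₂ (e-at j v))) e))
      root-at : proj₁ (v-at i (root (T i))) ≡ root (S (κ i))
      root-at = same-root (κ≗pos i) (trans (sym (proj₂ (v-at i (root (T i))))) (proj₂ (root-to-root i)))
        where
        same-root : ∀ {j k w} → j ≡ k → _≡_ {A = Vtx (Glued S)} (j , w) (k , root (S k)) → w ≡ root (S j)
        same-root refl p = Σ-injective₂ p

    restrict-σ : ∀ i v → σ→ f (i , v) ≡ (κ i , σ→ (proj₁ (restrict i)) v)
    restrict-σ i v = proj₂ (v-at i v)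

    restrict-τ : ∀ i e → τ→ f (inj₂ (i , e)) ≡ inj₂ (κ i , τ→ (proj₁ (restrict i)) e)
    restrict-τ i e = proj₂ (e-at i e)

Card-Glued : ∀ {n} {T S : Fin n → RootedTree} → (∀ i → IsRootedTree (T i)) → (∀ i → IsRootedTree (S i)) →
  ∀ {A} (autC : Card (AIsoSetoid ⌜ cycle n ⌝ ⌜ cycle n ⌝) A)
  (h : Fin n → Fin n → ℕ) → (∀ i j → Card (RootedSetoid (T i) (S j)) (h i j)) →
  Card (AIsoSetoid (Glued T) (Glued S)) (ΣN.sum λ a → ΣN.prod λ i → h i (σ→ (Card.at autC a) i))
Card-Glued {n} {T} {S} T-tree S-tree {A} autC h homC =
  Card-map (≡.setoid (Σ (Fin A) (Fin ∘ P))) (AIsoSetoid (Glued T) (Glued S)) g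
    (λ { {x} refl → Setoid.refl (AIsoSetoid (Glued T) (Glued S)) {g x} }) g-inj g-surj
    (Card-Σ P (λ a → Card-Fin (P a)))
  where
  ψ : Fin A → AIso ⌜ cycle n ⌝ ⌜ cycle n ⌝
  ψ = Card.at autC
  H : Fin A → Fin n → ℕ
  H a i = h i (σ→ (ψ a) i)
  P : Fin A → ℕ
  P a = ΣN.prod (H a)
  ρ : ∀ a (k : Fin (P a)) i → Setoid.Carrier (RootedSetoid (T i) (S (σ→ (ψ a) i)))
  ρ a k i = Card.at (homC i (σ→ (ψ a) i)) (decΠ (H a) k i)
  g : Σ (Fin A) (Fin ∘ P) → AIso (Glued T) (Glued S)
  g (a , k) = glueIso {T = T} {S} (ψ a) (ρ a k)
  g-inj : ∀ {x y} → g x ≈ᵢ g y → x ≡ y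
  g-inj {a , k} {b , l} (es , et , ee)
    with at-inj (isEnum autC) a b ((λ i → cong proj₁ (es (i , root (T i)))) , (λ i → inj₁-injective (et (inj₁ i))) , (λ i → ee (inj₁ i)))
  ... | refl = cong (a ,_) (decΠ-inj (H a) k l λ i → at-inj (isEnum (homC i (σ→ (ψ a) i))) _ _
      ((λ v → Σ-injective₂ (es (i , v))) , (λ e → Σ-injective₂ (inj₂-injective (et (inj₂ (i , e))))) , (λ e → ee (inj₂ (i , e)))))
  g-surj : ∀ f → ∃ λ x → g x ≈ᵢ f
  g-surj f = (a , k) , eσ , eτ , eε
    where
    found : ∃ λ a → ψ a ≈ᵢ rotation {T = T} {S} T-tree S-tree f
    found = at-surj (isEnum autC) (rotation {T = T} {S} T-tree S-tree f)
    a : Fin A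
    a = proj₁ found
    r : ∀ i → Setoid.Carrier (RootedSetoid (T i) (S (σ→ (ψ a) i)))
    r = restrict {T = T} {S} T-tree S-tree f (σ→ (ψ a)) (proj₁ (proj₂ found))
    t : ∀ i → ∃ λ j → Setoid._≈_ (RootedSetoid (T i) (S (σ→ (ψ a) i))) (Card.at (homC i (σ→ (ψ a) i)) j) (r i)
    t i = at-surj (isEnum (homC i (σ→ (ψ a) i))) (r i)
    k : Fin (P a)
    k = encΠ (H a) (proj₁ ∘ t)
    ρ≈r : ∀ i → Setoid._≈_ (RootedSetoid (T i) (S (σ→ (ψ a) i))) (ρ a k i) (r i)
    ρ≈r i = subst (λ j → Setoid._≈_ (RootedSetoid (T i) (S (σ→ (ψ a) i))) (Card.at (homC i (σ→ (ψ a) i)) j) (r i))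
                  (sym (dec-encΠ (H a) (proj₁ ∘ t) i)) (proj₂ (t i))
    eσ : σ→ (g (a , k)) ≗ σ→ f
    eσ (i , v) = trans (cong (σ→ (ψ a) i ,_) (proj₁ (ρ≈r i) v))
                       (sym (restrict-σ {T = T} {S} T-tree S-tree f (σ→ (ψ a)) (proj₁ (proj₂ found)) i v))
    eτ : τ→ (g (a , k)) ≗ τ→ f
    eτ (inj₁ i) = trans (cong inj₁ (proj₁ (proj₂ (proj₂ found)) i)) (sym (proj₂ (GluedIso₂.cycle-edge {T = T} {S} T-tree S-tree f i)))
    eτ (inj₂ (i , e)) = trans (cong (λ d → inj₂ (σ→ (ψ a) i , d)) (proj₁ (proj₂ (ρ≈r i)) e))
      (sym (restrict-τ {T = T} {S} T-tree S-tree f (σ→ (ψ a)) (proj₁ (proj₂ found)) i e))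
    eε : AIso.ε (g (a , k)) ≗ AIso.ε f
    eε (inj₁ i)       = proj₂ (proj₂ (proj₂ found)) i
    eε (inj₂ (i , e)) = proj₂ (proj₂ (ρ≈r i)) e

-- Colourings and their weights

ind : Bool → ℕ
ind b = if b then 1 else 0

⌊⌋-cong : ∀ {P Q : Set} (p? : Dec P) (q? : Dec Q) → (P → Q) → (Q → P) → ⌊ p? ⌋ ≡ ⌊ q? ⌋
⌊⌋-cong (yes p) q? f g = sym (dec⇒true q? (f p))
⌊⌋-cong (no ¬p) q? f g = sym (dec⇒false q? (¬p ∘ g))

-- The edge test inside `blackCount`, over any vertex type, so that it can be evaluated on the pairs
-- of a glued graph.
blackJoin : ∀ {V : Set} → DecidableEquality V → (V → Bool) → V → V × V → Bool
blackJoin _≟_ c v (a , b) = not ⌊ a ≟ b ⌋ ∧ ((⌊ a ≟ v ⌋ ∧ c b) ∨ (⌊ b ≟ v ⌋ ∧ c a))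

module _ {V : Set} (_≟_ : DecidableEquality V) where
  blackJoin-orient : ∀ c v b p → blackJoin _≟_ c v (orient b p) ≡ blackJoin _≟_ c v p
  blackJoin-orient c v false p       = refl
  blackJoin-orient c v true  (x , y) = cong₂ _∧_ (cong not (⌊⌋-cong (y ≟ x) (x ≟ y) sym sym)) (Bool.∨-comm (⌊ y ≟ v ⌋ ∧ c x) _)

  module _ {W : Set} (_≟′_ : DecidableEquality W) {f : V → W} where
    blackJoin-map : Injective _≡_ _≡_ f → ∀ c c′ → c′ ∘ f ≗ c → ∀ v p →
                    blackJoin _≟′_ c′ (f v) (mapPair f p) ≡ blackJoin _≟_ c v p
    blackJoin-map f-inj c c′ c≗ v (a , b) = cong₂ _∧_ (cong not (eq a b))
      (cong₂ _∨_ (cong₂ _∧_ (eq a v) (c≗ b)) (cong₂ _∧_ (eq b v) (c≗ a)))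
      where
      eq : ∀ x y → ⌊ f x ≟′ f y ⌋ ≡ ⌊ x ≟ y ⌋
      eq x y = ⌊⌋-cong (f x ≟′ f y) (x ≟ y) f-inj (cong f)

    blackJoin-off : ∀ c {w} → (∀ v → f v ≢ w) → ∀ p → blackJoin _≟′_ c w (mapPair f p) ≡ false
    blackJoin-off c {w} f≢ (a , b)
      rewrite dec⇒false (f a ≟′ w) (f≢ a) | dec⇒false (f b ≟′ w) (f≢ b) = Bool.∧-zeroʳ _

blackCount-sum : ∀ G c v → blackCount G c v ≡ ΣN.sum (λ e → ind (blackJoin Fin._≟_ c v (ends G e)))
blackCount-sum G c v = countB-allFin (λ e → blackJoin Fin._≟_ c v (ends G e))

blackCount-cong : ∀ G {c c′} → c ≗ c′ → ∀ v → blackCount G c v ≡ blackCount G c′ v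
blackCount-cong G {c} {c′} e v = trans (blackCount-sum G c v) (trans (ΣN.sum-cong-≋ (λ d →
  cong ind (blackJoin-map Fin._≟_ Fin._≟_ {f = id} id c′ c e v (ends G d))))
  (sym (blackCount-sum G c′ v)))

whiteEven-sum : ∀ G c → whiteEven G c ≡ ΣN.sum (λ v → ind (not (c v) ∧ isEven (blackCount G c v)))
whiteEven-sum G c = countB-allFin (λ v → not (c v) ∧ isEven (blackCount G c v))

blackCount-Iso : ∀ {G H} (f : AIso ⌜ G ⌝ ⌜ H ⌝) {c c′} → c′ ∘ σ→ f ≗ c → ∀ v →
                 blackCount H c′ (σ→ f v) ≡ blackCount G c v
blackCount-Iso {G} {H} f {c} {c′} c≗ v = begin
  blackCount H c′ (σ→ f v)
    ≡⟨ blackCount-sum H c′ (σ→ f v) ⟩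
  ΣN.sum (λ e → ind (blackJoin Fin._≟_ c′ (σ→ f v) (ends H e)))
    ≡⟨ ΣN.sum-permute (λ e → ind (blackJoin Fin._≟_ c′ (σ→ f v) (ends H e))) (AIso.τ f) ⟩
  ΣN.sum (λ e → ind (blackJoin Fin._≟_ c′ (σ→ f v) (ends H (τ→ f e))))
    ≡⟨ ΣN.sum-cong-≋ (λ e → cong ind (begin
         blackJoin Fin._≟_ c′ (σ→ f v) (ends H (τ→ f e))
           ≡⟨ cong (blackJoin Fin._≟_ c′ (σ→ f v)) (AIso.compat f e) ⟩
         blackJoin Fin._≟_ c′ (σ→ f v) (orient (AIso.ε f e) (mapPair (σ→ f) (ends G e)))
           ≡⟨ blackJoin-orient Fin._≟_ c′ (σ→ f v) (AIso.ε f e) _ ⟩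
         blackJoin Fin._≟_ c′ (σ→ f v) (mapPair (σ→ f) (ends G e))
           ≡⟨ blackJoin-map Fin._≟_ Fin._≟_ (↔-injective (AIso.σ f)) c c′ c≗ v (ends G e) ⟩
         blackJoin Fin._≟_ c v (ends G e) ∎)) ⟩
  ΣN.sum (λ e → ind (blackJoin Fin._≟_ c v (ends G e)))
    ≡⟨ sym (blackCount-sum G c v) ⟩
  blackCount G c v ∎
  where open ≡.≡-Reasoning

whiteEven-Iso : ∀ {G H} (f : AIso ⌜ G ⌝ ⌜ H ⌝) {c c′} → c′ ∘ σ→ f ≗ c → whiteEven H c′ ≡ whiteEven G c
whiteEven-Iso {G} {H} f {c} {c′} c≗ = trans (whiteEven-sum H c′) (trans
  (ΣN.sum-permute (λ v → ind (not (c′ v) ∧ isEven (blackCount H c′ v))) (AIso.σ f))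
  (trans (ΣN.sum-cong-≋ (λ v → cong₂ (λ x y → ind (not x ∧ isEven y)) (c≗ v) (blackCount-Iso f {c} {c′} c≗ v)))
         (sym (whiteEven-sum G c))))

whiteEven-cong : ∀ G {c c′} → c ≗ c′ → whiteEven G c ≡ whiteEven G c′
whiteEven-cong G {c} {c′} e = trans (whiteEven-sum G c) (trans
  (ΣN.sum-cong-≋ (λ v → cong₂ (λ x y → ind (not x ∧ isEven y)) (e v) (blackCount-cong G e v)))
  (sym (whiteEven-sum G c′)))

-- A bijection of setoids induces a bijection between the index sets of any two enumerations, and
-- sums are invariant under permutation.
reindex : (S S′ : Setoid 0ℓ 0ℓ) {m n : ℕ} {at : Fin m → Setoid.Carrier S} {at′ : Fin n → Setoid.Carrier S′} →
  IsEnum S at → IsEnum S′ at′ → (f : Setoid.Carrier S → Setoid.Carrier S′) →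
  (∀ {x y} → Setoid._≈_ S x y → Setoid._≈_ S′ (f x) (f y)) →
  (∀ {x y} → Setoid._≈_ S′ (f x) (f y) → Setoid._≈_ S x y) →
  (∀ y → ∃ λ x → Setoid._≈_ S′ (f x) y) →
  (F : Setoid.Carrier S → ℚ) (F′ : Setoid.Carrier S′ → ℚ) →
  (∀ {x y} → Setoid._≈_ S′ (f x) y → F x ≡ F′ y) →
  ΣQ.sum (F ∘ at) ≡ ΣQ.sum (F′ ∘ at′)
reindex S S′ {m} {n} {at} {at′} A A′ f f-cong f-inj f-surj F F′ e =
  trans (ΣQ.sum-cong-≋ (λ i → e (S′.sym (proj₂ (find i))))) (sym (ΣQ.sum-permute (F′ ∘ at′) π))
  where
  module S′ = Setoid S′
  find : ∀ i → ∃ λ j → S′._≈_ (at′ j) (f (at i))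
  find i = at-surj A′ (f (at i))
  π : Fin m ↔ Fin n
  π = inj-surj⇒↔ (proj₁ ∘ find)
    (λ {i} {j} p → at-inj A i j (f-inj (S′.trans (S′.sym (proj₂ (find i)))
      (subst (λ k → S′._≈_ (at′ k) (f (at j))) (sym p) (proj₂ (find j))))))
    (λ k → let (x , fx≈) = f-surj (at′ k) ; (i , i≈) = at-surj A x in
      i , at-inj A′ _ _ (S′.trans (proj₂ (find i)) (S′.trans (f-cong i≈) fx≈)))

colorings-isEnum : ∀ G → IsEnum (Fin (nv G) →-setoid Bool) (lookup (colorings G))
colorings-isEnum G = allFuns-isEnum (nv G) bools-Unique ∈-bools

weight : (ℤ → ℚ) → Graph → ℚ
weight φ G = ΣQ.∑ (colorings G) (λ c → φ (+ whiteEven G c))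

weight-Iso : ∀ φ {G H} → AIso ⌜ G ⌝ ⌜ H ⌝ → weight φ G ≡ weight φ H
weight-Iso φ {G} {H} f = reindex (Fin (nv G) →-setoid Bool) (Fin (nv H) →-setoid Bool)
  (colorings-isEnum G) (colorings-isEnum H) (_∘ σ← f) (λ e x → e (σ← f x))
  (λ {c} {c′} e x → subst (λ x → c x ≡ c′ x) (Inverse.strictlyInverseʳ (AIso.σ f) x) (e (σ→ f x)))
  (λ c → c ∘ σ→ f , λ x → cong c (Inverse.strictlyInverseˡ (AIso.σ f) x))
  (λ c → φ (+ whiteEven G c)) (λ c → φ (+ whiteEven H c)) (λ {c} {c′} e → cong (φ ∘ +_) (sym (whiteEven-Iso f {c} {c′} λ x →
    trans (sym (e (σ→ f x))) (cong c (Inverse.strictlyInverseʳ (AIso.σ f) x)))))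

-- Colourings of a glued graph as families of tree colourings

Col : RootedTree → Set
Col T = Fin (nv (tree T)) → Bool

ColΠ : ∀ {n} → (Fin n → RootedTree) → Setoid 0ℓ 0ℓ
ColΠ {n} T = record
  { Carrier = ∀ i → Col (T i)
  ; _≈_ = λ c d → ∀ i → c i ≗ d i
  ; isEquivalence = record
    { refl = λ _ _ → refl ; sym = λ e i x → sym (e i x) ; trans = λ e e′ i x → trans (e i x) (e′ i x) } }

consΠ : ∀ {n} {T : Fin (suc n) → RootedTree} → Col (T zero) → (∀ i → Col (T (suc i))) → ∀ i → Col (T i)
consΠ d ds zero    = d
consΠ d ds (suc i) = ds i

-- The type of a colouring varies with the tree, so vectors over one list do not fit. The recursion
-- of `allVecs` is kept, so that sums split off the first tree.
allColΠ : ∀ n (T : Fin n → RootedTree) → List (∀ i → Col (T i))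
allColΠ zero    T = (λ ()) ∷ []
allColΠ (suc n) T = concatMap (λ d → map (consΠ {T = T} d) (allColΠ n (T ∘ suc))) (colorings (tree (T zero)))

allColΠ-suc : ∀ n (T : Fin (suc n) → RootedTree) →
  allColΠ (suc n) T ≡ cartesianProductWith (consΠ {T = T}) (colorings (tree (T zero))) (allColΠ n (T ∘ suc))
allColΠ-suc n T = go (colorings (tree (T zero)))
  where
  go : ∀ ys → concatMap (λ d → map (consΠ {T = T} d) (allColΠ n (T ∘ suc))) ys
            ≡ cartesianProductWith (consΠ {T = T}) ys (allColΠ n (T ∘ suc))
  go []       = refl
  go (y ∷ ys) = cong (map (consΠ {T = T} y) (allColΠ n (T ∘ suc)) ++_) (go ys)

colorings-Unique : ∀ G → UniqueS.Unique (Fin (nv G) →-setoid Bool) (colorings G)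
colorings-Unique G =
  UniqueSP.map⁺ (≡.setoid _) (Fin (nv G) →-setoid Bool) lookup-≗⇒≡ (allVecs-Unique (nv G) bools-Unique)

IsEnum-∈ : (S : Setoid 0ℓ 0ℓ) {L : List (Setoid.Carrier S)} → IsEnum S (lookup L) → ∀ x → MemS._∈_ S x L
IsEnum-∈ S {L} A x = let (i , e) = at-surj A x in
  MemS.∈-resp-≈ S e (MemS.∈-lookup S L i)

allColΠ-Unique : ∀ n (T : Fin n → RootedTree) → UniqueS.Unique (ColΠ T) (allColΠ n T)
allColΠ-Unique zero    T = [] ∷ []
allColΠ-Unique (suc n) T = subst (UniqueS.Unique (ColΠ T)) (sym (allColΠ-suc n T))
  (UniqueSP.cartesianProductWith⁺ (Fin (nv (tree (T zero))) →-setoid Bool) (ColΠ (T ∘ suc)) (ColΠ T) consΠ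
    (λ e → e zero , e ∘ suc) (colorings-Unique (tree (T zero))) (allColΠ-Unique n (T ∘ suc)))

∈-allColΠ : ∀ n (T : Fin n → RootedTree) d → MemS._∈_ (ColΠ T) d (allColΠ n T)
∈-allColΠ zero    T d = here λ ()
∈-allColΠ (suc n) T d = subst (MemS._∈_ (ColΠ T) d) (sym (allColΠ-suc n T))
  (MemS.∈-resp-≈ (ColΠ T) {xs = cartesianProductWith (consΠ {T = T}) (colorings (tree (T zero))) (allColΠ n (T ∘ suc))}
    {x = consΠ (d zero) (d ∘ suc)} (λ { zero _ → refl ; (suc i) _ → refl })
    (MemS.∈-cartesianProductWith⁺ (Fin (nv (tree (T zero))) →-setoid Bool) (ColΠ (T ∘ suc)) (ColΠ T) {f = consΠ {T = T}}
      (λ { e e′ zero → e ; e e′ (suc i) → e′ i })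
      {xs = colorings (tree (T zero))} {ys = allColΠ n (T ∘ suc)} {a = d zero} {b = d ∘ suc}
      (IsEnum-∈ (Fin (nv (tree (T zero))) →-setoid Bool) {colorings (tree (T zero))} (colorings-isEnum (tree (T zero))) (d zero))
      (∈-allColΠ n (T ∘ suc) (d ∘ suc))))

allColΠ-isEnum : ∀ n (T : Fin n → RootedTree) → IsEnum (ColΠ T) (lookup (allColΠ n T))
allColΠ-isEnum n T = Unique⇒IsEnum (ColΠ T) (allColΠ-Unique n T)
  λ d → Any.index (∈-allColΠ n T d) , Setoid.sym (ColΠ T) {d} (Any.lookup-index (∈-allColΠ n T d))

module _ {n} (T : Fin n → RootedTree) (d : ∀ i → Col (T i)) where
  private
    V = Vtx (Glued T)
    _≟V_ : DecidableEquality V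
    _≟V_ = ≡-dec Fin._≟_ Fin._≟_
    enc : V → Fin (nv (glue T))
    enc = Inverse.from (glue-V T)

  gluedCol : Fin (nv (glue T)) → Bool
  gluedCol = uncurry d ∘ Inverse.to (glue-V T)

  rootCol : Fin n → Bool
  rootCol i = d i (root (T i))

  private
    gluedCol-enc : ∀ p → gluedCol (enc p) ≡ uncurry d p
    gluedCol-enc p = cong (uncurry d) (Inverse.strictlyInverseˡ (glue-V T) p)

    edge : V → Edg (Glued T) → ℕ
    edge v e = ind (blackJoin _≟V_ (uncurry d) v (inc (Glued T) e))

    glue-E-inj₁ : ∀ j → Inverse.to (glue-E T) (j ↑ˡ _) ≡ inj₁ j
    glue-E-inj₁ j rewrite Fin.splitAt-↑ˡ n j (ΣN.sum (λ i → ne (tree (T i)))) = refl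

    glue-E-inj₂ : ∀ j e → Inverse.to (glue-E T) (n ↑ʳ encΣ (λ i → ne (tree (T i))) j e) ≡ inj₂ (j , e)
    glue-E-inj₂ j e
      rewrite Fin.splitAt-↑ʳ n (ΣN.sum (λ i → ne (tree (T i)))) (encΣ (λ i → ne (tree (T i))) j e)
            | dec-encΣ (λ i → ne (tree (T i))) j e = refl

    blackCount-edges : ∀ v → blackCount (glue T) gluedCol (enc v) ≡
      ΣN.sum (λ j → edge v (inj₁ j)) ℕ.+ ΣN.sum (λ j → ΣN.sum (λ e → edge v (inj₂ (j , e))))
    blackCount-edges v = begin
      blackCount (glue T) gluedCol (enc v)
        ≡⟨ blackCount-sum (glue T) gluedCol (enc v) ⟩
      ΣN.sum (λ e → ind (blackJoin Fin._≟_ gluedCol (enc v) (ends (glue T) e)))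
        ≡⟨ ΣN.sum-cong-≋ (λ e → cong ind (blackJoin-map _≟V_ Fin._≟_ enc-inj (uncurry d) gluedCol gluedCol-enc v (inc (Glued T) (Inverse.to (glue-E T) e)))) ⟩
      ΣN.sum h
        ≡⟨ ΣN.sum-+ n m h ⟩
      ΣN.sum (λ (j : Fin n) → h (j ↑ˡ m)) ℕ.+ ΣN.sum (λ (k : Fin m) → h (n ↑ʳ k))
        ≡⟨ cong₂ ℕ._+_ (ΣN.sum-cong-≋ (λ j → cong (edge v) (glue-E-inj₁ j)))
            (trans (ΣN.sum-Σ (λ i → ne (tree (T i))) (λ k → h (n ↑ʳ k)))
              (ΣN.sum-cong-≋ λ j → ΣN.sum-cong-≋ λ e → cong (edge v) (glue-E-inj₂ j e))) ⟩
      ΣN.sum (λ j → edge v (inj₁ j)) ℕ.+ ΣN.sum (λ j → ΣN.sum (λ e → edge v (inj₂ (j , e)))) ∎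
      where
      open ≡.≡-Reasoning
      m = ΣN.sum (λ i → ne (tree (T i)))
      enc-inj : Injective _≡_ _≡_ enc
      enc-inj {x} {y} e = trans (sym (Inverse.strictlyInverseˡ (glue-V T) x))
        (trans (cong (Inverse.to (glue-V T)) e) (Inverse.strictlyInverseˡ (glue-V T) y))
      h : Fin (ne (glue T)) → ℕ
      h e = edge v (Inverse.to (glue-E T) e)

    tree-edges : ∀ i x → ΣN.sum (λ j → ΣN.sum (λ e → edge (i , x) (inj₂ (j , e)))) ≡ blackCount (tree (T i)) (d i) x
    tree-edges i x = begin
      ΣN.sum (λ j → ΣN.sum (λ e → edge (i , x) (inj₂ (j , e))))
        ≡⟨ ΣN.sum-single i (λ j j≢i → ΣN.sum-zero λ e → cong ind
             (blackJoin-off Fin._≟_ _≟V_ {f = j ,_} (uncurry d) (λ v p → j≢i (cong proj₁ p)) (ends (tree (T j)) e))) ⟩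
      ΣN.sum (λ e → edge (i , x) (inj₂ (i , e)))
        ≡⟨ ΣN.sum-cong-≋ (λ e → cong ind (blackJoin-map Fin._≟_ _≟V_ {f = i ,_} Σ-injective₂ (d i) (uncurry d) (λ _ → refl) x (ends (tree (T i)) e))) ⟩
      ΣN.sum (λ e → ind (blackJoin Fin._≟_ (d i) x (ends (tree (T i)) e)))
        ≡⟨ sym (blackCount-sum (tree (T i)) (d i) x) ⟩
      blackCount (tree (T i)) (d i) x ∎
      where open ≡.≡-Reasoning

    ρ : Fin n → V
    ρ j = j , root (T j)

    cycle-edges-root : ∀ i → ΣN.sum (λ j → edge (ρ i) (inj₁ j)) ≡ blackCount (cycle n) rootCol i
    cycle-edges-root i = trans
      (ΣN.sum-cong-≋ (λ j → cong ind (blackJoin-map Fin._≟_ _≟V_ {f = ρ} (cong proj₁) rootCol (uncurry d) (λ _ → refl) i (j , nextF j))))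
      (sym (blackCount-sum (cycle n) rootCol i))

    cycle-edges-off : ∀ i x → x ≢ root (T i) → ΣN.sum (λ j → edge (i , x) (inj₁ j)) ≡ 0
    cycle-edges-off i x x≢ = ΣN.sum-zero λ j → cong ind
      (blackJoin-off Fin._≟_ _≟V_ {f = ρ} (uncurry d) (λ { v refl → x≢ refl }) (j , nextF j))

  blackCount-root : ∀ i → blackCount (glue T) gluedCol (enc (ρ i)) ≡
                    blackCount (cycle n) rootCol i ℕ.+ blackCount (tree (T i)) (d i) (root (T i))
  blackCount-root i = trans (blackCount-edges (ρ i)) (cong₂ ℕ._+_ (cycle-edges-root i) (tree-edges i _))

  blackCount-off : ∀ i x → x ≢ root (T i) → blackCount (glue T) gluedCol (enc (i , x)) ≡ blackCount (tree (T i)) (d i) x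
  blackCount-off i x x≢ = trans (blackCount-edges (i , x)) (cong₂ ℕ._+_ (cycle-edges-off i x x≢) (tree-edges i x))

  whiteEven-glue : whiteEven (glue T) gluedCol ≡
    ΣN.sum (λ i → ΣN.sum (λ x → ind (not (d i x) ∧ isEven (blackCount (glue T) gluedCol (enc (i , x))))))
  whiteEven-glue = trans (whiteEven-sum (glue T) gluedCol)
    (trans (ΣN.sum-Σ (λ i → nv (tree (T i))) (λ v → ind (not (gluedCol v) ∧ isEven (blackCount (glue T) gluedCol v)))) (ΣN.sum-cong-≋ λ i → ΣN.sum-cong-≋ λ x →
      cong (λ b → ind (not b ∧ isEven (blackCount (glue T) gluedCol (enc (i , x))))) (gluedCol-enc (i , x))))

isEven-+ : ∀ a b → isEven (a ℕ.+ b) ≡ (if isEven a then isEven b else not (isEven b))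
isEven-+ zero          b = refl
isEven-+ (suc zero)    b = isEven-suc b
  where
  isEven-suc : ∀ b → isEven (suc b) ≡ not (isEven b)
  isEven-suc zero          = refl
  isEven-suc (suc zero)    = refl
  isEven-suc (suc (suc b)) = isEven-suc b
isEven-+ (suc (suc a)) b = isEven-+ a b

-- The change of the t-exponent of a tree when its root, black or white and
-- even or odd, is placed on a cycle vertex of given parity.
rootShift : (evenCycle black evenRoot : Bool) → ℤ
rootShift _     true  _     = + 0
rootShift true  false _     = + 0
rootShift false false true  = ℤ.- + 1
rootShift false false false = + 1

shiftedExp : Bool → (T : RootedTree) → Col T → ℤ
shiftedExp p T d = + whiteEven (tree T) d ℤ.+ rootShift p (d (root T)) (isEven (blackCount (tree T) d (root T)))

-- Changing one term changes the sum by the difference of the terms, written without subtraction.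
sum-change : ∀ {m} (f g : Fin m → ℕ) r → (∀ x → x ≢ r → f x ≡ g x) → ΣN.sum f ℕ.+ g r ≡ ΣN.sum g ℕ.+ f r
sum-change f g zero e = begin
  f zero ℕ.+ ΣN.sum (f ∘ suc) ℕ.+ g zero
    ≡⟨ cong (λ s → f zero ℕ.+ s ℕ.+ g zero) (ΣN.sum-cong-≋ λ x → e (suc x) λ ()) ⟩
  f zero ℕ.+ ΣN.sum (g ∘ suc) ℕ.+ g zero
    ≡⟨ solve 3 (λ a b c → a :+ b :+ c := c :+ b :+ a) refl (f zero) (ΣN.sum (g ∘ suc)) (g zero) ⟩
  g zero ℕ.+ ΣN.sum (g ∘ suc) ℕ.+ f zero ∎
  where
  open ≡.≡-Reasoning
  open ℕ.+-*-Solver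
sum-change f g (suc r) e = begin
  f zero ℕ.+ ΣN.sum (f ∘ suc) ℕ.+ g (suc r)   ≡⟨ ℕ.+-assoc (f zero) _ _ ⟩
  f zero ℕ.+ (ΣN.sum (f ∘ suc) ℕ.+ g (suc r)) ≡⟨ cong₂ ℕ._+_ (e zero λ ()) (sum-change (f ∘ suc) (g ∘ suc) r λ x x≢ → e (suc x) (x≢ ∘ Fin.suc-injective)) ⟩
  g zero ℕ.+ (ΣN.sum (g ∘ suc) ℕ.+ f (suc r)) ≡⟨ sym (ℕ.+-assoc (g zero) _ _) ⟩
  g zero ℕ.+ ΣN.sum (g ∘ suc) ℕ.+ f (suc r)   ∎
  where open ≡.≡-Reasoning

module ΣZ = Sums ℤ.+-*-commutativeSemiring

+-sum : ∀ {n} (f : Fin n → ℕ) → + ΣN.sum f ≡ ΣZ.sum (λ i → + f i)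
+-sum {zero}  f = refl
+-sum {suc n} f = cong (ℤ._+_ (+ f zero)) (+-sum (f ∘ suc))

-- Gluing gives new neighbours to the roots only. Hence the exponents of the trees add up after one
-- correction per root, depending on the parity that the cycle contributes there.
whiteEven-glue-exp : ∀ {n} (T : Fin n → RootedTree) (d : ∀ i → Col (T i)) →
  + whiteEven (glue T) (gluedCol T d) ≡
  ΣZ.sum (λ i → shiftedExp (isEven (blackCount (cycle n) (rootCol T d) i)) (T i) (d i))
whiteEven-glue-exp {n} T d = trans (cong +_ (whiteEven-glue T d)) (trans (+-sum part) (ΣZ.sum-cong-≋ slot))
  where
  enc : Vtx (Glued T) → Fin (nv (glue T))
  enc = Inverse.from (glue-V T)
  part : Fin n → ℕ
  part i = ΣN.sum (λ x → ind (not (d i x) ∧ isEven (blackCount (glue T) (gluedCol T d) (enc (i , x)))))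
  slot : ∀ i → + part i ≡ shiftedExp (isEven (blackCount (cycle n) (rootCol T d) i)) (T i) (d i)
  slot i = lem (isEven (blackCount (cycle n) (rootCol T d) i)) (d i r) (isEven (blackCount (tree (T i)) (d i) r))
    (trans (cong isEven (blackCount-root T d i)) (isEven-+ (blackCount (cycle n) (rootCol T d) i) _))
    (trans (sum-change f g r λ x x≢ → cong (λ k → ind (not (d i x) ∧ isEven k)) (blackCount-off T d i x x≢))
           (cong (ℕ._+ f r) (sym (whiteEven-sum (tree (T i)) (d i)))))
    where
    r = root (T i)
    f g : Fin (nv (tree (T i))) → ℕ
    f x = ind (not (d i x) ∧ isEven (blackCount (glue T) (gluedCol T d) (enc (i , x))))
    g x = ind (not (d i x) ∧ isEven (blackCount (tree (T i)) (d i) x))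
    lem : ∀ {s w q} p b e → q ≡ (if p then e else not e) → s ℕ.+ ind (not b ∧ e) ≡ w ℕ.+ ind (not b ∧ q) →
          + s ≡ + w ℤ.+ rootShift p b e
    lem {s} p true e _ h = cong +_ (trans (sym (ℕ.+-identityʳ s)) h)
    lem true  false true  refl h = trans (cong +_ (ℕ.+-cancelʳ-≡ 1 _ _ h)) (sym (ℤ.+-identityʳ _))
    lem {s} true false false refl h = cong +_ (trans (sym (ℕ.+-identityʳ s)) h)
    lem {s} {w} false false true refl h = trans (lem′ (+ s)) (cong (ℤ._- + 1) (cong +_ (trans h (ℕ.+-identityʳ w))))
      where
      lem′ : ∀ a → a ≡ a ℤ.+ + 1 ℤ.- + 1
      lem′ a = sym (trans (ℤ.+-assoc a (+ 1) (ℤ.- + 1)) (ℤ.+-identityʳ a))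
    lem {s} false false false refl h = cong +_ (trans (sym (ℕ.+-identityʳ s)) h)

weight-glue : ∀ φ {n} (T : Fin n → RootedTree) → ΣQ.∑ (allColΠ n T) (λ d →
    φ (ΣZ.sum (λ i → shiftedExp (isEven (blackCount (cycle n) (rootCol T d) i)) (T i) (d i)))) ≡ weight φ (glue T)
weight-glue φ {n} T = reindex (ColΠ T) (Fin (nv (glue T)) →-setoid Bool)
  (allColΠ-isEnum n T) (colorings-isEnum (glue T)) (gluedCol T)
  (λ e x → e _ _)
  (λ {c} {d} e i x → subst (λ p → uncurry c p ≡ uncurry d p) (Inverse.strictlyInverseˡ (glue-V T) (i , x)) (e (Inverse.from (glue-V T) (i , x))))
  (λ c → (λ i x → c (Inverse.from (glue-V T) (i , x))) , λ x → cong c (Inverse.strictlyInverseʳ (glue-V T) x))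
  _ _ (λ {d} {c} e → cong φ (trans (sym (whiteEven-glue-exp T d)) (cong +_ (whiteEven-cong (glue T) e))))

-- Evaluation of the substituted series

χ : Bool → ℚ
χ b = if b then 1ℚ else 0ℚ

-- The linear functional t^k ↦ φ k on Laurent polynomials.
eval : (ℤ → ℚ) → LP → ℚ
eval φ p = ΣQ.∑ p (λ (e , q) → q ℚ.* φ e)

-- Reading off a coefficient is one instance of `eval`. The general functional is kept because
-- `eval-⊗` translates it, which would not preserve a fixed coefficient.
coeff-eval : ∀ p k → coeff p k ≡ eval (λ e → χ ⌊ e ℤ.≟ k ⌋) p
coeff-eval []            k = refl
coeff-eval ((e , q) ∷ p) k = cong₂ ℚ._+_ (lem ⌊ e ℤ.≟ k ⌋) (coeff-eval p k)
  where
  lem : ∀ b → (if b then q else 0ℚ) ≡ q ℚ.* χ b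
  lem true  = sym (ℚ.*-identityʳ q)
  lem false = sym (ℚ.*-zeroʳ q)

eval-cong : ∀ {φ ψ : ℤ → ℚ} → φ ≗ ψ → ∀ p → eval φ p ≡ eval ψ p
eval-cong e p = ΣQ.∑-cong p λ (k , q) → cong (q ℚ.*_) (e k)

eval-++ : ∀ φ p r → eval φ (p ++ r) ≡ eval φ p ℚ.+ eval φ r
eval-++ φ p r = ΣQ.∑-++ p r (λ (e , q) → q ℚ.* φ e)

eval-concatMap : ∀ {A : Set} φ (h : A → LP) L → eval φ (concatMap h L) ≡ ΣQ.∑ L (eval φ ∘ h)
eval-concatMap φ h L = ΣQ.∑-concatMap h L (λ (e , q) → q ℚ.* φ e)

eval-scale : ∀ φ q p → eval φ (scaleLP q p) ≡ q ℚ.* eval φ p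
eval-scale φ q p = trans (ΣQ.∑-map (λ (e , x) → e , q ℚ.* x) p (λ (e , q) → q ℚ.* φ e))
  (trans (ΣQ.∑-cong p λ (e , x) → ℚ.*-assoc q x (φ e)) (sym (ΣQ.∑-*ˡ p q (λ (e , x) → x ℚ.* φ e))))

eval-shift : ∀ φ k p → eval φ (shiftLP k p) ≡ eval (λ e → φ (e ℤ.+ k)) p
eval-shift φ k p = ΣQ.∑-map (λ (e , x) → e ℤ.+ k , x) p (λ (e , q) → q ℚ.* φ e)

eval-⊗ : ∀ φ p r → eval φ (p ⊗ r) ≡ eval (λ a → eval (λ b → φ (a ℤ.+ b)) r) p
eval-⊗ φ p r = trans
  (eval-concatMap φ (λ (a , x) → map (λ (b , y) → a ℤ.+ b , x ℚ.* y) r) p)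
  (ΣQ.∑-cong p λ (a , x) → trans
    (ΣQ.∑-map (λ (b , y) → a ℤ.+ b , x ℚ.* y) r (λ (e , q) → q ℚ.* φ e))
    (trans (ΣQ.∑-cong r λ (b , y) → ℚ.*-assoc x y (φ (a ℤ.+ b))) (sym (ΣQ.∑-*ˡ r x (λ (b , y) → y ℚ.* φ (a ℤ.+ b))))))

eval-W1 : ∀ φ RG N → eval φ (W1 RG N) ≡ ΣQ.∑ (RG N) (λ G → inv (autCount G) ℚ.* weight φ G)
eval-W1 φ RG N = trans (eval-concatMap φ (λ G → scaleLP (inv (autCount G)) (WLP G)) (RG N))
  (ΣQ.∑-cong (RG N) λ G → trans (eval-scale φ (inv (autCount G)) (WLP G)) (cong (inv (autCount G) ℚ.*_)
    (trans (ΣQ.∑-map (λ c → + whiteEven G c , 1ℚ) (colorings G) (λ (e , q) → q ℚ.* φ e))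
           (ΣQ.∑-cong (colorings G) λ c → ℚ.*-identityˡ (φ (+ whiteEven G c))))))

eval-treeSeries : ∀ φ T cond → eval φ (treeSeries T cond) ≡
  ΣQ.∑ (colorings (tree T)) (λ d → χ (cond d) ℚ.* φ (+ whiteEven (tree T) d))
eval-treeSeries φ T cond = trans
  (eval-concatMap φ (λ c → if cond c then (+ whiteEven (tree T) c , 1ℚ) ∷ [] else []) (colorings (tree T)))
  (ΣQ.∑-cong (colorings (tree T)) λ c → lem (cond c) (+ whiteEven (tree T) c))
  where
  lem : ∀ b k → eval φ (if b then (k , 1ℚ) ∷ [] else []) ≡ χ b ℚ.* φ k
  lem true  k = ℚ.+-identityʳ _
  lem false k = sym (ℚ.*-zeroˡ (φ k))

eval-TSeries : ∀ φ RT cond m → eval φ (TSeriesWith RT cond m) ≡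
  ΣQ.∑ (RT m) (λ T → inv (autCountR T) ℚ.* ΣQ.∑ (colorings (tree T)) (λ d → χ (cond T d) ℚ.* φ (+ whiteEven (tree T) d)))
eval-TSeries φ RT cond m = trans
  (eval-concatMap φ (λ T → scaleLP (inv (autCountR T)) (treeSeries T (cond T))) (RT m))
  (ΣQ.∑-cong (RT m) λ T → trans (eval-scale φ (inv (autCountR T)) (treeSeries T (cond T)))
    (cong (inv (autCountR T) ℚ.*_) (eval-treeSeries φ T (cond T))))

-- Boolean equality by cases on the prescribed colour, so that it reduces to the root conditions of
-- `Tb`, `Tw⁺` and `Tw⁻`.
agree : Bool → Bool → Bool
agree x y = if y then x else not x

slotSum : (ℤ → ℚ) → (evenCycle black : Bool) → RootedTree → ℚ
slotSum φ p b T = inv (autCountR T) ℚ.* ΣQ.∑ (colorings (tree T)) (λ d → χ (agree (d (root T)) b) ℚ.* φ (shiftedExp p T d))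

-- The substitution at one cycle vertex as a function of its parity and colour alone.
slotSeries : (ℕ → List RootedTree) → (evenCycle black : Bool) → Series
slotSeries RT p b =
  if b then Tb RT
  else (if p then Tw⁺ RT +S Tw⁻ RT else (shiftS (ℤ.- + 1) (Tw⁺ RT) +S shiftS (+ 1) (Tw⁻ RT)))

eval-slot : ∀ φ RT p b m → eval φ (slotSeries RT p b m) ≡ ΣQ.∑ (RT m) (slotSum φ p b)
eval-slot φ RT p true m = trans (eval-TSeries φ RT (λ T c → c (root T)) m)
  (ΣQ.∑-cong (RT m) λ T → cong (inv (autCountR T) ℚ.*_) (ΣQ.∑-cong (colorings (tree T)) λ d →
    lem p (d (root T)) (isEven (blackCount (tree T) d (root T))) (+ whiteEven (tree T) d)))
  where
  lem : ∀ p x e k → χ x ℚ.* φ k ≡ χ x ℚ.* φ (k ℤ.+ rootShift p x e)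
  lem p     true  e k = cong (λ k → 1ℚ ℚ.* φ k) (sym (ℤ.+-identityʳ k))
  lem p     false e k = trans (ℚ.*-zeroˡ (φ k)) (sym (ℚ.*-zeroˡ (φ (k ℤ.+ rootShift p false e))))
eval-slot φ RT p false m = trans (split p)
  (trans (sym (ΣQ.∑-+ (RT m) (summand (φ₊ p) even) (summand (φ₋ p) odd))) (ΣQ.∑-cong (RT m) λ T →
    trans (sym (ℚ.*-distribˡ-+ (inv (autCountR T)) (∑col (φ₊ p) even T) (∑col (φ₋ p) odd T)))
      (cong (inv (autCountR T) ℚ.*_)
        (trans (sym (ΣQ.∑-+ (colorings (tree T)) (term (φ₊ p) even T) (term (φ₋ p) odd T)))
          (ΣQ.∑-cong (colorings (tree T)) λ d →
            lem p (d (root T)) (isEven (blackCount (tree T) d (root T))) (+ whiteEven (tree T) d))))))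
  where
  up down : Bool → ℤ
  up   p = if p then + 0 else ℤ.- + 1
  down p = if p then + 0 else + 1
  φ₊ φ₋ : Bool → ℤ → ℚ
  φ₊ p k = φ (k ℤ.+ up p)
  φ₋ p k = φ (k ℤ.+ down p)
  even odd : (T : RootedTree) → Col T → Bool
  even T c = not (c (root T)) ∧ isEven (blackCount (tree T) c (root T))
  odd  T c = not (c (root T)) ∧ not (isEven (blackCount (tree T) c (root T)))
  term : (ℤ → ℚ) → ((T : RootedTree) → Col T → Bool) → (T : RootedTree) → Col T → ℚ
  term φ cond T d = χ (cond T d) ℚ.* φ (+ whiteEven (tree T) d)
  ∑col summand : (ℤ → ℚ) → ((T : RootedTree) → Col T → Bool) → RootedTree → ℚ
  ∑col φ cond T = ΣQ.∑ (colorings (tree T)) (term φ cond T)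
  summand φ cond T = inv (autCountR T) ℚ.* ∑col φ cond T
  split : ∀ p → eval φ (slotSeries RT p false m) ≡
          ΣQ.∑ (RT m) (summand (φ₊ p) even) ℚ.+ ΣQ.∑ (RT m) (summand (φ₋ p) odd)
  split true = trans (eval-++ φ (Tw⁺ RT m) (Tw⁻ RT m)) (cong₂ ℚ._+_
    (trans (eval-cong (λ k → cong φ (sym (ℤ.+-identityʳ k))) (Tw⁺ RT m)) (eval-TSeries (φ₊ true) RT even m))
    (trans (eval-cong (λ k → cong φ (sym (ℤ.+-identityʳ k))) (Tw⁻ RT m)) (eval-TSeries (φ₋ true) RT odd m)))
  split false = trans (eval-++ φ (shiftLP (ℤ.- + 1) (Tw⁺ RT m)) (shiftLP (+ 1) (Tw⁻ RT m))) (cong₂ ℚ._+_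
    (trans (eval-shift φ (ℤ.- + 1) (Tw⁺ RT m)) (eval-TSeries (φ₊ false) RT even m))
    (trans (eval-shift φ (+ 1) (Tw⁻ RT m)) (eval-TSeries (φ₋ false) RT odd m)))
  lem : ∀ p x e k → χ (not x ∧ e) ℚ.* φ₊ p k ℚ.+ χ (not x ∧ not e) ℚ.* φ₋ p k
                    ≡ χ (not x) ℚ.* φ (k ℤ.+ rootShift p x e)
  lem p     true  e     k = trans (cong₂ ℚ._+_ (ℚ.*-zeroˡ (φ₊ p k)) (ℚ.*-zeroˡ (φ₋ p k)))
                                  (sym (ℚ.*-zeroˡ (φ (k ℤ.+ rootShift p true e))))
  lem true  false true  k = trans (cong (1ℚ ℚ.* φ (k ℤ.+ + 0) ℚ.+_) (ℚ.*-zeroˡ (φ₋ true k))) (ℚ.+-identityʳ _)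
  lem true  false false k = trans (cong (ℚ._+ 1ℚ ℚ.* φ (k ℤ.+ + 0)) (ℚ.*-zeroˡ (φ₊ true k))) (ℚ.+-identityˡ _)
  lem false false true  k = trans (cong (1ℚ ℚ.* φ (k ℤ.+ (ℤ.- + 1)) ℚ.+_) (ℚ.*-zeroˡ (φ₋ false k))) (ℚ.+-identityʳ _)
  lem false false false k = trans (cong (ℚ._+ 1ℚ ℚ.* φ (k ℤ.+ + 1)) (ℚ.*-zeroˡ (φ₊ false k))) (ℚ.+-identityˡ _)

eval-substW : ∀ φ RT n N → eval φ (substW RT n N) ≡ ΣQ.∑ (colorings (cycle n)) (λ c →
  eval φ (prodS (tabulate (λ i → slotSeries RT (isEven (blackCount (cycle n) c i)) (c i))) N))
eval-substW φ RT n N = trans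
  (eval-concatMap φ (λ c → prodS (map (λ i → slotSeries RT (isEven (blackCount (cycle n) c i)) (c i)) (allFin n)) N)
    (colorings (cycle n)))
  (ΣQ.∑-cong (colorings (cycle n)) λ c → cong (λ L → eval φ (prodS L N))
    (List.map-tabulate id (λ i → slotSeries RT (isEven (blackCount (cycle n) c i)) (c i))))

-- Products of tree series as sums over tuples of trees

module Products {K : ℕ} (tr : Fin K → RootedTree) (α : Fin K → ℚ) (N : ℕ) where

  -- The common form of the three substituted series. Degrees are capped by `N` because `tr` is to
  -- list the trees with at most `N` vertices.
  Slot : Series → (∀ j → Col (tr j) → ℚ) → (∀ j → Col (tr j) → ℤ) → Set
  Slot s κ x = ∀ m → m ℕ.≤ N → ∀ φ → eval φ (s m) ≡ ΣQ.sum (λ j →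
    χ ⌊ nv (tree (tr j)) ℕ.≟ m ⌋ ℚ.* (α j ℚ.* ΣQ.∑ (colorings (tree (tr j))) (λ d → κ j d ℚ.* φ (x j d))))

  trees : ∀ {n} → Vec (Fin K) n → Fin n → RootedTree
  trees t i = tr (Vec.lookup t i)

  size : ∀ {n} → Vec (Fin K) n → ℕ
  size t = nv (glue (trees t))

  colSum : ∀ {n} (κ : ∀ (i : Fin n) j → Col (tr j) → ℚ) (x : ∀ (i : Fin n) j → Col (tr j) → ℤ) →
           (ℤ → ℚ) → Vec (Fin K) n → ℚ
  colSum {n} κ x φ t = ΣQ.∑ (allColΠ n (trees t)) λ d →
    ΣQ.prod (λ i → κ i (Vec.lookup t i) (d i)) ℚ.* φ (ΣZ.sum λ i → x i (Vec.lookup t i) (d i))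

  colSum-∷ : ∀ {n} κ x φ j (t : Vec (Fin K) n) → colSum κ x φ (j Vec.∷ t) ≡
    ΣQ.∑ (colorings (tree (tr j))) (λ d → κ zero j d ℚ.*
      colSum (κ ∘ suc) (x ∘ suc) (λ e → φ (x zero j d ℤ.+ e)) t)
  colSum-∷ {n} κ x φ j t = trans (ΣQ.∑-concatMap (λ d → map (consΠ {T = T} d) rest) (colorings (tree (tr j))) F)
    (ΣQ.∑-cong (colorings (tree (tr j))) λ d → trans (ΣQ.∑-map (consΠ {T = T} d) rest F)
      (trans (ΣQ.∑-cong rest λ ds → ℚ.*-assoc (κ zero j d) (P ds) (φ (x zero j d ℤ.+ E ds)))
             (sym (ΣQ.∑-*ˡ rest (κ zero j d) (λ ds → P ds ℚ.* φ (x zero j d ℤ.+ E ds))))))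
    where
    T = trees (j Vec.∷ t)
    rest = allColΠ n (trees t)
    P : (∀ i → Col (trees t i)) → ℚ
    P ds = ΣQ.prod (λ i → κ (suc i) (Vec.lookup t i) (ds i))
    E : (∀ i → Col (trees t i)) → ℤ
    E ds = ΣZ.sum λ i → x (suc i) (Vec.lookup t i) (ds i)
    F : (∀ i → Col (T i)) → ℚ
    F d = ΣQ.prod (λ i → κ i (Vec.lookup (j Vec.∷ t) i) (d i)) ℚ.* φ (ΣZ.sum λ i → x i (Vec.lookup (j Vec.∷ t) i) (d i))

  A : ∀ {n} → Vec (Fin K) n → ℚ
  A t = ΣQ.prod (λ i → α (Vec.lookup t i))

  -- Induction on the number of factors with `φ` free: splitting off the first factor translates `φ`
  -- by its exponent, and in the convolution only the degree equal to the size of the first tree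
  -- survives.
  eval-prodS : ∀ n (s : Fin n → Series) κ x → (∀ i → Slot (s i) (κ i) (x i)) → ∀ M → M ℕ.≤ N → ∀ φ →
    eval φ (prodS (tabulate s) M) ≡
    ΣQ.∑ (allVecs n (allFin K)) (λ t → χ ⌊ size t ℕ.≟ M ⌋ ℚ.* (A t ℚ.* colSum κ x φ t))
  eval-prodS zero s κ x slot zero M≤ φ = lem (φ (+ 0))
    where
    lem : ∀ a → 1ℚ ℚ.* a ℚ.+ 0ℚ ≡ 1ℚ ℚ.* (1ℚ ℚ.* (1ℚ ℚ.* a ℚ.+ 0ℚ)) ℚ.+ 0ℚ
    lem = solve 1 (λ a → con 1ℚ :* a :+ con 0ℚ := con 1ℚ :* (con 1ℚ :* (con 1ℚ :* a :+ con 0ℚ)) :+ con 0ℚ) refl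
      where open ℚ.+-*-Solver
  eval-prodS zero s κ x slot (suc M) M≤ φ = sym (trans (ℚ.+-identityʳ _) (ℚ.*-zeroˡ (1ℚ ℚ.* colSum κ x φ Vec.[])))
  eval-prodS (suc n) s κ x slot M M≤ φ = begin
    eval φ (concatMap (λ i → s zero i ⊗ rest (M ∸ i)) (upTo (suc M)))
      ≡⟨ eval-concatMap φ (λ i → s zero i ⊗ rest (M ∸ i)) (upTo (suc M)) ⟩
    ΣQ.∑ (upTo (suc M)) (λ i → eval φ (s zero i ⊗ rest (M ∸ i)))
      ≡⟨ ΣQ.∑-applyUpTo id (suc M) (λ i → eval φ (s zero i ⊗ rest (M ∸ i))) ⟩
    ΣQ.sum {suc M} (λ i → eval φ (s zero (toℕ i) ⊗ rest (M ∸ toℕ i)))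
      ≡⟨ ΣQ.sum-cong-≋ {suc M} (λ i → trans (eval-⊗ φ (s zero (toℕ i)) (rest (M ∸ toℕ i)))
           (slot zero (toℕ i) (ℕ.≤-trans (ℕ.≤-pred (Fin.toℕ<n i)) M≤) (R (M ∸ toℕ i)))) ⟩
    ΣQ.sum {suc M} (λ i → ΣQ.sum (λ j → χ ⌊ nv (tree (tr j)) ℕ.≟ toℕ i ⌋ ℚ.* H j (toℕ i)))
      ≡⟨ ΣQ.∑-comm {suc M} (λ i j → χ ⌊ nv (tree (tr j)) ℕ.≟ toℕ i ⌋ ℚ.* H j (toℕ i)) ⟩
    ΣQ.sum (λ j → ΣQ.sum {suc M} (λ i → χ ⌊ nv (tree (tr j)) ℕ.≟ toℕ i ⌋ ℚ.* H j (toℕ i)))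
      ≡⟨ ΣQ.sum-cong-≋ (λ j → per j (nv (tree (tr j)) ℕ.≤? M)) ⟩
    ΣQ.sum (λ j → ΣQ.∑ (allVecs n (allFin K)) (λ t → Goal (j Vec.∷ t)))
      ≡⟨ sym (ΣQ.∑-tabulate id (λ j → ΣQ.∑ (allVecs n (allFin K)) (λ t → Goal (j Vec.∷ t)))) ⟩
    ΣQ.∑ (allFin K) (λ j → ΣQ.∑ (allVecs n (allFin K)) (λ t → Goal (j Vec.∷ t)))
      ≡⟨ sym (ΣQ.∑-allVecs-suc n (allFin K) Goal) ⟩
    ΣQ.∑ (allVecs (suc n) (allFin K)) Goal ∎
    where
    open ≡.≡-Reasoning
    rest : Series
    rest = prodS (tabulate (s ∘ suc))
    R : ℕ → ℤ → ℚ
    R M a = eval (λ b → φ (a ℤ.+ b)) (rest M)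
    cols : ∀ j → List (Col (tr j))
    cols j = colorings (tree (tr j))
    H : Fin K → ℕ → ℚ
    H j i = α j ℚ.* ΣQ.∑ (cols j) (λ d → κ zero j d ℚ.* R (M ∸ i) (x zero j d))
    Goal : Vec (Fin K) (suc n) → ℚ
    Goal t = χ ⌊ size t ℕ.≟ M ⌋ ℚ.* (A t ℚ.* colSum κ x φ t)
    cs : ∀ j → Col (tr j) → Vec (Fin K) n → ℚ
    cs j d t = colSum (κ ∘ suc) (x ∘ suc) (λ e → φ (x zero j d ℤ.+ e)) t
    per : ∀ j → Dec (nv (tree (tr j)) ℕ.≤ M) →
          ΣQ.sum {suc M} (λ i → χ ⌊ nv (tree (tr j)) ℕ.≟ toℕ i ⌋ ℚ.* H j (toℕ i)) ≡
          ΣQ.∑ (allVecs n (allFin K)) (λ t → Goal (j Vec.∷ t))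
    -- A first tree with more than `M` vertices contributes 0 to both sides.
    per j (no v≰M) = trans
      (ΣQ.sum-zero {suc M} λ i → trans (cong (λ b → χ b ℚ.* H j (toℕ i))
        (dec⇒false (nv (tree (tr j)) ℕ.≟ toℕ i) λ e → v≰M (subst (ℕ._≤ M) (sym e) (ℕ.≤-pred (Fin.toℕ<n i))))) (ℚ.*-zeroˡ (H j (toℕ i))))
      (sym (ΣQ.sum-zero λ k → let t = lookup (allVecs n (allFin K)) k in
        trans (cong (λ b → χ b ℚ.* (A (j Vec.∷ t) ℚ.* colSum κ x φ (j Vec.∷ t)))
          (dec⇒false (size (j Vec.∷ t) ℕ.≟ M) λ e → v≰M (ℕ.≤-trans (ℕ.m≤m+n _ _) (ℕ.≤-reflexive e)))) (ℚ.*-zeroˡ (A (j Vec.∷ t) ℚ.* colSum κ x φ (j Vec.∷ t)))))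
    per j (yes v≤M) = begin
      ΣQ.sum {suc M} (λ i → χ ⌊ v ℕ.≟ toℕ i ⌋ ℚ.* H j (toℕ i))
        ≡⟨ ΣQ.sum-single (fromℕ< (s≤s v≤M)) (λ i i≢ → trans (cong (λ b → χ b ℚ.* H j (toℕ i))
             (dec⇒false (v ℕ.≟ toℕ i) λ e → i≢ (Fin.toℕ-injective (trans (sym e) (sym (Fin.toℕ-fromℕ< (s≤s v≤M))))))) (ℚ.*-zeroˡ (H j (toℕ i)))) ⟩
      χ ⌊ v ℕ.≟ toℕ (fromℕ< (s≤s v≤M)) ⌋ ℚ.* H j (toℕ (fromℕ< (s≤s v≤M)))
        ≡⟨ cong (λ i → χ ⌊ v ℕ.≟ i ⌋ ℚ.* H j i) (Fin.toℕ-fromℕ< (s≤s v≤M)) ⟩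
      χ ⌊ v ℕ.≟ v ⌋ ℚ.* H j v
        ≡⟨ trans (cong (λ b → χ b ℚ.* H j v) (dec⇒true (v ℕ.≟ v) refl)) (ℚ.*-identityˡ _) ⟩
      α j ℚ.* ΣQ.∑ (cols j) (λ d → κ zero j d ℚ.* R (M ∸ v) (x zero j d))
        ≡⟨ cong (α j ℚ.*_) (ΣQ.∑-cong (cols j) λ d → trans
             (cong (κ zero j d ℚ.*_) (eval-prodS n (s ∘ suc) (κ ∘ suc) (x ∘ suc) (slot ∘ suc) (M ∸ v)
                (ℕ.≤-trans (ℕ.m∸n≤m M v) M≤) (λ b → φ (x zero j d ℤ.+ b))))
             (ΣQ.∑-*ˡ Ts (κ zero j d) (λ t → c t ℚ.* (A t ℚ.* cs j d t)))) ⟩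
      α j ℚ.* ΣQ.∑ (cols j) (λ d → ΣQ.∑ Ts (λ t → X d t))
        ≡⟨ cong (α j ℚ.*_) (ΣQ.∑-swap (cols j) Ts X) ⟩
      α j ℚ.* ΣQ.∑ Ts (λ t → ΣQ.∑ (cols j) (λ d → X d t))
        ≡⟨ ΣQ.∑-*ˡ Ts (α j) (λ t → ΣQ.∑ (cols j) (λ d → X d t)) ⟩
      ΣQ.∑ Ts (λ t → α j ℚ.* ΣQ.∑ (cols j) (λ d → X d t))
        ≡⟨ ΣQ.∑-cong Ts (λ t → begin
             α j ℚ.* ΣQ.∑ (cols j) (λ d → X d t)
               ≡⟨ cong (α j ℚ.*_) (ΣQ.∑-cong (cols j) λ d → shuffle₁ (κ zero j d) (c t) (A t) (cs j d t)) ⟩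
             α j ℚ.* ΣQ.∑ (cols j) (λ d → c t ℚ.* A t ℚ.* (κ zero j d ℚ.* cs j d t))
               ≡⟨ cong (α j ℚ.*_) (sym (ΣQ.∑-*ˡ (cols j) (c t ℚ.* A t) (λ d → κ zero j d ℚ.* cs j d t))) ⟩
             α j ℚ.* (c t ℚ.* A t ℚ.* ΣQ.∑ (cols j) (λ d → κ zero j d ℚ.* cs j d t))
               ≡⟨ shuffle₂ (α j) (c t) (A t) (ΣQ.∑ (cols j) (λ d → κ zero j d ℚ.* cs j d t)) ⟩
             c t ℚ.* (α j ℚ.* A t ℚ.* ΣQ.∑ (cols j) (λ d → κ zero j d ℚ.* cs j d t))
               ≡⟨ cong₂ (λ b y → χ b ℚ.* (α j ℚ.* A t ℚ.* y))
                    (⌊⌋-cong (size t ℕ.≟ M ∸ v) (size (j Vec.∷ t) ℕ.≟ M)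
                      (λ e → trans (cong (v ℕ.+_) e) (ℕ.m+[n∸m]≡n v≤M))
                      (λ e → trans (sym (ℕ.m+n∸m≡n v (size t))) (cong (_∸ v) e)))
                    (sym (colSum-∷ κ x φ j t)) ⟩
             Goal (j Vec.∷ t) ∎) ⟩
      ΣQ.∑ Ts (λ t → Goal (j Vec.∷ t)) ∎
      where
      v = nv (tree (tr j))
      Ts = allVecs n (allFin K)
      c : Vec (Fin K) n → ℚ
      c t = χ ⌊ size t ℕ.≟ M ∸ v ⌋
      X : Col (tr j) → Vec (Fin K) n → ℚ
      X d t = κ zero j d ℚ.* (c t ℚ.* (A t ℚ.* cs j d t))
      open ℚ.+-*-Solver
      shuffle₁ : ∀ k c a s → k ℚ.* (c ℚ.* (a ℚ.* s)) ≡ c ℚ.* a ℚ.* (k ℚ.* s)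
      shuffle₁ = solve 4 (λ k c a s → k :* (c :* (a :* s)) := c :* a :* (k :* s)) refl
      shuffle₂ : ∀ p c a s → p ℚ.* (c ℚ.* a ℚ.* s) ≡ c ℚ.* (p ℚ.* a ℚ.* s)
      shuffle₂ = solve 4 (λ p c a s → p :* (c :* a :* s) := c :* (p :* a :* s)) refl

-- Masses of isomorphism classes

ι : ℕ → ℚ
ι n = + n ℚ./ 1

-- Checked on unnormalised fractions, since the gcd normalisation of `ℚ` does not compute for a
-- variable `n`.
ι-suc : ∀ n → ι (suc n) ≡ 1ℚ ℚ.+ ι n
ι-suc n = ℚ.toℚᵘ-injective (begin
  ℚ.toℚᵘ (ι (suc n))              ≈⟨ ℚ.toℚᵘ-fromℚᵘ (ℚᵘ.mkℚᵘ (+ suc n) 0) ⟩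
  ℚᵘ.mkℚᵘ (+ suc n) 0             ≈⟨ ℚᵘ.*≡* (cong (ℤ._* + 1) (sym (cong₂ ℤ._+_ (ℤ.*-identityʳ (+ 1)) (ℤ.*-identityʳ (+ n))))) ⟩
  ℚᵘ.1ℚᵘ ℚᵘ.+ ℚᵘ.mkℚᵘ (+ n) 0     ≈⟨ ℚᵘ.+-congʳ ℚᵘ.1ℚᵘ (ℚᵘ.≃-sym (ℚ.toℚᵘ-fromℚᵘ (ℚᵘ.mkℚᵘ (+ n) 0))) ⟩
  ℚ.toℚᵘ 1ℚ ℚᵘ.+ ℚ.toℚᵘ (ι n)     ≈⟨ ℚᵘ.≃-sym (ℚ.toℚᵘ-homo-+ 1ℚ (ι n)) ⟩
  ℚ.toℚᵘ (1ℚ ℚ.+ ι n)             ∎)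
  where open ℚᵘ.≃-Reasoning

ι-+ : ∀ m n → ι (m ℕ.+ n) ≡ ι m ℚ.+ ι n
ι-+ zero    n = sym (ℚ.+-identityˡ (ι n))
ι-+ (suc m) n = trans (ι-suc (m ℕ.+ n)) (trans (cong (1ℚ ℚ.+_) (ι-+ m n))
  (trans (sym (ℚ.+-assoc 1ℚ (ι m) (ι n))) (cong (ℚ._+ ι n) (sym (ι-suc m)))))

ι-* : ∀ m n → ι (m ℕ.* n) ≡ ι m ℚ.* ι n
ι-* zero    n = sym (ℚ.*-zeroˡ (ι n))
ι-* (suc m) n = trans (ι-+ n (m ℕ.* n)) (trans (cong₂ ℚ._+_ (sym (ℚ.*-identityˡ (ι n))) (ι-* m n))
  (trans (sym (ℚ.*-distribʳ-+ (ι n) 1ℚ (ι m))) (cong (ℚ._* ι n) (sym (ι-suc m)))))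

ι-sum : ∀ {n} (f : Fin n → ℕ) → ι (ΣN.sum f) ≡ ΣQ.sum (ι ∘ f)
ι-sum {zero}  f = refl
ι-sum {suc n} f = trans (ι-+ (f zero) _) (cong (ι (f zero) ℚ.+_) (ι-sum (f ∘ suc)))

ι-prod : ∀ {n} (f : Fin n → ℕ) → ι (ΣN.prod f) ≡ ΣQ.prod (ι ∘ f)
ι-prod {zero}  f = refl
ι-prod {suc n} f = trans (ι-* (f zero) _) (cong (ι (f zero) ℚ.*_) (ι-prod (f ∘ suc)))

-- The element of `Fin n` rules out `n = 0`, where `inv` takes its default 0. For automorphism
-- counts the identity supplies it.
inv-ι : ∀ {n} → Fin n → inv n ℚ.* ι n ≡ 1ℚ
inv-ι {suc k} _ = ℚ.toℚᵘ-injective (begin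
  ℚ.toℚᵘ (inv (suc k) ℚ.* ι (suc k))
    ≈⟨ ℚ.toℚᵘ-homo-* (inv (suc k)) (ι (suc k)) ⟩
  ℚ.toℚᵘ (inv (suc k)) ℚᵘ.* ℚ.toℚᵘ (ι (suc k))
    ≈⟨ ℚᵘ.*-cong (ℚ.toℚᵘ-fromℚᵘ (ℚᵘ.mkℚᵘ (+ 1) k)) (ℚ.toℚᵘ-fromℚᵘ (ℚᵘ.mkℚᵘ (+ suc k) 0)) ⟩
  ℚᵘ.mkℚᵘ (+ 1) k ℚᵘ.* ℚᵘ.mkℚᵘ (+ suc k) 0
    ≈⟨ ℚᵘ.*≡* (trans (ℤ.*-identityʳ (+ 1 ℤ.* + suc k)) (trans (ℤ.*-identityˡ (+ suc k))
         (sym (trans (ℤ.*-identityˡ (+ (suc k ℕ.* 1))) (cong +_ (ℕ.*-identityʳ (suc k))))))) ⟩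
  ℚᵘ.1ℚᵘ ∎)
  where open ℚᵘ.≃-Reasoning

inv-Card : ∀ {S n} → Card S n → Setoid.Carrier S → inv n ℚ.* ι n ≡ 1ℚ
inv-Card c x = inv-ι (proj₁ (at-surj (isEnum c) x))

AIso-refl : ∀ A → AIso A A
AIso-refl A = record { σ = ↔-id _ ; τ = ↔-id _ ; ε = λ _ → false ; compat = λ _ → refl }

aut-Card : ∀ G → Card (AIsoSetoid ⌜ G ⌝ ⌜ G ⌝) (autCount G)
aut-Card G = Card-map (Restrict (IsoSetoid G G) (λ _ → true ≡ true)) (AIsoSetoid ⌜ G ⌝ ⌜ G ⌝) (fromIso ∘ proj₁)
  id id (λ f → (toIso f , refl) , (λ _ → refl) , (λ _ → refl) , (λ _ → refl))
  (autCountWith-Card G (λ _ → true) (λ _ → refl))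

autR-Card : ∀ T → Card (RootedSetoid T T) (autCountR T)
autR-Card T = Card-map (Restrict (IsoSetoid G G) (λ f → eqF (Inverse.to (Iso.σ f) r) r ≡ true)) (RootedSetoid T T)
  (λ (f , p) → fromIso f , true⇒dec (_ Fin.≟ r) p) id id
  (λ (f , p) → (toIso f , dec⇒true (_ Fin.≟ r) p) , (λ _ → refl) , (λ _ → refl) , (λ _ → refl))
  (autCountWith-Card G (λ σ → eqF (σ r) r) (λ e → cong (λ x → eqF x r) (e r)))
  where
  G = tree T
  r = root T

Card-rooted : ∀ {T U W} (h : AIso ⌜ tree U ⌝ ⌜ tree W ⌝) → σ→ h (root U) ≡ root W →
              ∀ {n} → Card (RootedSetoid T U) n → Card (RootedSetoid T W) n
Card-rooted {T} {U} {W} h hr = Card-map (RootedSetoid T U) (RootedSetoid T W)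
  (λ (f , p) → AIso-trans f h , trans (cong (σ→ h) p) hr)
  (λ {f} {g} → postcompose-cong h {f = proj₁ f} {proj₁ g}) (λ {f} {g} → postcompose-inj h {f = proj₁ f} {proj₁ g})
  (λ (g , p) → (AIso-trans g (AIso-sym h) ,
      trans (cong (σ← h) (trans p (sym hr))) (Inverse.strictlyInverseʳ (AIso.σ h) (root U)))
    , postcompose-sym h g)

prod-χ : ∀ {n} (f : Fin n → Bool) → ΣQ.prod (χ ∘ f) ≡ 0ℚ ⊎ (∀ i → f i ≡ true)
prod-χ {zero}  f = inj₂ λ ()
prod-χ {suc n} f with f zero in eq | prod-χ (f ∘ suc)
... | false | _      = inj₁ (ℚ.*-zeroˡ (ΣQ.prod (χ ∘ f ∘ suc)))
... | true  | inj₁ p = inj₁ (trans (ℚ.*-identityˡ _) p)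
... | true  | inj₂ p = inj₂ λ { zero → eq ; (suc i) → p i }

agree⁻ : ∀ {x y} → agree x y ≡ true → x ≡ y
agree⁻ {true}  {true}  e = refl
agree⁻ {false} {false} e = refl

agree⁺ : ∀ {x y} → x ≡ y → agree x y ≡ true
agree⁺ {true}  refl = refl
agree⁺ {false} refl = refl

module RepTrees (RT : ℕ → List RootedTree)
  (repT : ∀ m → IsRepSystem RIso (λ T → IsRootedTree T × nv (tree T) ≡ m) (RT m)) (N : ℕ) where

  count : Fin (suc N) → ℕ
  count m = length (RT (toℕ m))

  K : ℕ
  K = ΣN.sum count

  -- One numbering of the representatives of all sizes up to `N`, so that a tuple of trees of mixed
  -- sizes is a vector over a single finite set.
  tr : Fin K → RootedTree
  tr j = let (m , i) = decΣ count j in lookup (RT (toℕ m)) i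

  private
    rep : ∀ m i → IsRootedTree (lookup (RT m) i) × nv (tree (lookup (RT m) i)) ≡ m
    rep m i = All.lookup (IsRepSystem.allP (repT m)) (∈-lookup {xs = RT m} i)

  tr-isTree : ∀ j → IsRootedTree (tr j)
  tr-isTree j = let (m , i) = decΣ count j in proj₁ (rep (toℕ m) i)

  tr-complete : ∀ U → IsRootedTree U → nv (tree U) ℕ.≤ N → ∃ λ j → RIso U (tr j)
  tr-complete U isT ≤N = encΣ count m′ (proj₁ found) , subst (RIso U) (sym tr-enc) (proj₂ found)
    where
    m′ : Fin (suc N)
    m′ = fromℕ< (s≤s ≤N)
    found : ∃ λ i → RIso U (lookup (RT (toℕ m′)) i)
    found = IsRepSystem.complete (repT (toℕ m′)) U (isT , sym (Fin.toℕ-fromℕ< (s≤s ≤N)))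
    tr-enc : tr (encΣ count m′ (proj₁ found)) ≡ lookup (RT (toℕ m′)) (proj₁ found)
    tr-enc = cong (λ (m , i) → lookup (RT (toℕ m)) i) (dec-encΣ count m′ (proj₁ found))

  tr-distinct : ∀ j k → RIso (tr j) (tr k) → j ≡ k
  tr-distinct j k r = trans (sym (enc-decΣ count j))
    (trans (cong (uncurry (encΣ count)) (same (decΣ count j) (decΣ count k) r)) (enc-decΣ count k))
    where
    T : Σ (Fin (suc N)) (Fin ∘ count) → RootedTree
    T (m , i) = lookup (RT (toℕ m)) i
    same : ∀ p q → RIso (T p) (T q) → p ≡ q
    same (m , i) (m′ , i′) r
      with Fin.toℕ-injective (trans (sym (proj₂ (rep (toℕ m) i))) (trans (↔⇒≡ (Iso.σ (RIso.iso r))) (proj₂ (rep (toℕ m′) i′))))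
    ... | refl = cong (m ,_) (IsRepSystem.distinct (repT (toℕ m)) i i′ r)

  RT-sum : ∀ {m} → m ℕ.≤ N → (H : RootedTree → ℚ) →
           ΣQ.∑ (RT m) H ≡ ΣQ.sum (λ j → χ ⌊ nv (tree (tr j)) ℕ.≟ m ⌋ ℚ.* H (tr j))
  RT-sum {m} m≤N H = sym (begin
    ΣQ.sum (λ j → X (tr j))
      ≡⟨ ΣQ.sum-Σ count (λ j → X (tr j)) ⟩
    ΣQ.sum {suc N} (λ k → ΣQ.sum (λ i → X (tr (encΣ count k i))))
      ≡⟨ ΣQ.sum-cong-≋ {suc N} (λ k → ΣQ.sum-cong-≋ λ i →
           cong (λ (m , i) → X (lookup (RT (toℕ m)) i)) (dec-encΣ count k i)) ⟩
    ΣQ.sum {suc N} (λ k → ΣQ.∑ (RT (toℕ k)) X)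
      ≡⟨ ΣQ.sum-single m′ (λ k k≢ → ΣQ.sum-zero λ i → trans (cong (λ b → χ b ℚ.* H (lookup (RT (toℕ k)) i))
           (dec⇒false (nv (tree (lookup (RT (toℕ k)) i)) ℕ.≟ m) λ e →
             k≢ (Fin.toℕ-injective (trans (sym (proj₂ (rep (toℕ k) i))) (trans e (sym m′≡))))))
           (ℚ.*-zeroˡ (H (lookup (RT (toℕ k)) i)))) ⟩
    ΣQ.∑ (RT (toℕ m′)) X
      ≡⟨ cong (λ k → ΣQ.∑ (RT k) X) m′≡ ⟩
    ΣQ.∑ (RT m) X
      ≡⟨ ΣQ.sum-cong-≋ (λ i → trans (cong (λ b → χ b ℚ.* H (lookup (RT m) i))
           (dec⇒true (nv (tree (lookup (RT m) i)) ℕ.≟ m) (proj₂ (rep m i)))) (ℚ.*-identityˡ (H (lookup (RT m) i)))) ⟩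
    ΣQ.∑ (RT m) H ∎)
    where
    open ≡.≡-Reasoning
    m′ : Fin (suc N)
    m′ = fromℕ< (s≤s m≤N)
    m′≡ : toℕ m′ ≡ m
    m′≡ = Fin.toℕ-fromℕ< (s≤s m≤N)
    X : RootedTree → ℚ
    X T = χ ⌊ nv (tree T) ℕ.≟ m ⌋ ℚ.* H T

  α : Fin K → ℚ
  α j = inv (autCountR (tr j))

  open Products tr α N public

  κ : Bool → ∀ j → Col (tr j) → ℚ
  κ b j d = χ (agree (d (root (tr j))) b)

  slot : ∀ p b → Slot (slotSeries RT p b) (κ b) (λ j → shiftedExp p (tr j))
  slot p b m m≤N φ = trans (eval-slot φ RT p b m) (RT-sum m≤N (slotSum φ p b))

  module _ {n} (c : Fin n → Bool) where
    parity : Fin n → Bool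
    parity i = isEven (blackCount (cycle n) c i)

    κs : ∀ (i : Fin n) j → Col (tr j) → ℚ
    κs i = κ (c i)

    xs : ∀ (i : Fin n) j → Col (tr j) → ℤ
    xs i j = shiftedExp (parity i) (tr j)

  -- Only the colouring of the cycle by the root colours contributes.
  colSum-colorings : ∀ φ {n} (t : Vec (Fin K) n) →
    ΣQ.∑ (colorings (cycle n)) (λ c → colSum (κs c) (xs c) φ t) ≡ weight φ (glue (trees t))
  colSum-colorings φ {n} t = trans (ΣQ.∑-swap (colorings (cycle n)) (allColΠ n T) F)
    (trans (ΣQ.∑-cong (allColΠ n T) per) (weight-glue φ T))
    where
    T = trees t
    E : (Fin n → Bool) → (∀ i → Col (T i)) → ℤ
    E c d = ΣZ.sum (λ i → shiftedExp (isEven (blackCount (cycle n) c i)) (T i) (d i))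
    F : (Fin n → Bool) → (∀ i → Col (T i)) → ℚ
    F c d = ΣQ.prod (λ i → χ (agree (d i (root (T i))) (c i))) ℚ.* φ (E c d)
    per : ∀ d → ΣQ.∑ (colorings (cycle n)) (λ c → F c d) ≡ φ (E (rootCol T d) d)
    per d = trans (ΣQ.sum-single i₀ λ i i≢ → [ (λ z → trans (cong (ℚ._* φ (E (c i) d)) z) (ℚ.*-zeroˡ (φ (E (c i) d))))
                                           , (λ all → contradiction (at-inj en i i₀ λ x → trans (sym (agree⁻ (all x))) (sym (c₀≗ x))) i≢) ]′
                                           (prod-χ (λ x → agree (rootCol T d x) (c i x))))
      (trans (cong (ℚ._* φ (E (c i₀) d)) (ΣQ.prod-one λ x → cong χ (agree⁺ (sym (c₀≗ x))))) (trans (ℚ.*-identityˡ _)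
        (cong φ (ΣZ.sum-cong-≋ λ i → cong (λ k → shiftedExp (isEven k) (T i) (d i)) (blackCount-cong (cycle n) c₀≗ i)))))
      where
      en : IsEnum (Fin n →-setoid Bool) (lookup (colorings (cycle n)))
      en = colorings-isEnum (cycle n)
      c : Fin (length (colorings (cycle n))) → Fin n → Bool
      c = lookup (colorings (cycle n))
      i₀ = proj₁ (at-surj en (rootCol T d))
      c₀≗ : c i₀ ≗ rootCol T d
      c₀≗ = proj₂ (at-surj en (rootCol T d))

  eval-substW-weights : ∀ φ n → eval φ (substW RT n N) ≡
    ΣQ.∑ (allVecs n (allFin K)) (λ t → χ ⌊ size t ℕ.≟ N ⌋ ℚ.* (A t ℚ.* weight φ (glue (trees t))))
  eval-substW-weights φ n = begin
    eval φ (substW RT n N)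
      ≡⟨ eval-substW φ RT n N ⟩
    ΣQ.∑ C (λ c → eval φ (prodS (tabulate (λ i → slotSeries RT (parity c i) (c i))) N))
      ≡⟨ ΣQ.∑-cong C (λ c → eval-prodS n (λ i → slotSeries RT (parity c i) (c i)) (κs c) (xs c)
           (λ i → slot (parity c i) (c i)) N ℕ.≤-refl φ) ⟩
    ΣQ.∑ C (λ c → ΣQ.∑ Ts (λ t → χ ⌊ size t ℕ.≟ N ⌋ ℚ.* (A t ℚ.* colSum (κs c) (xs c) φ t)))
      ≡⟨ ΣQ.∑-swap C Ts (λ c t → χ ⌊ size t ℕ.≟ N ⌋ ℚ.* (A t ℚ.* colSum (κs c) (xs c) φ t)) ⟩
    ΣQ.∑ Ts (λ t → ΣQ.∑ C (λ c → χ ⌊ size t ℕ.≟ N ⌋ ℚ.* (A t ℚ.* colSum (κs c) (xs c) φ t)))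
      ≡⟨ ΣQ.∑-cong Ts (λ t → trans (sym (ΣQ.∑-*ˡ C (χ ⌊ size t ℕ.≟ N ⌋) (λ c → A t ℚ.* colSum (κs c) (xs c) φ t)))
           (cong (χ ⌊ size t ℕ.≟ N ⌋ ℚ.*_) (trans (sym (ΣQ.∑-*ˡ C (A t) (λ c → colSum (κs c) (xs c) φ t)))
             (cong (A t ℚ.*_) (colSum-colorings φ t))))) ⟩
    ΣQ.∑ Ts (λ t → χ ⌊ size t ℕ.≟ N ⌋ ℚ.* (A t ℚ.* weight φ (glue (trees t)))) ∎
    where
    open ≡.≡-Reasoning
    C = colorings (cycle n)
    Ts = allVecs n (allFin K)

  -- The number of rooted isomorphisms from `tr j` to a tree of type `k`: such isomorphisms form a
  -- torsor under the automorphisms of `tr j`, or there are none.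
  homCount : Fin K → Fin K → ℕ
  homCount k j = if ⌊ k Fin.≟ j ⌋ then autCountR (tr j) else 0

  hom-Card : ∀ {U} k → RIso U (tr k) → ∀ j → Card (RootedSetoid (tr j) U) (homCount k j)
  hom-Card {U} k r j with k Fin.≟ j
  ... | yes refl = Card-rooted {tr k} {tr k} {U} (AIso-sym (fromIso (RIso.iso r)))
    (trans (cong (Inverse.from (Iso.σ (RIso.iso r))) (sym (RIso.rootPres r))) (Inverse.strictlyInverseʳ (Iso.σ (RIso.iso r)) (root U)))
    (autR-Card (tr k))
  ... | no k≢j = Card-empty (RootedSetoid (tr j) U) λ (f , p) → k≢j (sym (tr-distinct j k (record
    { iso = toIso (AIso-trans f (fromIso (RIso.iso r)))
    ; rootPres = trans (cong (Inverse.to (Iso.σ (RIso.iso r))) p) (RIso.rootPres r) })))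

  -- Exactly one representative has type `k`, and its isomorphisms are as many as its automorphisms,
  -- which cancels the weight `α k`.
  hom-sum : ∀ k → ΣQ.∑ (allFin K) (λ j → α j ℚ.* ι (homCount k j)) ≡ 1ℚ
  hom-sum k = trans (ΣQ.∑-tabulate id (λ j → α j ℚ.* ι (homCount k j)))
    (trans (ΣQ.sum-single k λ j j≢k → trans (cong (λ b → α j ℚ.* ι (if b then autCountR (tr j) else 0))
              (dec⇒false (k Fin.≟ j) (j≢k ∘ sym))) (ℚ.*-zeroʳ (α j)))
      (trans (cong (λ b → α k ℚ.* ι (if b then autCountR (tr k) else 0)) (dec⇒true (k Fin.≟ k) refl))
        (inv-Card (autR-Card (tr k)) (AIso-refl ⌜ tree (tr k) ⌝ , refl))))

  trees-isTree : ∀ {n} (t : Vec (Fin K) n) i → IsRootedTree (trees t i)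
  trees-isTree t i = tr-isTree (Vec.lookup t i)

*-left-comm : ∀ x y z → x ℚ.* (y ℚ.* z) ≡ y ℚ.* (x ℚ.* z)
*-left-comm x y z = trans (sym (ℚ.*-assoc x y z)) (trans (cong (ℚ._* z) (ℚ.*-comm x y)) (ℚ.*-assoc y x z))

ι-sum-1 : ∀ k → ΣQ.sum {k} (λ _ → 1ℚ) ≡ ι k
ι-sum-1 zero    = refl
ι-sum-1 (suc k) = trans (cong (1ℚ ℚ.+_) (ι-sum-1 k)) (sym (ι-suc k))

-- For fixed `i` the summand factors over the positions, and each position sums to 1. Every `i`
-- therefore contributes 1.
∑-sum-prod : ∀ {X : Set} (L : List X) {k n} (a : X → ℚ) (b : Fin k → Fin n → X → ℚ) →
  (∀ i j → ΣQ.∑ L (λ x → a x ℚ.* b i j x) ≡ 1ℚ) →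
  ΣQ.∑ (allVecs n L) (λ t → ΣQ.prod (λ j → a (Vec.lookup t j)) ℚ.* ΣQ.sum (λ i → ΣQ.prod (λ j → b i j (Vec.lookup t j)))) ≡ ι k
∑-sum-prod L {k} {n} a b one = begin
  ΣQ.∑ Ts (λ t → ΣQ.prod (λ j → a (Vec.lookup t j)) ℚ.* ΣQ.sum (λ i → P i t))
    ≡⟨ ΣQ.∑-cong Ts (λ t → trans (ΣQ.*-distribˡ-sum (ΣQ.prod (λ j → a (Vec.lookup t j))) (λ i → P i t))
         (ΣQ.sum-cong-≋ λ i → sym (ΣQ.prod-distrib-* (λ j → a (Vec.lookup t j)) (λ j → b i j (Vec.lookup t j))))) ⟩
  ΣQ.∑ Ts (λ t → ΣQ.sum (λ i → ΣQ.prod (λ j → W i j (Vec.lookup t j))))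
    ≡⟨ ΣQ.∑-comm (λ s i → ΣQ.prod (λ j → W i j (Vec.lookup (lookup Ts s) j))) ⟩
  ΣQ.sum (λ i → ΣQ.∑ Ts (λ t → ΣQ.prod (λ j → W i j (Vec.lookup t j))))
    ≡⟨ ΣQ.sum-cong-≋ (λ i → trans (ΣQ.∑-prod n L (W i)) (ΣQ.prod-one (one i))) ⟩
  ΣQ.sum {k} (λ _ → 1ℚ)
    ≡⟨ ι-sum-1 k ⟩
  ι k ∎
  where
  open ≡.≡-Reasoning
  Ts = allVecs n L
  W : Fin k → Fin n → _ → ℚ
  W i j x = a x ℚ.* b i j x
  P : Fin k → Vec _ n → ℚ
  P i t = ΣQ.prod (λ j → b i j (Vec.lookup t j))

*-∑-sum : ∀ {X : Set} c (L : List X) (a : X → ℚ) {k} (b : X → Fin k → ℚ) (w : Fin k → ℚ) →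
  c ℚ.* ΣQ.∑ L (λ x → a x ℚ.* ΣQ.sum (λ i → b x i ℚ.* w i)) ≡
  ΣQ.sum (λ i → c ℚ.* ΣQ.∑ L (λ x → a x ℚ.* b x i) ℚ.* w i)
*-∑-sum c L a b w = begin
  c ℚ.* ΣQ.∑ L (λ x → a x ℚ.* ΣQ.sum (λ i → b x i ℚ.* w i))
    ≡⟨ cong (c ℚ.*_) (ΣQ.∑-cong L λ x → trans (ΣQ.*-distribˡ-sum (a x) (λ i → b x i ℚ.* w i))
         (ΣQ.sum-cong-≋ λ i → sym (ℚ.*-assoc (a x) (b x i) (w i)))) ⟩
  c ℚ.* ΣQ.∑ L (λ x → ΣQ.sum (λ i → a x ℚ.* b x i ℚ.* w i))
    ≡⟨ cong (c ℚ.*_) (ΣQ.∑-comm (λ s i → a (lookup L s) ℚ.* b (lookup L s) i ℚ.* w i)) ⟩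
  c ℚ.* ΣQ.sum (λ i → ΣQ.∑ L (λ x → a x ℚ.* b x i ℚ.* w i))
    ≡⟨ ΣQ.*-distribˡ-sum c (λ i → ΣQ.∑ L (λ x → a x ℚ.* b x i ℚ.* w i)) ⟩
  ΣQ.sum (λ i → c ℚ.* ΣQ.∑ L (λ x → a x ℚ.* b x i ℚ.* w i))
    ≡⟨ ΣQ.sum-cong-≋ (λ i → trans (cong (c ℚ.*_) (sym (ΣQ.∑-*ʳ L (w i) (λ x → a x ℚ.* b x i))))
         (sym (ℚ.*-assoc c (ΣQ.∑ L (λ x → a x ℚ.* b x i)) (w i)))) ⟩
  ΣQ.sum (λ i → c ℚ.* ΣQ.∑ L (λ x → a x ℚ.* b x i) ℚ.* w i) ∎
  where open ≡.≡-Reasoning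

-- Summation over the unicyclic graphs

module UnicyclicSum (RT : ℕ → List RootedTree)
  (repT : ∀ m → IsRepSystem RIso (λ T → IsRootedTree T × nv (tree T) ≡ m) (RT m))
  (RG : ℕ → List Graph)
  (repG : ∀ N → IsRepSystem Iso (λ G → Connected G × betti G ≡ + 1 × nv G ≡ N) (RG N)) (N : ℕ) where

  open RepTrees RT repT N

  private
    G : Fin (length (RG N)) → Graph
    G = lookup (RG N)

    G-spec : ∀ g → Connected (G g) × betti (G g) ≡ + 1 × nv (G g) ≡ N
    G-spec g = All.lookup (IsRepSystem.allP (repG N)) (∈-lookup {xs = RG N} g)

  glued-rep : ∀ {n} (t : Vec (Fin K) (suc n)) → size t ≡ N → ∃ λ g → AIso (Glued (trees t)) ⌜ G g ⌝
  glued-rep t p =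
    let (g , f) = IsRepSystem.complete (repG N) (glue (trees t))
          (glue-Connected (trees t) (trees-isTree t) zero , glue-betti (trees t) (trees-isTree t) , p)
    in g , AIso-trans (AIso-sym (glue-AIso (trees t))) (fromIso f)

  -- The decision is an argument so that proofs can match on it: a representative of the glued graph
  -- is available only from a proof that its size is `N`.
  isoCount : ∀ {n} (t : Vec (Fin K) (suc n)) → Fin (length (RG N)) → Dec (size t ≡ N) → ℕ
  isoCount t g (yes p) = if ⌊ proj₁ (glued-rep t p) Fin.≟ g ⌋ then autCount (G g) else 0
  isoCount t g (no _)  = 0

  iso-Card : ∀ {n} (t : Vec (Fin K) (suc n)) g p? → Card (AIsoSetoid (Glued (trees t)) ⌜ G g ⌝) (isoCount t g p?)
  iso-Card t g (no ¬p) = Card-empty (AIsoSetoid (Glued (trees t)) ⌜ G g ⌝) λ f →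
    ¬p (trans (↔⇒≡ (AIso.σ (AIso-trans (glue-AIso (trees t)) f))) (proj₂ (proj₂ (G-spec g))))
  iso-Card t g (yes p) = go (proj₁ (glued-rep t p)) (proj₂ (glued-rep t p)) (proj₁ (glued-rep t p) Fin.≟ g)
    where
    go : ∀ g′ → AIso (Glued (trees t)) ⌜ G g′ ⌝ → (d : Dec (g′ ≡ g)) →
         Card (AIsoSetoid (Glued (trees t)) ⌜ G g ⌝) (if ⌊ d ⌋ then autCount (G g) else 0)
    go g′ f (yes refl) = Card-precompose f (aut-Card (G g))
    go g′ f (no g′≢g)  = Card-empty (AIsoSetoid (Glued (trees t)) ⌜ G g ⌝) λ h →
      g′≢g (IsRepSystem.distinct (repG N) g′ g (toIso (AIso-trans (AIso-sym f) h)))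

  isos : ∀ {n} → Vec (Fin K) (suc n) → Fin (length (RG N)) → ℚ
  isos t g = ι (isoCount t g (size t ℕ.≟ N))

  -- A glued graph of size `N` is isomorphic to one representative only, by as many isomorphisms as
  -- that has automorphisms. Writing its weight through these isomorphisms allows the sum to be
  -- regrouped by graphs.
  weight-isos : ∀ φ {n} (t : Vec (Fin K) (suc n)) → χ ⌊ size t ℕ.≟ N ⌋ ℚ.* weight φ (glue (trees t)) ≡
    ΣQ.sum (λ g → isos t g ℚ.* (inv (autCount (G g)) ℚ.* weight φ (G g)))
  weight-isos φ t = go (size t ℕ.≟ N)
    where
    go : ∀ p? → χ ⌊ p? ⌋ ℚ.* weight φ (glue (trees t)) ≡
         ΣQ.sum (λ g → ι (isoCount t g p?) ℚ.* (inv (autCount (G g)) ℚ.* weight φ (G g)))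
    go (no _)  = trans (ℚ.*-zeroˡ (weight φ (glue (trees t)))) (sym (ΣQ.sum-zero λ g → ℚ.*-zeroˡ (inv (autCount (G g)) ℚ.* weight φ (G g))))
    go (yes p) = sym (trans (ΣQ.sum-single g₀ λ g g≢ →
        trans (cong (λ b → ι (if b then autCount (G g) else 0) ℚ.* (inv (autCount (G g)) ℚ.* weight φ (G g)))
          (dec⇒false (g₀ Fin.≟ g) (g≢ ∘ sym))) (ℚ.*-zeroˡ (inv (autCount (G g)) ℚ.* weight φ (G g))))
      (trans (cong (λ b → ι (if b then a else 0) ℚ.* (inv a ℚ.* weight φ (G g₀))) (dec⇒true (g₀ Fin.≟ g₀) refl))
      (trans (sym (ℚ.*-assoc (ι a) (inv a) (weight φ (G g₀))))
      (cong₂ ℚ._*_ (trans (ℚ.*-comm (ι a) (inv a)) (inv-Card (aut-Card (G g₀)) (AIso-refl ⌜ G g₀ ⌝)))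
        (sym (weight-Iso φ (AIso-trans (glue-AIso (trees t)) (proj₂ (glued-rep t p)))))))))
      where
      g₀ = proj₁ (glued-rep t p)
      a = autCount (G g₀)

  module _ (g : Fin (length (RG N))) {m} {S : Fin (suc m) → RootedTree} (S-tree : ∀ i → IsRootedTree (S i))
    (f : AIso (Glued S) ⌜ G g ⌝) where
    private
      -- Applied to the vertices of one tree, it places that tree among the `tr j`; applied to the
      -- roots, it bounds the cycle length.
      ≤N : ∀ {k} {h : Fin k → Vtx (Glued S)} → Injective _≡_ _≡_ h → k ℕ.≤ N
      ≤N h-inj = subst (_ ℕ.≤_) (proj₂ (proj₂ (G-spec g))) (Fin.injective⇒≤ (h-inj ∘ ↔-injective (AIso.σ f)))

      idx : ∀ i → ∃ λ j → RIso (S i) (tr j)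
      idx i = tr-complete (S i) (S-tree i) (≤N {h = i ,_} Σ-injective₂)

      h : Fin (suc m) → Fin K → ℕ
      h i j = homCount (proj₁ (idx i)) j

      Aut : ℕ
      Aut = autCount (cycle (suc m))

      ψ : Fin Aut → Fin (suc m) → Fin (suc m)
      ψ a = σ→ (Card.at (aut-Card (cycle (suc m))) a)

    cycle-length< : m < N
    cycle-length< = ≤N {h = λ i → i , root (S i)} (cong proj₁)

    isos-zero : ∀ {n} → n ≢ m → (t : Vec (Fin K) (suc n)) → isos t g ≡ 0ℚ
    isos-zero n≢m t = cong ι (Card-unique (AIsoSetoid (Glued (trees t)) ⌜ G g ⌝) (iso-Card t g (size t ℕ.≟ N))
      (Card-empty (AIsoSetoid (Glued (trees t)) ⌜ G g ⌝) λ h →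
        n≢m (ℕ.suc-injective (glued-length {T = trees t} {S} (trees-isTree t) S-tree (AIso-trans h (AIso-sym f))))))

    isos-sum : (t : Vec (Fin K) (suc m)) → isos t g ≡ ΣQ.sum (λ a → ΣQ.prod (λ i → ι (h (ψ a i) (Vec.lookup t i))))
    isos-sum t = trans (cong ι (Card-unique (AIsoSetoid (Glued (trees t)) ⌜ G g ⌝) (iso-Card t g (size t ℕ.≟ N))
        (Card-postcompose f (Card-Glued {T = trees t} {S} (trees-isTree t) S-tree (aut-Card (cycle (suc m)))
          (λ i i′ → h i′ (Vec.lookup t i)) (λ i i′ → hom-Card (proj₁ (idx i′)) (proj₂ (idx i′)) (Vec.lookup t i))))))
      (trans (ι-sum (λ a → ΣN.prod (λ i → h (ψ a i) (Vec.lookup t i))))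
        (ΣQ.sum-cong-≋ λ a → ι-prod (λ i → h (ψ a i) (Vec.lookup t i))))

    -- By `hom-sum` at every position, each automorphism of the cycle contributes total weight 1;
    -- there are `Aut` of them.
    isos-mass : inv Aut ℚ.* ΣQ.∑ (allVecs (suc m) (allFin K)) (λ t → A t ℚ.* isos t g) ≡ 1ℚ
    isos-mass = trans (cong (inv Aut ℚ.*_) (trans
        (ΣQ.∑-cong (allVecs (suc m) (allFin K)) λ t → cong (A t ℚ.*_) (isos-sum t))
        (∑-sum-prod (allFin K) α (λ a i j → ι (h (ψ a i) j)) λ a i → hom-sum (proj₁ (idx (ψ a i))))))
      (inv-Card (aut-Card (cycle (suc m))) (AIso-refl ⌜ cycle (suc m) ⌝))

  term : Fin (length (RG N)) → ℕ → ℚ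
  term g n = inv (autCount (cycle (suc n))) ℚ.* ΣQ.∑ (allVecs (suc n) (allFin K)) (λ t → A t ℚ.* isos t g)

  -- Each automorphism of the cycle leaves one choice for the isomorphism type of every tree.
  mass : ∀ g → ΣQ.sum (λ (n : Fin N) → term g (toℕ n)) ≡ 1ℚ
  mass g = go (decompose (G g) (proj₁ (G-spec g)) (ℕ.suc-injective (sym (betti⇒ {G g} (proj₁ (proj₂ (G-spec g)))))))
    where
    go : (∃ λ m → ∃ λ (S : Fin (suc m) → RootedTree) → (∀ i → IsRootedTree (S i)) × AIso (Glued S) ⌜ G g ⌝) →
         ΣQ.sum (λ (n : Fin N) → term g (toℕ n)) ≡ 1ℚ
    -- The cycle length is an isomorphism invariant, so only the term of the decomposition found
    -- survives; `m<N` puts it inside the summation range, whose index is the length minus 1.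
    go (m , S , S-tree , f) = trans (ΣQ.sum-single (fromℕ< m<N) λ n n≢ → other (toℕ n) λ n≡m →
        n≢ (Fin.toℕ-injective (trans n≡m (sym (Fin.toℕ-fromℕ< m<N)))))
      (trans (cong (term g) (Fin.toℕ-fromℕ< m<N)) (isos-mass g {S = S} S-tree f))
      where
      m<N : m < N
      m<N = cycle-length< g {S = S} S-tree f
      other : ∀ n → n ≢ m → term g n ≡ 0ℚ
      other n n≢m = trans (cong (inv (autCount (cycle (suc n))) ℚ.*_) (ΣQ.sum-zero λ k →
          let t = lookup (allVecs (suc n) (allFin K)) k in
          trans (cong (A t ℚ.*_) (isos-zero g {S = S} S-tree f n≢m t)) (ℚ.*-zeroʳ (A t))))
        (ℚ.*-zeroʳ (inv (autCount (cycle (suc n)))))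

  w : (ℤ → ℚ) → Fin (length (RG N)) → ℚ
  w φ g = inv (autCount (G g)) ℚ.* weight φ (G g)

  eval-term : ∀ φ n → eval φ (scaleLP (inv (autCount (cycle (suc n)))) (substW RT (suc n) N)) ≡
              ΣQ.sum (λ g → term g n ℚ.* w φ g)
  eval-term φ n = trans (eval-scale φ (inv (autCount (cycle (suc n)))) (substW RT (suc n) N))
    (trans (cong (inv (autCount (cycle (suc n))) ℚ.*_) (trans (eval-substW-weights φ (suc n))
        (ΣQ.∑-cong (allVecs (suc n) (allFin K)) λ t →
          trans (*-left-comm (χ ⌊ size t ℕ.≟ N ⌋) (A t) (weight φ (glue (trees t)))) (cong (A t ℚ.*_) (weight-isos φ t)))))
      (*-∑-sum (inv (autCount (cycle (suc n)))) (allVecs (suc n) (allFin K)) A isos (w φ)))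

  eval-substZ : ∀ φ → eval φ (substZ RT N) ≡ eval φ (W1 RG N)
  eval-substZ φ = begin
    eval φ (substZ RT N)
      ≡⟨ eval-concatMap φ (λ n → scaleLP (inv (autCount (cycle n))) (substW RT n N)) (map suc (upTo N)) ⟩
    ΣQ.∑ (map suc (upTo N)) F
      ≡⟨ trans (ΣQ.∑-map suc (upTo N) F) (ΣQ.∑-applyUpTo id N (F ∘ suc)) ⟩
    ΣQ.sum (λ (n : Fin N) → F (suc (toℕ n)))
      ≡⟨ ΣQ.sum-cong-≋ {N} (λ n → eval-term φ (toℕ n)) ⟩
    ΣQ.sum (λ (n : Fin N) → ΣQ.sum (λ g → term g (toℕ n) ℚ.* w φ g))
      ≡⟨ ΣQ.∑-comm {N} (λ n g → term g (toℕ n) ℚ.* w φ g) ⟩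
    ΣQ.sum (λ g → ΣQ.sum (λ (n : Fin N) → term g (toℕ n) ℚ.* w φ g))
      ≡⟨ ΣQ.sum-cong-≋ (λ g → trans (sym (ΣQ.*-distribʳ-sum {N} (w φ g) (λ n → term g (toℕ n))))
           (trans (cong (ℚ._* w φ g) (mass g)) (ℚ.*-identityˡ (w φ g)))) ⟩
    ΣQ.sum (w φ)
      ≡⟨ sym (eval-W1 φ RG N) ⟩
    eval φ (W1 RG N) ∎
    where
    open ≡.≡-Reasoning
    F : ℕ → ℚ
    F n = eval φ (scaleLP (inv (autCount (cycle n))) (substW RT n N))

theorem4p14 : (RT : ℕ → List RootedTree) →
    (∀ m → IsRepSystem RIso (λ T → IsRootedTree T × nv (tree T) ≡ m) (RT m)) →
    (RG : ℕ → List Graph) →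
    (∀ N → IsRepSystem Iso (λ G → Connected G × betti G ≡ + 1 × nv G ≡ N) (RG N)) →
    ∀ (N : ℕ) (k : ℤ) → coeff (substZ RT N) k ≡ coeff (W1 RG N) k
theorem4p14 RT repT RG repG N k = trans (coeff-eval (substZ RT N) k)
  (trans (UnicyclicSum.eval-substZ RT repT RG repG N (λ e → χ ⌊ e ℤ.≟ k ⌋)) (sym (coeff-eval (W1 RG N) k)))
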